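{- For every integer $k\geq 1$, as formal power series in $q$ (whose coefficients are Laurent polynomials in $x_1,\ldots,x_k$), \[ \sum_{m_2,\ldots,m_{k+1}=-\infty}^{\infty}\sum_{n=0}^{\infty}D_{k+1}(0,m_2,\ldots,m_{k+1};n)\,x_1^{m_2}\cdots x_k^{m_{k+1}}q^n =\frac{1}{(q;q)_\infty}\sum_{n=1}^{\infty}(-1)^{n-1}q^{n(3n-1)/2+kn}\frac{1-q^n}{\prod_{j=1}^{k}(1-x_jq^n)(1-x_j^{ -1}q^n)}. \]
   Context: $(q;q)_\infty=\prod_{j\ge1}(1-q^j)$, and on the right-hand side each factor $1/((1-x_jq^n)(1-x_j^{ -1}q^n))$ is expanded as a power series in $q$. A partition $\lambda=(\lambda_1,\ldots,\lambda_s)$ has parts $\lambda_1\ge\cdots\ge\lambda_s\ge1$; $\ell(\lambda)=s$ and $|\lambda|$ is its sum. For a positive integer $K$, a $K$-marked Durfee symbol of $n$ is an array $\tau=\begin{pmatrix}\alpha^K,&\ldots,&\alpha^1\\ \beta^K,&\ldots,&\beta^1\end{pmatrix}_D$ consisting of $K$ pairs $(\alpha^j,\beta^j)$ of partitions and a positive integer $D$ such that: (1) $\alpha^j$ is nonempty for $1\le j<K$, while $\alpha^K$ and all $\beta^j$ may be empty; (2) for $2\le j\le K$, $\beta^{j-1}_1\le\alpha^{j-1}_1\le\min\{\alpha^j_s,\beta^j_s\}$, where $\alpha^j_s,\beta^j_s$ denote smallest parts (minimum over the nonempty ones) and $\beta^{j-1}_1$ the largest part of $\beta^{j-1}$ (vacuous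 if empty); (3) $\alpha^K_1,\beta^K_1\le D$; (4) $\sum_{j=1}^K(|\alpha^j|+|\beta^j|)+D^2=n$. The $j$-th rank is $\rho_j(\tau)=\ell(\alpha^j)-\ell(\beta^j)-1$ for $1\le j<K$ and $\rho_K(\tau)=\ell(\alpha^K)-\ell(\beta^K)$. $D_K(m_1,\ldots,m_K;n)$ denotes the number of $K$-marked Durfee symbols $\tau$ of $n$ with $\rho_j(\tau)=m_j$ for all $1\le j\le K$ (and is $0$ for $n=0$).
   Formalization: All parts of all α^j, β^j are also required to be at most D; this matters only when α^K and β^K are both empty, where condition (2) is a minimum over nothing and, read as vacuous, makes the identity false (k=1, n=3, α^1=(2), other partitions empty, D=1). -}

module Defs where

open import Data.Nat as ℕ using (ℕ; zero; suc; _≤_; _≥_; _∸_; _<_)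
open import Data.Nat.DivMod using (_/_)
open import Data.Integer as ℤ using (ℤ; +_; _-_; -_)
open import Data.Fin using (Fin)
open import Data.Nat.ListAction using (sum)
open import Data.List as List using (List; []; _∷_; _++_; length; head; last; upTo; allFin; foldr; concatMap)
open import Data.List.Relation.Unary.All as LAll using ()
open import Data.List.Relation.Unary.Linked using (Linked)
open import Data.Maybe.Relation.Unary.All as MAll using ()
open import Data.Vec as Vec using (Vec; []; _∷_; replicate; updateAt; zipWith)
open import Data.Vec.Relation.Unary.All as VAll using ()
open import Data.Vec.Properties using (≡-dec)
open import Data.Product using (_×_; _,_; proj₁; proj₂; Σ)
open import Data.Empty using (⊥)
open import Data.Bool using (if_then_else_)
open import Relation.Nullary.Decidable using (⌊_⌋)
open import Relation.Binary.PropositionalEquality using (_≡_)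
open import Function.Bundles using (_↔_)

HasSize : Set → ℕ → Set
HasSize A N = Fin N ↔ A

IsPartition : List ℕ → Set
IsPartition xs = Linked _≥_ xs × LAll.All (1 ≤_) xs

∣_∣ₚ : List ℕ → ℕ
∣ xs ∣ₚ = sum xs

-- K-marked Durfee symbols.
-- A symbol is stored as a vector of K pairs listed from j = 1 upward:
--   pairs = (α¹ , β¹) ∷ (α² , β²) ∷ ⋯ ∷ (αᴷ , βᴷ) ∷ []
-- together with the positive integer D.
-- `head xs` is the largest part (nothing if empty), `last xs` the smallest.

-- Condition (1) and (2) for consecutive pairs (j-1 , j), 2 ≤ j ≤ K:
--   α^{j-1} nonempty, β^{j-1}_1 ≤ α^{j-1}_1 ≤ min{α^j_s , β^j_s}
--   (comparisons with an empty partition being vacuous).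
Link : List ℕ × List ℕ → List ℕ × List ℕ → Set
Link ([] , β) _ = ⊥
Link (a ∷ as , β) (α′ , β′) =
  MAll.All (_≤ a) (head β) × MAll.All (a ≤_) (last α′) × MAll.All (a ≤_) (last β′)

Valid : ∀ {K} → Vec (List ℕ × List ℕ) K → ℕ → Set
Valid [] D = ⊥
Valid ((α , β) ∷ []) D = MAll.All (_≤ D) (head α) × MAll.All (_≤ D) (head β)
Valid (p ∷ p′ ∷ ps) D = Link p p′ × Valid (p′ ∷ ps) D

weight : ∀ {K} → Vec (List ℕ × List ℕ) K → ℕ
weight [] = 0
weight ((α , β) ∷ ps) = ∣ α ∣ₚ ℕ.+ ∣ β ∣ₚ ℕ.+ weight ps

record MarkedDurfee (K n : ℕ) : Set where
  constructor mkDurfee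
  field
    pairs   : Vec (List ℕ × List ℕ) K
    D       : ℕ
    D-pos   : 1 ≤ D
    parts   : VAll.All (λ p → IsPartition (proj₁ p) × IsPartition (proj₂ p)) pairs
    valid   : Valid pairs D
    -- Durfee-symbol convention (Andrews): every part of every α^j, β^j
    -- is ≤ D.  Together with `valid` this is the reading of (2) in which
    -- the minimum for j = K also involves D when α^K and β^K are both
    -- empty.
    bounded : VAll.All (λ p → LAll.All (_≤ D) (proj₁ p) × LAll.All (_≤ D) (proj₂ p)) pairs
    size    : weight pairs ℕ.+ D ℕ.* D ≡ n

ranks : ∀ {K} → Vec (List ℕ × List ℕ) K → Vec ℤ K
ranks [] = []
ranks ((α , β) ∷ []) = ((+ length α) - (+ length β)) ∷ []
ranks ((α , β) ∷ p ∷ ps) = ((+ length α) - (+ length β) - ℤ.1ℤ) ∷ ranks (p ∷ ps)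

DurfeeSet : (K : ℕ) → Vec ℤ K → ℕ → Set
DurfeeSet K ms n = Σ (MarkedDurfee K n) (λ τ → ranks (MarkedDurfee.pairs τ) ≡ ms)

-- Laurent polynomials in x₁,…,x_k with integer coefficients, as finite
-- formal sums of terms  c · x^e  (c ∈ ℤ, e ∈ ℤᵏ); only their coefficients
-- (coeffL) are ever compared.

LPoly : ℕ → Set
LPoly k = List (ℤ × Vec ℤ k)

module _ {k : ℕ} where

  zeroL : LPoly k
  zeroL = []

  constL : ℤ → LPoly k
  constL c = (c , replicate k (+ 0)) ∷ []

  oneL : LPoly k
  oneL = constL ℤ.1ℤ

  _+L_ : LPoly k → LPoly k → LPoly k
  p +L q = p ++ q

  negL : LPoly k → LPoly k
  negL = List.map (λ t → (- proj₁ t , proj₂ t))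

  _*L_ : LPoly k → LPoly k → LPoly k
  p *L q = concatMap (λ t → List.map (λ u → (proj₁ t ℤ.* proj₁ u , zipWith ℤ._+_ (proj₂ t) (proj₂ u))) q) p

  powL : LPoly k → ℕ → LPoly k
  powL p zero = oneL
  powL p (suc t) = p *L powL p t

  sumL : List (LPoly k) → LPoly k
  sumL = foldr _+L_ zeroL

  var : Fin k → LPoly k
  var j = (ℤ.1ℤ , updateAt (replicate k (+ 0)) j (λ _ → ℤ.1ℤ)) ∷ []

  varInv : Fin k → LPoly k
  varInv j = (ℤ.1ℤ , updateAt (replicate k (+ 0)) j (λ _ → ℤ.-1ℤ)) ∷ []

  coeffL : LPoly k → Vec ℤ k → ℤ
  coeffL p m = List.foldr ℤ._+_ (+ 0)
    (List.map (λ t → if ⌊ ≡-dec ℤ._≟_ (proj₂ t) m ⌋ then proj₁ t else + 0) p)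

-- Formal power series in q with Laurent-polynomial coefficients:
-- f n = coefficient of qⁿ.

PS : ℕ → Set
PS k = ℕ → LPoly k

module _ {k : ℕ} where

  monoQ : LPoly k → ℕ → PS k
  monoQ c d n = if ⌊ n ℕ.≟ d ⌋ then c else zeroL

  oneP : PS k
  oneP = monoQ oneL 0

  _+P_ : PS k → PS k → PS k
  (f +P g) n = f n +L g n

  _-P_ : PS k → PS k → PS k
  (f -P g) n = f n +L negL (g n)

  _*P_ : PS k → PS k → PS k
  (f *P g) n = sumL (List.map (λ i → f i *L g (n ∸ i)) (upTo (suc n)))

  sumP : List (PS k) → PS k
  sumP = foldr _+P_ (λ _ → zeroL)

  prodP : List (PS k) → PS k
  prodP = foldr _*P_ oneP

  -- 1 / (1 − c q^d) = Σ_{t ≥ 0} c^t q^{d t}, for d ≥ 1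
  -- (for d ≥ 1 only t ≤ n can contribute to qⁿ).
  geomP : LPoly k → ℕ → PS k
  geomP c d n = sumL (List.map (λ t → if ⌊ d ℕ.* t ℕ.≟ n ⌋ then powL c t else zeroL) (upTo (suc n)))

pent : ℕ → ℕ
pent n = (n ℕ.* (3 ℕ.* n ∸ 1)) / 2

rhsTerm : (k n : ℕ) → PS k
rhsTerm k n =
  monoQ (constL (ℤ.-1ℤ ℤ.^ (n ∸ 1))) (pent n ℕ.+ k ℕ.* n)
  *P ((oneP -P monoQ oneL n)
  *P prodP (List.map (λ j → geomP (var j) n *P geomP (varInv j) n) (allFin k)))

-- 1/(q;q)_∞ = ∏_{j ≥ 1} 1/(1 − q^j), truncated to j ≤ N
-- (factors with j > N are 1 + O(q^{N+1})).
invPochTo : (k N : ℕ) → PS k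
invPochTo k N = prodP (List.map (λ j → geomP oneL (suc j)) (upTo N))

-- Coefficient of x^m qᴺ in
--   (1/(q;q)_∞) Σ_{n ≥ 1} rhsTerm k n ;
-- the n-th summand is O(q^{n(3n−1)/2 + kn}) = O(q^{n}), so only n ≤ N contribute.
rhsCoeff : (k N : ℕ) → Vec ℤ k → ℤ
rhsCoeff k N m =
  coeffL ((invPochTo k N *P sumP (List.map (λ n → rhsTerm k (suc n)) (upTo N))) N) m

{-# OPTIONS --safe #-}
module Submission where

-- Let f_i(x) = 1/((1-xqⁱ)(1-x⁻¹qⁱ)), F_{c,a}(x) = ∏_{i=c}^{a} f_i(x) and b_n(a) = 1/((q)_{a-n} (q)_{a+n}).
-- With z marking ρ₁ and a_j denoting the largest part of αʲ, (k+1)-marked Durfee symbols are counted by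
--   Σ_D q^{D²} Σ_{a₁ ≤ … ≤ a_k ≤ D} q^{a₁+⋯+a_k} F_{1,a₁}(z) F_{a₁,a₂}(x₁) ⋯ F_{a_k,D}(x_k).
-- Partial fractions give F_{1,a}(z) = Σ_n (-1)ⁿ⁻¹ q^{n(n-1)/2} (1-qⁿ)(1-q²ⁿ) f_n(z) b_n(a) for a ≥ 1, and
-- the Bailey step Σ_a q^a b_n(a) F_{a,D}(x) = qⁿ f_n(x) b_n(D), applied k times, carries out the sums over
-- a₁, …, a_k. The sum over D is then Σ_D q^{D²} b_n(D) = q^{n²}/(q)_∞. Finally
-- (1-q²ⁿ) f_n(z) = Σ_s q^{n|s|} z^s has constant term 1 in z, which leaves the right-hand side.
--
-- Only coefficients of qⁱ with i ≤ N matter, so everything takes place in a ring where q^{N+1} = 0; there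
-- all infinite sums and products are finite, and 1-y has the inverse 1+y+⋯+yᴺ for every multiple y of q.

open import Defs
open import Data.Nat using (ℕ; suc; _≤_)
open import Data.Integer using (ℤ; +_)
open import Data.Vec using (Vec; _∷_)
open import Data.Product using (_×_; ∃-syntax)
open import Relation.Binary.PropositionalEquality using (_≡_)
open import Algebra.Bundles using (CommutativeRing; RawRing)
import Algebra.Properties.CommutativeSemigroup
import Algebra.Properties.CommutativeSemiring.Exp
import Algebra.Properties.Ring
import Algebra.Properties.Semiring.Mult
import Algebra.Solver.Ring
open import Algebra.Solver.Ring.AlmostCommutativeRing using (fromCommutativeRing; _-Raw-AlmostCommutative⟶_)
open import Data.Bool using (if_then_else_)
open import Data.Empty using (⊥)
open import Data.Fin using (Fin; zero; suc)
import Data.Integer as ℤ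
import Data.Integer.Properties as ℤₚ
open import Data.List using (List; []; _∷_; _++_; map; concatMap; foldr; upTo; allFin; length; filter; head; last; lookup; cartesianProduct; cartesianProductWith)
import Data.List.Properties as Listₚ
open import Data.List.Membership.Propositional using (_∈_; find; lose)
open import Data.List.Membership.Propositional.Properties
open import Data.List.Relation.Unary.All as LAll using ([]; _∷_)
open import Data.List.Relation.Unary.AllPairs using ([]; _∷_)
open import Data.List.Relation.Unary.Any using (Any; here; there; index)
open import Data.List.Relation.Unary.Any.Properties using (lookup-index)
open import Data.List.Relation.Unary.Linked as Linked using (Linked; []; [-]; _∷_)
open import Data.List.Relation.Unary.Unique.Propositional using (Unique)
import Data.List.Relation.Unary.Unique.Propositional.Properties as Uniqueₚ
open import Data.Maybe using (Maybe; just; nothing)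
open import Data.Maybe.Relation.Unary.All as MAll using (just; nothing)
import Data.Nat as ℕ
open import Data.Nat using (zero; _∸_; _<_; _≥_)
open import Data.Nat.DivMod using (m*n/n≡m)
open import Data.Nat.ListAction using (sum)
import Data.Nat.Properties as ℕₚ
import Data.Nat.Solver
open import Data.Product using (_,_; proj₁; proj₂)
open import Data.Sum using (inj₁; inj₂)
open import Data.Unit using (⊤; tt)
open import Data.Vec as Vec using ([]; replicate; zipWith; updateAt)
import Data.Vec.Properties as Vecₚ
import Data.Vec.Relation.Unary.All as VAll
open import Function using (_∘_)
open import Function.Bundles using (mk↔ₛ′)
open import Level using (0ℓ)
open import Relation.Binary.Definitions using (tri<; tri≈; tri>)
import Relation.Binary.PropositionalEquality as ≡
open ≡ using (_≢_; module ≡-Reasoning)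
import Relation.Binary.Reasoning.Setoid
open import Relation.Binary.Structures using (IsEquivalence)
open import Relation.Nullary using (¬_; Dec; yes; no; contradiction)
open import Relation.Nullary.Decidable using (⌊_⌋; _×-dec_)

-- Only the first rank 0 is wanted, yet z stays a variable until the end: taking the constant term
-- in z at once would destroy the product form of F_{1,a}(z), on which the induction on a rests.
-- After the partial fractions, z occurs only in single factors f_n(z), whose constant terms are
-- easy to read. Partial fractions and the Bailey step are consequences of one relation: the
-- denominator at q^{a+1} times f_n(x) b_n(a+1) is f_n(x) b_n(a) plus a multiple of b_n(a+1) that is
-- free of x. Both follow by induction on the upper end of the product, using only inverses of
-- elements 1 - y; neither residues nor limits occur. On the combinatorial side, the largest part of
-- αʲ closes the range of the j-th pair and opens that of the next. Once a₁, ..., a_k are fixed, the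
-- remaining parts are therefore chosen independently, and the generating function becomes a nested
-- sum of products.

-- Solvers for polynomial identities in ℕ and in an arbitrary commutative ring.

module ℕ-Solver = Data.Nat.Solver.+-*-Solver

-- The solver compares coefficients syntactically, so differences are kept reduced: one of the two entries is 0.
reduce : ℕ × ℕ → ℕ × ℕ
reduce (a , b) = a ∸ b , b ∸ a

-- The operations on formal differences are polynomial, unlike those of ℤ, hence easily mapped to any ring.
module Difference where
  _⊞_ _⊠_ : ℕ × ℕ → ℕ × ℕ → ℕ × ℕ
  (a , b) ⊞ (c , d) = a ℕ.+ c , b ℕ.+ d
  (a , b) ⊠ (c , d) = a ℕ.* c ℕ.+ b ℕ.* d , a ℕ.* d ℕ.+ b ℕ.* c

  ⊟_ : ℕ × ℕ → ℕ × ℕ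
  ⊟ (a , b) = b , a

open Difference

differences : RawRing 0ℓ 0ℓ
differences = record
  { Carrier = ℕ × ℕ
  ; _≈_ = ≡._≡_
  ; _+_ = λ u v → reduce (u ⊞ v)
  ; _*_ = λ u v → reduce (u ⊠ v)
  ; -_ = ⊟_
  ; 0# = 0 , 0
  ; 1# = 1 , 0
  }

module RingSolver (R : CommutativeRing 0ℓ 0ℓ) where
  open CommutativeRing R
  open Algebra.Properties.Ring ring
  open Algebra.Properties.Semiring.Mult semiring using (×1-homo-*; ×-homo-+; ×-homo-1) renaming (_×_ to _×′_)
  open Algebra.Properties.CommutativeSemigroup +-commutativeSemigroup using (interchange)
  open Relation.Binary.Reasoning.Setoid setoid

  private
    diff : ℕ × ℕ → Carrier
    diff (a , b) = (a ×′ 1#) - (b ×′ 1#)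

    -- The first two clauses make the constants of the solver's syntax denote 0# and 1# definitionally.
    ⟦_⟧ : ℕ × ℕ → Carrier
    ⟦ 0 , 0 ⟧ = 0#
    ⟦ 1 , 0 ⟧ = 1#
    ⟦ u ⟧ = diff u

    ⟦⟧≈diff : ∀ u → ⟦ u ⟧ ≈ diff u
    ⟦⟧≈diff (0 , 0) = sym (-‿inverseʳ 0#)
    ⟦⟧≈diff (0 , suc _) = refl
    ⟦⟧≈diff (1 , 0) = sym (trans (+-cong (×-homo-1 1#) -0#≈0#) (+-identityʳ 1#))
    ⟦⟧≈diff (1 , suc _) = refl
    ⟦⟧≈diff (suc (suc _) , _) = refl

    difference-+ : ∀ w x y z → (w + y) - (x + z) ≈ (w - x) + (y - z)
    difference-+ w x y z = begin
      (w + y) - (x + z)       ≈⟨ +-congˡ (sym (-‿+-comm x z)) ⟩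
      (w + y) + (- x + - z)   ≈⟨ interchange w y (- x) (- z) ⟩
      (w - x) + (y - z)       ∎

    difference-* : ∀ w x y z → (w * y + x * z) - (w * z + x * y) ≈ (w - x) * (y - z)
    difference-* w x y z = begin
      (w * y + x * z) - (w * z + x * y)     ≈⟨ +-congˡ (-‿cong (+-comm _ _)) ⟩
      (w * y + x * z) - (x * y + w * z)     ≈⟨ difference-+ _ _ _ _ ⟩
      (w * y - x * y) + (x * z - w * z)     ≈⟨ +-cong (sym ([y-z]x≈yx-zx y w x)) (sym ([y-z]x≈yx-zx z x w)) ⟩
      (w - x) * y + (x - w) * z             ≈⟨ +-congˡ (*-congʳ (sym (⁻¹-anti-homo‿- w x))) ⟩
      (w - x) * y + (- (w - x)) * z         ≈⟨ +-congˡ (trans (sym (-‿distribˡ-* _ _)) (-‿distribʳ-* _ _)) ⟩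
      (w - x) * y + (w - x) * (- z)         ≈⟨ sym (distribˡ _ _ _) ⟩
      (w - x) * (y - z)                     ∎

    +-homo : ∀ u v → diff (u ⊞ v) ≈ diff u + diff v
    +-homo (a , b) (c , d) =
      trans (+-cong (×-homo-+ 1# a c) (-‿cong (×-homo-+ 1# b d))) (difference-+ _ _ _ _)

    ×-homo-*+* : ∀ a b c d → (a ℕ.* c ℕ.+ b ℕ.* d) ×′ 1# ≈ (a ×′ 1#) * (c ×′ 1#) + (b ×′ 1#) * (d ×′ 1#)
    ×-homo-*+* a b c d = trans (×-homo-+ 1# (a ℕ.* c) (b ℕ.* d)) (+-cong (×1-homo-* a c) (×1-homo-* b d))

    *-homo : ∀ u v → diff (u ⊠ v) ≈ diff u * diff v
    *-homo (a , b) (c , d) =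
      trans (+-cong (×-homo-*+* a b c d) (-‿cong (×-homo-*+* a b d c))) (difference-* _ _ _ _)

    -‿homo : ∀ u → diff (⊟ u) ≈ - diff u
    -‿homo (a , b) = sym (⁻¹-anti-homo‿- _ _)

    cancel : ∀ w x y z → w + z ≈ y + x → w - x ≈ y - z
    cancel w x y z p = begin
      w - x               ≈⟨ sym (+-identityʳ _) ⟩
      w - x + 0#          ≈⟨ +-congˡ (sym (-‿inverseʳ z)) ⟩
      (w - x) + (z - z)   ≈⟨ interchange w (- x) z (- z) ⟩
      (w + z) + (- x - z) ≈⟨ +-cong p refl ⟩
      (y + x) + (- x - z) ≈⟨ +-congˡ (+-comm (- x) (- z)) ⟩
      (y + x) + (- z - x) ≈⟨ interchange y x (- z) (- x) ⟩
      (y - z) + (x - x)   ≈⟨ +-congˡ (-‿inverseʳ x) ⟩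
      y - z + 0#          ≈⟨ +-identityʳ _ ⟩
      y - z               ∎

    diff-cong : ∀ a b c d → a ℕ.+ d ≡.≡ c ℕ.+ b → diff (a , b) ≈ diff (c , d)
    diff-cong a b c d p = cancel _ _ _ _ (trans (sym (×-homo-+ 1# a d))
                            (trans (reflexive (≡.cong (_×′ 1#) p)) (×-homo-+ 1# c b)))

    -- The two truncated differences have the same formal difference as a and b themselves, which is
    -- why `reduce` leaves the denoted ring element unchanged.
    ∸-balance : ∀ a b → a ∸ b ℕ.+ b ≡.≡ a ℕ.+ (b ∸ a)
    ∸-balance zero zero = ≡.refl
    ∸-balance zero (suc b) = ≡.refl
    ∸-balance (suc a) zero = ≡.refl
    ∸-balance (suc a) (suc b) = ≡.trans (ℕₚ.+-suc (a ∸ b) b) (≡.cong suc (∸-balance a b))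

    ⟦reduce⟧ : ∀ u → ⟦ reduce u ⟧ ≈ diff u
    ⟦reduce⟧ (a , b) = trans (⟦⟧≈diff (reduce (a , b))) (diff-cong (a ∸ b) (b ∸ a) a b (∸-balance a b))

    morphism : differences -Raw-AlmostCommutative⟶ fromCommutativeRing R
    morphism = record
      { ⟦_⟧ = ⟦_⟧
      ; +-homo = λ u v → trans (⟦reduce⟧ (u ⊞ v)) (trans (+-homo u v) (sym (+-cong (⟦⟧≈diff u) (⟦⟧≈diff v))))
      ; *-homo = λ u v → trans (⟦reduce⟧ (u ⊠ v)) (trans (*-homo u v) (sym (*-cong (⟦⟧≈diff u) (⟦⟧≈diff v))))
      ; -‿homo = λ u → trans (⟦⟧≈diff (⊟ u)) (trans (-‿homo u) (sym (-‿cong (⟦⟧≈diff u))))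
      ; 0-homo = refl
      ; 1-homo = refl
      }

    equal? : ∀ u v → Maybe (⟦ u ⟧ ≈ ⟦ v ⟧)
    equal? (a , b) (c , d) with a ℕ.+ d ℕ.≟ c ℕ.+ b
    ... | no _ = nothing
    ... | yes p = just (trans (⟦⟧≈diff (a , b)) (trans (diff-cong a b c d p) (sym (⟦⟧≈diff (c , d)))))

  open Algebra.Solver.Ring differences (fromCommutativeRing R) morphism equal? public
    using (solve; _:=_; _:+_; _:*_; _:-_; :-_; con; Polynomial)

  :0 : ∀ {n} → Polynomial n
  :0 = con (0 , 0)

  :1 : ∀ {n} → Polynomial n
  :1 = con (1 , 0)

-- Finite sums over lists and over initial segments of ℕ.

module ListSums (R : CommutativeRing 0ℓ 0ℓ) where
  open CommutativeRing R
  open Algebra.Properties.CommutativeSemigroup +-commutativeSemigroup using (interchange)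
  open Relation.Binary.Reasoning.Setoid setoid

  ∑ : {A : Set} → List A → (A → Carrier) → Carrier
  ∑ [] f = 0#
  ∑ (x ∷ xs) f = f x + ∑ xs f

  ∑-cong-∈ : {A : Set} (xs : List A) {f g : A → Carrier} → (∀ {x} → x ∈ xs → f x ≈ g x) → ∑ xs f ≈ ∑ xs g
  ∑-cong-∈ [] p = refl
  ∑-cong-∈ (x ∷ xs) p = +-cong (p (here ≡.refl)) (∑-cong-∈ xs (λ i → p (there i)))

  ∑-cong : {A : Set} (xs : List A) {f g : A → Carrier} → (∀ x → f x ≈ g x) → ∑ xs f ≈ ∑ xs g
  ∑-cong xs p = ∑-cong-∈ xs (λ {x} _ → p x)

  ∑-zero-∈ : {A : Set} (xs : List A) {f : A → Carrier} → (∀ {x} → x ∈ xs → f x ≈ 0#) → ∑ xs f ≈ 0#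
  ∑-zero-∈ [] p = refl
  ∑-zero-∈ (x ∷ xs) p = trans (+-cong (p (here ≡.refl)) (∑-zero-∈ xs (λ i → p (there i)))) (+-identityʳ 0#)

  ∑-++ : {A : Set} (xs ys : List A) (f : A → Carrier) → ∑ (xs ++ ys) f ≈ ∑ xs f + ∑ ys f
  ∑-++ [] ys f = sym (+-identityˡ _)
  ∑-++ (x ∷ xs) ys f = trans (+-congˡ (∑-++ xs ys f)) (sym (+-assoc _ _ _))

  ∑-map : {A B : Set} (h : A → B) (xs : List A) (f : B → Carrier) → ∑ (map h xs) f ≈ ∑ xs (λ x → f (h x))
  ∑-map h [] f = refl
  ∑-map h (x ∷ xs) f = +-congˡ (∑-map h xs f)

  ∑-concatMap : {A B : Set} (h : A → List B) (xs : List A) (f : B → Carrier) →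
                ∑ (concatMap h xs) f ≈ ∑ xs (λ x → ∑ (h x) f)
  ∑-concatMap h [] f = refl
  ∑-concatMap h (x ∷ xs) f = trans (∑-++ (h x) (concatMap h xs) f) (+-congˡ (∑-concatMap h xs f))

  ∑-+ : {A : Set} (xs : List A) (f g : A → Carrier) → ∑ xs (λ x → f x + g x) ≈ ∑ xs f + ∑ xs g
  ∑-+ [] f g = sym (+-identityʳ 0#)
  ∑-+ (x ∷ xs) f g = trans (+-congˡ (∑-+ xs f g)) (interchange _ _ _ _)

  ∑-*ˡ : {A : Set} (c : Carrier) (xs : List A) (f : A → Carrier) → c * ∑ xs f ≈ ∑ xs (λ x → c * f x)
  ∑-*ˡ c [] f = zeroʳ c
  ∑-*ˡ c (x ∷ xs) f = trans (distribˡ c _ _) (+-congˡ (∑-*ˡ c xs f))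

  ∑-*ʳ : {A : Set} (c : Carrier) (xs : List A) (f : A → Carrier) → ∑ xs f * c ≈ ∑ xs (λ x → f x * c)
  ∑-*ʳ c xs f = trans (*-comm _ _) (trans (∑-*ˡ c xs f) (∑-cong xs (λ _ → *-comm _ _)))

  ∑-swap : {A B : Set} (xs : List A) (ys : List B) (f : A → B → Carrier) →
           ∑ xs (λ x → ∑ ys (f x)) ≈ ∑ ys (λ y → ∑ xs (λ x → f x y))
  ∑-swap [] ys f = sym (∑-zero-∈ ys (λ _ → refl))
  ∑-swap (x ∷ xs) ys f = trans (+-congˡ (∑-swap xs ys f)) (sym (∑-+ ys (f x) _))

  ∑-cartesianProductWith : {A B C : Set} (h : A → B → C) (xs : List A) (ys : List B) (f : C → Carrier) →
                           ∑ (cartesianProductWith h xs ys) f ≈ ∑ xs (λ x → ∑ ys (λ y → f (h x y)))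
  ∑-cartesianProductWith h [] ys f = refl
  ∑-cartesianProductWith h (x ∷ xs) ys f =
    trans (∑-++ (map (h x) ys) _ f) (+-cong (∑-map (h x) ys f) (∑-cartesianProductWith h xs ys f))

  ∑-product : {A B C : Set} (h : A → B → C) (xs : List A) (ys : List B) {f : C → Carrier}
              {g : A → Carrier} {k : B → Carrier} → (∀ x y → f (h x y) ≈ g x * k y) →
              ∑ (cartesianProductWith h xs ys) f ≈ ∑ xs g * ∑ ys k
  ∑-product h xs ys {f} {g} {k} p = begin
    ∑ (cartesianProductWith h xs ys) f          ≈⟨ ∑-cartesianProductWith h xs ys f ⟩
    ∑ xs (λ x → ∑ ys (λ y → f (h x y)))
      ≈⟨ ∑-cong xs (λ x → trans (∑-cong ys (p x)) (sym (∑-*ˡ (g x) ys k))) ⟩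
    ∑ xs (λ x → g x * ∑ ys k)                   ≈⟨ sym (∑-*ʳ _ xs g) ⟩
    ∑ xs g * ∑ ys k                             ∎

  ∑< : ℕ → (ℕ → Carrier) → Carrier
  ∑< n = ∑ (upTo n)

  ∑<-cong : ∀ n {f g} → (∀ i → i ℕ.< n → f i ≈ g i) → ∑< n f ≈ ∑< n g
  ∑<-cong n p = ∑-cong-∈ (upTo n) (λ {i} i∈ → p i (∈-upTo⁻ i∈))

  ∑<-zero : ∀ n {f} → (∀ i → i ℕ.< n → f i ≈ 0#) → ∑< n f ≈ 0#
  ∑<-zero n p = ∑-zero-∈ (upTo n) (λ {i} i∈ → p i (∈-upTo⁻ i∈))

  ∑<-suc : ∀ n f → ∑< (suc n) f ≈ ∑< n f + f n
  ∑<-suc n f = begin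
    ∑ (upTo (suc n)) f        ≡⟨ ≡.cong (λ l → ∑ l f) (≡.sym (Listₚ.upTo-∷ʳ n)) ⟩
    ∑ (upTo n ++ n ∷ []) f    ≈⟨ ∑-++ (upTo n) (n ∷ []) f ⟩
    ∑< n f + (f n + 0#)       ≈⟨ +-congˡ (+-identityʳ _) ⟩
    ∑< n f + f n              ∎

  ∑<-+ : ∀ m n f → ∑< (m ℕ.+ n) f ≈ ∑< m f + ∑< n (λ i → f (m ℕ.+ i))
  ∑<-+ m zero f = trans (reflexive (≡.cong (λ l → ∑< l f) (ℕₚ.+-identityʳ m))) (sym (+-identityʳ _))
  ∑<-+ m (suc n) f = begin
    ∑< (m ℕ.+ suc n) f                                    ≡⟨ ≡.cong (λ l → ∑< l f) (ℕₚ.+-suc m n) ⟩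
    ∑< (suc (m ℕ.+ n)) f                                  ≈⟨ ∑<-suc (m ℕ.+ n) f ⟩
    ∑< (m ℕ.+ n) f + f (m ℕ.+ n)                          ≈⟨ +-congʳ (∑<-+ m n f) ⟩
    ∑< m f + ∑< n (λ i → f (m ℕ.+ i)) + f (m ℕ.+ n)       ≈⟨ +-assoc _ _ _ ⟩
    ∑< m f + (∑< n (λ i → f (m ℕ.+ i)) + f (m ℕ.+ n))     ≈⟨ +-congˡ (sym (∑<-suc n (λ i → f (m ℕ.+ i)))) ⟩
    ∑< m f + ∑< (suc n) (λ i → f (m ℕ.+ i))               ∎

  ∑<-head : ∀ n f → ∑< (suc n) f ≈ f 0 + ∑< n (λ i → f (suc i))
  ∑<-head n f = trans (∑<-+ 1 n f) (+-congʳ (+-identityʳ (f 0)))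

  ∑<-truncate : ∀ {m n} {f} → m ℕ.≤ n → (∀ i → m ℕ.≤ i → i ℕ.< n → f i ≈ 0#) → ∑< n f ≈ ∑< m f
  ∑<-truncate {m} {n} {f} m≤n p = begin
    ∑< n f                                    ≡⟨ ≡.cong (λ l → ∑< l f) (≡.sym (ℕₚ.m+[n∸m]≡n m≤n)) ⟩
    ∑< (m ℕ.+ (n ∸ m)) f                      ≈⟨ ∑<-+ m (n ∸ m) f ⟩
    ∑< m f + ∑< (n ∸ m) (λ i → f (m ℕ.+ i))   ≈⟨ +-congˡ (∑<-zero (n ∸ m) (λ i i< → p (m ℕ.+ i) (ℕₚ.m≤m+n m i)
                                                   (≡.subst (m ℕ.+ i ℕ.<_) (ℕₚ.m+[n∸m]≡n m≤n) (ℕₚ.+-monoʳ-< m i<)))) ⟩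
    ∑< m f + 0#                               ≈⟨ +-identityʳ _ ⟩
    ∑< m f                                    ∎

  ∑<-single : ∀ {n} a {f} → a ℕ.< n → (∀ i → i ≡.≢ a → f i ≈ 0#) → ∑< n f ≈ f a
  ∑<-single {n} a {f} a<n p = begin
    ∑< n f              ≈⟨ ∑<-truncate {suc a} a<n (λ i a<i _ → p i (λ { ≡.refl → ℕₚ.<-irrefl ≡.refl a<i })) ⟩
    ∑< (suc a) f        ≈⟨ ∑<-suc a f ⟩
    ∑< a f + f a        ≈⟨ +-congʳ (∑<-zero a (λ i i<a → p i (λ { ≡.refl → ℕₚ.<-irrefl ≡.refl i<a }))) ⟩
    0# + f a            ≈⟨ +-identityˡ _ ⟩
    f a                 ∎

-- q-series identities in a commutative ring with nilpotent q.

module QSeries (R : CommutativeRing 0ℓ 0ℓ) where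
  open CommutativeRing R hiding (zero)
  open RingSolver R
  open ListSums R
  open Algebra.Properties.Ring ring using (-0#≈0#)
  open Algebra.Properties.CommutativeSemiring.Exp commutativeSemiring
  open Relation.Binary.Reasoning.Setoid setoid

  x-y≈0⇒x≈y : ∀ {x y} → x - y ≈ 0# → x ≈ y
  x-y≈0⇒x≈y {x} {y} h = trans (solve 2 (λ x y → x := x :- y :+ y) refl x y) (trans (+-congʳ h) (+-identityˡ y))

  -- Stands for a variable together with its reciprocal. The q-series identities are proved for
  -- arbitrary units; z and the xⱼ are substituted only through `variable-unit`.
  record Unit : Set where
    field
      val inv : Carrier
      val*inv : val * inv ≈ 1#
  open Unit

  geometric-sum : ∀ y n → (1# - y) * ∑< n (y ^_) ≈ 1# - y ^ n
  geometric-sum y zero = trans (zeroʳ _) (sym (-‿inverseʳ 1#))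
  geometric-sum y (suc n) = begin
    (1# - y) * ∑< (suc n) (y ^_)                ≈⟨ *-congˡ (∑<-suc n (y ^_)) ⟩
    (1# - y) * (∑< n (y ^_) + y ^ n)            ≈⟨ distribˡ _ _ _ ⟩
    (1# - y) * ∑< n (y ^_) + (1# - y) * y ^ n   ≈⟨ +-congʳ (geometric-sum y n) ⟩
    1# - y ^ n + (1# - y) * y ^ n
      ≈⟨ solve 2 (λ y z → :1 :- z :+ (:1 :- y) :* z := :1 :- y :* z) refl y (y ^ n) ⟩
    1# - y ^ suc n                              ∎

  module Truncated (q : Carrier) (N : ℕ) (q^[1+N]≈0 : q ^ suc N ≈ 0#) where

    q^-vanish : ∀ {e} → N ℕ.< e → q ^ e ≈ 0#
    q^-vanish {e} N<e = begin
      q ^ e                          ≡⟨ ≡.cong (q ^_) (≡.sym (ℕₚ.m+[n∸m]≡n N<e)) ⟩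
      q ^ (suc N ℕ.+ (e ∸ suc N))    ≈⟨ ^-homo-* q (suc N) (e ∸ suc N) ⟩
      q ^ suc N * q ^ (e ∸ suc N)    ≈⟨ *-congʳ q^[1+N]≈0 ⟩
      0# * q ^ (e ∸ suc N)           ≈⟨ zeroˡ _ ⟩
      0#                             ∎

    -- geo y = 1/(1-y) for multiples y of q, so that p i = 1/(q;q)ᵢ below.
    geo : Carrier → Carrier
    geo y = ∑< (suc N) (y ^_)

    geo-inverse : ∀ x i → (1# - x * q ^ suc i) * geo (x * q ^ suc i) ≈ 1#
    geo-inverse x i = begin
      (1# - x * q ^ suc i) * geo (x * q ^ suc i)        ≈⟨ geometric-sum _ (suc N) ⟩
      1# - (x * q ^ suc i) ^ suc N                      ≈⟨ +-congˡ (-‿cong (^-distrib-* x _ (suc N))) ⟩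
      1# - x ^ suc N * (q ^ suc i) ^ suc N
        ≈⟨ +-congˡ (-‿cong (*-congˡ (trans (^-assocʳ q (suc i) (suc N))
                                                            (q^-vanish (ℕₚ.m≤n*m (suc N) (suc i)))))) ⟩
      1# - x ^ suc N * 0#                               ≈⟨ +-congˡ (-‿cong (zeroʳ _)) ⟩
      1# - 0#                                           ≈⟨ trans (+-congˡ -0#≈0#) (+-identityʳ 1#) ⟩
      1#                                                ∎

    geo-cong : ∀ {x y} → x ≈ y → geo x ≈ geo y
    geo-cong p = ∑-cong (upTo (suc N)) (λ n → ^-congˡ n p)

    geo-q-inverse : ∀ i → (1# - q ^ suc i) * geo (q ^ suc i) ≈ 1#
    geo-q-inverse i = trans (*-cong (+-congˡ (-‿cong (sym (*-identityˡ _)))) (geo-cong (sym (*-identityˡ _)))) (geo-inverse 1# i)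

    p : ℕ → Carrier
    p zero = 1#
    p (suc i) = geo (q ^ suc i) * p i

    p-suc : ∀ i → (1# - q ^ suc i) * p (suc i) ≈ p i
    p-suc i = trans (sym (*-assoc _ _ _)) (trans (*-congʳ (geo-q-inverse i)) (*-identityˡ _))

    -- The test implements the convention that 1/(q;q) with a negative index is 0; truncated
    -- subtraction alone would make `p (a ∸ n)` equal to 1 there. With this convention, sums over a
    -- or over n can be lengthened freely at the end where `b` vanishes.
    b : ℕ → ℕ → Carrier
    b n a with n ℕ.≤? a
    ... | yes _ = p (a ∸ n) * p (a ℕ.+ n)
    ... | no _ = 0#

    b-below : ∀ {n a} → a ℕ.< n → b n a ≈ 0#
    b-below {n} {a} a<n with n ℕ.≤? a
    ... | yes n≤a = contradiction n≤a (ℕₚ.<⇒≱ a<n)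
    ... | no _ = refl

    b-at : ∀ n i → b n (n ℕ.+ i) ≈ p i * p (n ℕ.+ i ℕ.+ n)
    b-at n i with n ℕ.≤? n ℕ.+ i
    ... | yes _ = *-congʳ (reflexive (≡.cong p (ℕₚ.m+n∸m≡n n i)))
    ... | no n≰ = contradiction (ℕₚ.m≤m+n n i) n≰

    -- With a = n + i the factors are 1 - q^{a+1-n} and 1 - q^{a+1+n}, by which the two q-factorials
    -- grow from a to a + 1.
    b-step : ∀ n i → (1# - q ^ suc i) * (1# - q ^ suc (n ℕ.+ i ℕ.+ n)) * b n (suc (n ℕ.+ i)) ≈ b n (n ℕ.+ i)
    b-step n i = begin
      (1# - q ^ suc i) * (1# - q ^ suc m) * b n (suc (n ℕ.+ i))
        ≈⟨ *-congˡ (reflexive (≡.cong (b n) (≡.sym (ℕₚ.+-suc n i)))) ⟩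
      (1# - q ^ suc i) * (1# - q ^ suc m) * b n (n ℕ.+ suc i)          ≈⟨ *-congˡ (b-at n (suc i)) ⟩
      (1# - q ^ suc i) * (1# - q ^ suc m) * (p (suc i) * p (n ℕ.+ suc i ℕ.+ n))
        ≡⟨ ≡.cong (λ l → (1# - q ^ suc i) * (1# - q ^ suc m) * (p (suc i) * p (l ℕ.+ n))) (ℕₚ.+-suc n i) ⟩
      (1# - q ^ suc i) * (1# - q ^ suc m) * (p (suc i) * p (suc m))
        ≈⟨ solve 4 (λ a b c d → a :* b :* (c :* d) := (a :* c) :* (b :* d)) refl _ _ _ _ ⟩
      ((1# - q ^ suc i) * p (suc i)) * ((1# - q ^ suc m) * p (suc m))  ≈⟨ *-cong (p-suc i) (p-suc m) ⟩
      p i * p m                                                        ≈⟨ sym (b-at n i) ⟩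
      b n (n ℕ.+ i)                                                    ∎
      where m = n ℕ.+ i ℕ.+ n

    -- With a = n + i + 1 this trades n for n + 1 at fixed a: one q-factorial loses 1 - q^{a-n}, the
    -- other gains 1 - q^{a+n+1}. The telescoping in `κ-partial-sum` rests on it.
    b-slide : ∀ n i → (1# - q ^ suc i) * b n (n ℕ.+ suc i) ≈
                      (1# - q ^ (n ℕ.+ suc i ℕ.+ suc n)) * b (suc n) (n ℕ.+ suc i)
    b-slide n i = begin
      (1# - q ^ suc i) * b n (n ℕ.+ suc i)                 ≈⟨ *-congˡ (b-at n (suc i)) ⟩
      (1# - q ^ suc i) * (p (suc i) * p m)                 ≈⟨ sym (*-assoc _ _ _) ⟩
      (1# - q ^ suc i) * p (suc i) * p m                   ≈⟨ *-congʳ (p-suc i) ⟩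
      p i * p m                                            ≈⟨ *-congˡ (sym (p-suc m)) ⟩
      p i * ((1# - q ^ suc m) * p (suc m))
        ≈⟨ solve 3 (λ a b c → a :* (b :* c) := b :* (a :* c)) refl _ _ _ ⟩
      (1# - q ^ suc m) * (p i * p (suc m))
        ≡⟨ ≡.cong (λ l → (1# - q ^ l) * (p i * p l)) (≡.sym (ℕₚ.+-suc (n ℕ.+ suc i) n)) ⟩
      (1# - q ^ (n ℕ.+ suc i ℕ.+ suc n)) * (p i * p (n ℕ.+ suc i ℕ.+ suc n))
        ≡⟨ ≡.cong (λ l → (1# - q ^ (n ℕ.+ suc i ℕ.+ suc n)) * (p i * p (l ℕ.+ suc n))) (ℕₚ.+-suc n i) ⟩
      (1# - q ^ (n ℕ.+ suc i ℕ.+ suc n)) * (p i * p (suc n ℕ.+ i ℕ.+ suc n))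
        ≈⟨ *-congˡ (sym (b-at (suc n) i)) ⟩
      (1# - q ^ (n ℕ.+ suc i ℕ.+ suc n)) * b (suc n) (suc n ℕ.+ i)
        ≡⟨ ≡.cong (λ l → (1# - q ^ (n ℕ.+ suc i ℕ.+ suc n)) * b (suc n) l) (≡.sym (ℕₚ.+-suc n i)) ⟩
      (1# - q ^ (n ℕ.+ suc i ℕ.+ suc n)) * b (suc n) (n ℕ.+ suc i)  ∎
      where m = n ℕ.+ suc i ℕ.+ n

    -- The factors f_i(x), their denominators and the three-term relation.

    f : Unit → ℕ → Carrier
    f x i = geo (val x * q ^ i) * geo (inv x * q ^ i)

    -- The product of x and its inverse is already replaced by 1. The solver can then treat
    -- `val x + inv x` as one atom, and the identity behind `den-f-b` is a plain polynomial
    -- identity.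
    den : Unit → Carrier → Carrier
    den x y = 1# - (val x + inv x) * y + y * y

    den-factors : ∀ x y → den x y ≈ (1# - val x * y) * (1# - inv x * y)
    den-factors x y = begin
      1# - (val x + inv x) * y + y * y
        ≈⟨ +-congˡ (sym (trans (*-congʳ (val*inv x)) (*-identityˡ _))) ⟩
      1# - (val x + inv x) * y + val x * inv x * (y * y)
        ≈⟨ solve 3 (λ a b y → :1 :- (a :+ b) :* y :+ a :* b :* (y :* y) := (:1 :- a :* y) :* (:1 :- b :* y)) refl _ _ _ ⟩
      (1# - val x * y) * (1# - inv x * y)                   ∎

    den-f : ∀ x i → den x (q ^ suc i) * f x (suc i) ≈ 1#
    den-f x i = begin
      den x (q ^ suc i) * f x (suc i)                              ≈⟨ *-congʳ (den-factors x _) ⟩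
      (1# - val x * q ^ suc i) * (1# - inv x * q ^ suc i) * f x (suc i)
        ≈⟨ solve 4 (λ a b c d → a :* b :* (c :* d) := (a :* c) :* (b :* d)) refl _ _ _ _ ⟩
      _
        ≈⟨ *-cong (geo-inverse (val x) i) (geo-inverse (inv x) i) ⟩
      1# * 1#                                                      ≈⟨ *-identityˡ 1# ⟩
      1#                                                           ∎

    den-cong : ∀ x {y z} → y ≈ z → den x y ≈ den x z
    den-cong x p = +-cong (+-congˡ (-‿cong (*-congˡ p))) (*-cong p p)

    -- Every summation below rests on the identity
    -- (1 - x y w)(1 - x⁻¹ y w) = (1 - w)(1 - y² w) + w (1 - x y)(1 - x⁻¹ y) with y = qⁿ and y w = q^{a+1}.
    den-f-b : ∀ x n a → den x (q ^ suc a) * (f x (suc n) * b (suc n) (suc a)) ≈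
                        f x (suc n) * b (suc n) a + q ^ (a ∸ n) * b (suc n) (suc a)
    den-f-b x n a with ℕₚ.<-cmp n a
    ... | tri< n<a _ _ with i , ≡.refl ← ℕₚ.m≤n⇒∃[o]m+o≡n n<a = begin
      den x (q ^ suc (suc n ℕ.+ i)) * (F * B)                     ≈⟨ *-congʳ (den-cong x yw) ⟩
      den x (y * w) * (F * B)
        ≈⟨ solve 5 (λ s y w F B → (:1 :- s :* (y :* w) :+ y :* w :* (y :* w)) :* (F :* B) :=
             F :* ((:1 :- w) :* (:1 :- y :* w :* y) :* B) :+ w :* B :* ((:1 :- s :* y :+ y :* y) :* F)) refl (val x + inv x) y w F B ⟩
      F * ((1# - w) * (1# - y * w * y) * B) + w * B * (den x y * F)
        ≈⟨ +-cong (*-congˡ (trans (*-congʳ (*-congˡ (+-congˡ (-‿cong (sym ywy))))) (b-step (suc n) i)))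
                  (trans (*-congˡ (den-f x n)) (*-identityʳ _)) ⟩
      F * b (suc n) (suc n ℕ.+ i) + w * B
        ≡⟨ ≡.cong (λ e → F * b (suc n) (suc n ℕ.+ i) + q ^ e * B) (≡.sym (≡.trans (≡.cong (_∸ n) (≡.sym (ℕₚ.+-suc n i))) (ℕₚ.m+n∸m≡n n (suc i)))) ⟩
      F * b (suc n) (suc n ℕ.+ i) + q ^ (suc n ℕ.+ i ∸ n) * B     ∎
      where
      y = q ^ suc n
      w = q ^ suc i
      F = f x (suc n)
      B = b (suc n) (suc (suc n ℕ.+ i))
      yw : q ^ suc (suc n ℕ.+ i) ≈ y * w
      yw = trans (reflexive (≡.cong (q ^_) (≡.sym (ℕₚ.+-suc (suc n) i)))) (^-homo-* q (suc n) (suc i))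
      ywy : q ^ suc (suc n ℕ.+ i ℕ.+ suc n) ≈ y * w * y
      ywy = trans (^-homo-* q (suc (suc n ℕ.+ i)) (suc n)) (*-congʳ yw)
    -- The case w = 1: the denominator cancels f, and `b (suc n) n` is 0.
    den-f-b x n a | tri≈ _ ≡.refl _ = begin
      den x (q ^ suc n) * (f x (suc n) * b (suc n) (suc n))       ≈⟨ sym (*-assoc _ _ _) ⟩
      den x (q ^ suc n) * f x (suc n) * b (suc n) (suc n)         ≈⟨ *-congʳ (den-f x n) ⟩
      1# * b (suc n) (suc n)
        ≡⟨ ≡.cong (λ e → q ^ e * b (suc n) (suc n)) (≡.sym (ℕₚ.n∸n≡0 n)) ⟩
      q ^ (n ∸ n) * b (suc n) (suc n)                             ≈⟨ sym (+-identityˡ _) ⟩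
      0# + q ^ (n ∸ n) * b (suc n) (suc n)
        ≈⟨ +-congʳ (sym (trans (*-congˡ (b-below {suc n} {n} ℕₚ.≤-refl)) (zeroʳ _))) ⟩
      f x (suc n) * b (suc n) n + q ^ (n ∸ n) * b (suc n) (suc n) ∎
    -- Both values of `b` are 0 here, which also disposes of `q ^ (a ∸ n)` with its exponent
    -- truncated to 0.
    den-f-b x n a | tri> _ _ a<n = begin
      den x (q ^ suc a) * (f x (suc n) * b (suc n) (suc a))
        ≈⟨ *-congˡ (trans (*-congˡ high) (zeroʳ _)) ⟩
      den x (q ^ suc a) * 0#                                      ≈⟨ zeroʳ _ ⟩
      0#                                                          ≈⟨ sym (+-identityʳ 0#) ⟩
      0# + 0#
        ≈⟨ sym (+-cong (trans (*-congˡ (b-below (ℕₚ.m<n⇒m<1+n a<n))) (zeroʳ _))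
                                                                                  (trans (*-congˡ high) (zeroʳ _))) ⟩
      f x (suc n) * b (suc n) a + q ^ (a ∸ n) * b (suc n) (suc a) ∎
      where
      high : b (suc n) (suc a) ≈ 0#
      high = b-below (ℕ.s≤s a<n)

    -- The products F_{c,a}(x).

    -- Follows the recursion of `partitions` clause by clause, which makes `partitions-gf` a direct
    -- induction.
    below : Carrier → ℕ → ℕ → Carrier
    below x c zero = 1#
    below x c (suc a) with c ℕ.≤? suc a
    ... | yes _ = geo (x * q ^ suc a) * below x c a
    ... | no _ = 1#

    -- For a < c the value is 0 and not the empty product 1: this imposes a₁ ≤ a₂ ≤ ... in the
    -- nested sums of `chain`, whose variables all run up to D.
    F : Unit → ℕ → ℕ → Carrier
    F x c a with c ℕ.≤? a
    ... | yes _ = below (val x) c a * below (inv x) c a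
    ... | no _ = 0#

    below-empty : ∀ x {c a} → a ℕ.< c → below x c a ≈ 1#
    below-empty x {c} {zero} a<c = refl
    below-empty x {c} {suc a} a<c with c ℕ.≤? suc a
    ... | yes c≤a = contradiction c≤a (ℕₚ.<⇒≱ a<c)
    ... | no _ = refl

    below-suc : ∀ x {c a} → c ℕ.≤ suc a → below x c (suc a) ≈ geo (x * q ^ suc a) * below x c a
    below-suc x {c} {a} c≤ with c ℕ.≤? suc a
    ... | yes _ = refl
    ... | no c≰ = contradiction c≤ c≰

    F-yes : ∀ x {c a} → c ℕ.≤ a → F x c a ≈ below (val x) c a * below (inv x) c a
    F-yes x {c} {a} c≤a with c ℕ.≤? a
    ... | yes _ = refl
    ... | no c≰a = contradiction c≤a c≰a

    F-no : ∀ x {c a} → a ℕ.< c → F x c a ≈ 0#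
    F-no x {c} {a} a<c with c ℕ.≤? a
    ... | yes c≤a = contradiction c≤a (ℕₚ.<⇒≱ a<c)
    ... | no _ = refl

    -- Formulated with `below` because it must include c = a + 1, where the empty product is 1 but
    -- `F x c a` is 0.
    F-below : ∀ x {c a} → c ℕ.≤ suc a → F x c (suc a) ≈ f x (suc a) * (below (val x) c a * below (inv x) c a)
    F-below x {c} {a} c≤ = begin
      F x c (suc a)                                           ≈⟨ F-yes x {c} {suc a} c≤ ⟩
      below (val x) c (suc a) * below (inv x) c (suc a)
        ≈⟨ *-cong (below-suc (val x) {c} {a} c≤) (below-suc (inv x) {c} {a} c≤) ⟩
      _
        ≈⟨ solve 4 (λ a b c d → (a :* b) :* (c :* d) := (a :* c) :* (b :* d)) refl _ _ _ _ ⟩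
      f x (suc a) * (below (val x) c a * below (inv x) c a)   ∎

    F-diagonal : ∀ x a → F x (suc a) (suc a) ≈ f x (suc a)
    F-diagonal x a = begin
      F x (suc a) (suc a)                                           ≈⟨ F-below x {suc a} {a} ℕₚ.≤-refl ⟩
      f x (suc a) * (below (val x) (suc a) a * below (inv x) (suc a) a)
        ≈⟨ *-congˡ (*-cong (below-empty (val x) {suc a} {a} ℕₚ.≤-refl) (below-empty (inv x) {suc a} {a} ℕₚ.≤-refl)) ⟩
      f x (suc a) * (1# * 1#)
        ≈⟨ trans (*-congˡ (*-identityˡ 1#)) (*-identityʳ _) ⟩
      f x (suc a)                                                   ∎

    F-suc : ∀ x {c a} → c ℕ.≤ a → F x c (suc a) ≈ f x (suc a) * F x c a
    F-suc x {c} {a} c≤a = trans (F-below x {c} {a} (ℕₚ.m≤n⇒m≤1+n c≤a)) (*-congˡ (sym (F-yes x {c} {a} c≤a)))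

    q^-b : ∀ n a → q ^ suc n * (q ^ (a ∸ n) * b (suc n) (suc a)) ≈ q ^ suc a * b (suc n) (suc a)
    q^-b n a with n ℕ.≤? a
    ... | yes n≤a = trans (sym (*-assoc _ _ _)) (*-congʳ (trans (sym (^-homo-* q (suc n) (a ∸ n)))
                      (reflexive (≡.cong (λ e → q ^ suc e) (ℕₚ.m+[n∸m]≡n n≤a)))))
    ... | no n≰a = trans (*-congˡ (trans (*-congˡ zero-b) (zeroʳ _))) (trans (zeroʳ _) (sym (trans (*-congˡ zero-b) (zeroʳ _))))
      where
      zero-b : b (suc n) (suc a) ≈ 0#
      zero-b = b-below (ℕ.s≤s (ℕₚ.≰⇒> n≰a))

    -- The Bailey step and the partial fractions of F_{1,a}.

    solve-den : ∀ x a {s t} → den x (q ^ suc a) * s ≈ t → s ≈ f x (suc a) * t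
    solve-den x a {s} {t} h = begin
      s                                                ≈⟨ sym (*-identityˡ s) ⟩
      1# * s                                           ≈⟨ *-congʳ (sym (trans (*-comm _ _) (den-f x a))) ⟩
      f x (suc a) * den x (q ^ suc a) * s              ≈⟨ *-assoc _ _ _ ⟩
      f x (suc a) * (den x (q ^ suc a) * s)            ≈⟨ *-congˡ h ⟩
      f x (suc a) * t                                  ∎

    -- Induction on D. Splitting off the top term shows that the left side satisfies S(D+1) =
    -- f_{D+1}(x) (S(D) + q^{D+1} b_{n+1}(D+1)). For the right side the same recurrence is `den-f-b`
    -- multiplied by q^{n+1} and divided by the denominator.
    bailey-step : ∀ x n D → ∑< D (λ i → q ^ suc i * b (suc n) (suc i) * F x (suc i) D) ≈
                       q ^ suc n * f x (suc n) * b (suc n) D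
    bailey-step x n zero = sym (trans (*-congˡ (b-below {suc n} (ℕ.s≤s ℕ.z≤n))) (zeroʳ _))
    bailey-step x n (suc D) = begin
      ∑< (suc D) (λ i → t i * F x (suc i) (suc D))                        ≈⟨ ∑<-suc D _ ⟩
      ∑< D (λ i → t i * F x (suc i) (suc D)) + t D * F x (suc D) (suc D)
        ≈⟨ +-cong (∑<-cong D (λ i i<D → trans (*-congˡ (F-suc x {suc i} {D} i<D)) (solve 3 (λ a b c → a :* (b :* c) := b :* (a :* c)) refl _ _ _)))
                  (trans (*-congˡ (F-diagonal x D)) (*-comm _ _)) ⟩
      ∑< D (λ i → f x (suc D) * (t i * F x (suc i) D)) + f x (suc D) * t D
        ≈⟨ +-congʳ (sym (∑-*ˡ _ (upTo D) _)) ⟩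
      f x (suc D) * ∑< D (λ i → t i * F x (suc i) D) + f x (suc D) * t D       ≈⟨ sym (distribˡ _ _ _) ⟩
      f x (suc D) * (∑< D (λ i → t i * F x (suc i) D) + t D)
        ≈⟨ *-congˡ (+-congʳ (bailey-step x n D)) ⟩
      f x (suc D) * (q ^ suc n * f x (suc n) * b (suc n) D + t D)              ≈⟨ sym (solve-den x D step) ⟩
      q ^ suc n * f x (suc n) * b (suc n) (suc D)                              ∎
      where
      t : ℕ → Carrier
      t i = q ^ suc i * b (suc n) (suc i)
      step : den x (q ^ suc D) * (q ^ suc n * f x (suc n) * b (suc n) (suc D)) ≈ q ^ suc n * f x (suc n) * b (suc n) D + t D
      step = begin
        _
          ≈⟨ solve 4 (λ a b c d → a :* (b :* c :* d) := b :* (a :* (c :* d))) refl _ _ _ _ ⟩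
        q ^ suc n * (den x (q ^ suc D) * (f x (suc n) * b (suc n) (suc D)))
          ≈⟨ *-congˡ (den-f-b x n D) ⟩
        q ^ suc n * (f x (suc n) * b (suc n) D + q ^ (D ∸ n) * b (suc n) (suc D))     ≈⟨ distribˡ _ _ _ ⟩
        _
          ≈⟨ +-cong (sym (*-assoc _ _ _)) (q^-b n D) ⟩
        q ^ suc n * f x (suc n) * b (suc n) D + t D                                   ∎

    -- σ n = (-1)ⁿ⁻¹ q^{n(n-1)/2}.
    σ : ℕ → Carrier
    σ zero = - 1#
    σ (suc n) = - (σ n * q ^ n)

    κ : ℕ → Carrier
    κ n = σ n * (1# - q ^ n) * (1# - q ^ n * q ^ n)

    -- The telescoped form is the output of Gosper's algorithm, multiplied by 1 - q^a; it vanishes at M = a + 1.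
    κ-partial-sum : ∀ a M → M ℕ.≤ suc a →
      (1# - q ^ a) * ∑< M (λ i → κ (suc i) * (q ^ (a ∸ i) * b (suc i) (suc a))) ≈
      σ M * q ^ a * (1# - q ^ M) * (1# - q ^ suc M) * ((1# - q ^ (suc a ∸ M)) * b M (suc a))
    κ-partial-sum a zero _ = begin
      (1# - q ^ a) * 0#     ≈⟨ zeroʳ _ ⟩
      0#
        ≈⟨ solve 4 (λ s a q r → :0 := s :* a :* (:1 :- :1) :* q :* r) refl (σ 0) (q ^ a) _ _ ⟩
      _                     ∎
    κ-partial-sum a (suc M) (ℕ.s≤s M≤a) with w , ≡.refl ← ℕₚ.m≤n⇒∃[o]m+o≡n M≤a = begin
      (1# - q ^ (M ℕ.+ w)) * ∑< (suc M) t                       ≈⟨ *-congˡ (∑<-suc M t) ⟩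
      (1# - q ^ (M ℕ.+ w)) * (∑< M t + t M)                     ≈⟨ distribˡ _ _ _ ⟩
      (1# - q ^ (M ℕ.+ w)) * ∑< M t + (1# - q ^ (M ℕ.+ w)) * t M
        ≈⟨ +-congʳ (κ-partial-sum (M ℕ.+ w) M (ℕₚ.m≤n⇒m≤1+n (ℕₚ.m≤m+n M w))) ⟩
      σ M * q ^ (M ℕ.+ w) * (1# - x) * (1# - q * x) * ((1# - q ^ (suc (M ℕ.+ w) ∸ M)) * b M (suc (M ℕ.+ w)))
        + (1# - q ^ (M ℕ.+ w)) * t M
        ≈⟨ +-cong (*-cong (*-congʳ (*-congʳ (*-congˡ xw))) slide)
                  (*-cong (+-congˡ (-‿cong xw)) (*-congˡ (*-congʳ (reflexive (≡.cong (q ^_) (ℕₚ.m+n∸m≡n M w)))))) ⟩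
      σ M * (x * y) * (1# - x) * (1# - q * x) * ((1# - q * (q * (x * y * x))) * B)
        + (1# - x * y) * (- (σ M * x) * (1# - q * x) * (1# - q * x * (q * x)) * (y * B))
        ≈⟨ solve 5 (λ s x y q B →
              s :* (x :* y) :* (:1 :- x) :* (:1 :- q :* x) :* ((:1 :- q :* (q :* (x :* y :* x))) :* B)
                :+ (:1 :- x :* y) :* (:- (s :* x) :* (:1 :- q :* x) :* (:1 :- q :* x :* (q :* x)) :* (y :* B))
              := :- (s :* x) :* (x :* y) :* (:1 :- q :* x) :* (:1 :- q :* (q :* x)) :* ((:1 :- y) :* B)) refl (σ M) x y q B ⟩
      - (σ M * x) * (x * y) * (1# - q * x) * (1# - q * (q * x)) * ((1# - y) * B)
        ≈⟨ *-cong (*-congʳ (*-congʳ (*-congˡ (sym xw)))) (*-congʳ (+-congˡ (-‿cong (reflexive (≡.cong (q ^_) (≡.sym (ℕₚ.m+n∸m≡n M w))))))) ⟩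
      σ (suc M) * q ^ (M ℕ.+ w) * (1# - q ^ suc M) * (1# - q ^ suc (suc M)) * ((1# - q ^ (M ℕ.+ w ∸ M)) * b (suc M) (suc (M ℕ.+ w))) ∎
      where
      t : ℕ → Carrier
      t i = κ (suc i) * (q ^ (M ℕ.+ w ∸ i) * b (suc i) (suc (M ℕ.+ w)))
      x = q ^ M
      y = q ^ w
      B = b (suc M) (suc (M ℕ.+ w))
      xw : q ^ (M ℕ.+ w) ≈ x * y
      xw = ^-homo-* q M w
      -- Turns the closed form at M, which contains `b M`, into a multiple of the `B` occurring in
      -- the new term. What then remains is a polynomial identity in x, y and q.
      slide : (1# - q ^ (suc (M ℕ.+ w) ∸ M)) * b M (suc (M ℕ.+ w)) ≈ (1# - q * (q * (x * y * x))) * B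
      slide = begin
        (1# - q ^ (suc (M ℕ.+ w) ∸ M)) * b M (suc (M ℕ.+ w))
          ≡⟨ ≡.cong (λ l → (1# - q ^ (l ∸ M)) * b M l) (≡.sym (ℕₚ.+-suc M w)) ⟩
        (1# - q ^ (M ℕ.+ suc w ∸ M)) * b M (M ℕ.+ suc w)
          ≡⟨ ≡.cong (λ l → (1# - q ^ l) * b M (M ℕ.+ suc w)) (ℕₚ.m+n∸m≡n M (suc w)) ⟩
        (1# - q ^ suc w) * b M (M ℕ.+ suc w)                        ≈⟨ b-slide M w ⟩
        (1# - q ^ (M ℕ.+ suc w ℕ.+ suc M)) * b (suc M) (M ℕ.+ suc w)
          ≡⟨ ≡.cong₂ (λ l m → (1# - q ^ l) * b (suc M) m) (≡.trans (ℕₚ.+-suc _ M) (≡.cong (λ l → suc (l ℕ.+ M)) (ℕₚ.+-suc M w))) (ℕₚ.+-suc M w) ⟩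
        (1# - q ^ suc (suc (M ℕ.+ w ℕ.+ M))) * B
          ≈⟨ *-congʳ (+-congˡ (-‿cong (*-congˡ (*-congˡ (trans (^-homo-* q (M ℕ.+ w) M) (*-congʳ xw)))))) ⟩
        (1# - q * (q * (x * y * x))) * B                            ∎

    -- The full sum is governed by the closed form of `κ-partial-sum` at its endpoint, which
    -- contains the factor 1 - q⁰. Cancelling 1 - q^{a+1} on the other side is why the statement is
    -- about `suc a`.
    κ-sum : ∀ a M → suc (suc a) ℕ.≤ M → ∑< M (λ i → κ (suc i) * (q ^ (suc a ∸ i) * b (suc i) (suc (suc a)))) ≈ 0#
    κ-sum a M a<M = begin
      ∑< M t
        ≈⟨ ∑<-truncate a<M (λ i a<i _ → trans (*-congˡ (trans (*-congˡ (b-below (ℕ.s≤s a<i))) (zeroʳ _))) (zeroʳ _)) ⟩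
      S                                             ≈⟨ sym (*-identityˡ S) ⟩
      1# * S                                        ≈⟨ *-congʳ (sym (trans (*-comm _ _) (geo-q-inverse a))) ⟩
      geo (q ^ suc a) * (1# - q ^ suc a) * S        ≈⟨ *-assoc _ _ _ ⟩
      geo (q ^ suc a) * ((1# - q ^ suc a) * S)
        ≈⟨ *-congˡ (κ-partial-sum (suc a) (suc (suc a)) ℕₚ.≤-refl) ⟩
      geo (q ^ suc a) * (r * ((1# - q ^ (a ∸ a)) * b (suc (suc a)) (suc (suc a))))
        ≡⟨ ≡.cong (λ e → geo (q ^ suc a) * (r * ((1# - q ^ e) * b (suc (suc a)) (suc (suc a))))) (ℕₚ.n∸n≡0 a) ⟩
      geo (q ^ suc a) * (r * ((1# - 1#) * b (suc (suc a)) (suc (suc a))))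
        ≈⟨ solve 3 (λ g r b → g :* (r :* ((:1 :- :1) :* b)) := :0) refl _ _ _ ⟩
      0#                                            ∎
      where
      t : ℕ → Carrier
      t i = κ (suc i) * (q ^ (suc a ∸ i) * b (suc i) (suc (suc a)))
      S r : Carrier
      S = ∑< (suc (suc a)) t
      r = σ (suc (suc a)) * q ^ suc a * (1# - q ^ suc (suc a)) * (1# - q ^ suc (suc (suc a)))

    -- The remaining case, where the factor to be cancelled would be 1 - q⁰. Only i = 0 survives,
    -- and κ₁ = (1 - q)(1 - q²) is the inverse of b₁(1).
    κ-sum₁ : ∀ M → 1 ℕ.≤ M → ∑< M (λ i → κ (suc i) * (q ^ (0 ∸ i) * b (suc i) 1)) ≈ 1#
    κ-sum₁ M 1≤M = begin
      ∑< M t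
        ≈⟨ ∑<-truncate 1≤M (λ i 1≤i _ → trans (*-congˡ (trans (*-congˡ (b-below (ℕ.s≤s 1≤i))) (zeroʳ _))) (zeroʳ _)) ⟩
      κ 1 * (1# * (p 0 * p 2)) + 0#
        ≈⟨ solve 3 (λ q g h → (:- (:- :1 :* :1) :* (:1 :- q :* :1) :* (:1 :- q :* :1 :* (q :* :1))) :* (:1 :* (:1 :* (h :* (g :* :1)))) :+ :0
              := ((:1 :- q :* :1) :* g) :* ((:1 :- q :* (q :* :1)) :* h)) refl q (geo (q ^ 1)) (geo (q ^ 2)) ⟩
      _                                             ≈⟨ *-cong (geo-q-inverse 0) (geo-q-inverse 1) ⟩
      1# * 1#                                       ≈⟨ *-identityˡ 1# ⟩
      1#                                            ∎
      where
      t : ℕ → Carrier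
      t i = κ (suc i) * (q ^ (0 ∸ i) * b (suc i) 1)

    -- Multiplication by the denominator at q^{a+1} sends the claimed sum at a + 1 to the sum at a
    -- plus a remainder free of x. For a ≥ 1 the former is F_{1,a} by induction and the latter is 0
    -- by `κ-sum`. At a = 0 it is the other way round: the sum is 0 because every `b` vanishes, and
    -- the remainder is 1. A common M for all a makes it possible to exchange this sum with one over
    -- a.
    partial-fractions : ∀ x a M → suc a ℕ.≤ M →
      F x 1 (suc a) ≈ ∑< M (λ i → κ (suc i) * (f x (suc i) * b (suc i) (suc a)))
    partial-fractions x a M a<M = begin
      F x 1 (suc a)                                  ≈⟨ F-below x {1} {a} (ℕ.s≤s ℕ.z≤n) ⟩
      f x (suc a) * (below (val x) 1 a * below (inv x) 1 a)
        ≈⟨ sym (solve-den x a (trans expand (remainder a a<M))) ⟩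
      ∑< M (λ i → κ (suc i) * (f x (suc i) * b (suc i) (suc a)))   ∎
      where
      previous rest : ℕ → Carrier
      previous a = ∑< M (λ i → κ (suc i) * (f x (suc i) * b (suc i) a))
      rest a = ∑< M (λ i → κ (suc i) * (q ^ (a ∸ i) * b (suc i) (suc a)))

      expand : den x (q ^ suc a) * previous (suc a) ≈ previous a + rest a
      expand = begin
        den x (q ^ suc a) * previous (suc a)     ≈⟨ ∑-*ˡ _ (upTo M) _ ⟩
        ∑< M (λ i → den x (q ^ suc a) * (κ (suc i) * (f x (suc i) * b (suc i) (suc a))))
          ≈⟨ ∑-cong (upTo M) (λ i → trans (solve 3 (λ a b c → a :* (b :* c) := b :* (a :* c)) refl _ _ _)
                                      (trans (*-congˡ (den-f-b x i a)) (distribˡ _ _ _))) ⟩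
        ∑< M (λ i → κ (suc i) * (f x (suc i) * b (suc i) a) + κ (suc i) * (q ^ (a ∸ i) * b (suc i) (suc a)))
          ≈⟨ ∑-+ (upTo M) _ _ ⟩
        previous a + rest a                      ∎

      remainder : ∀ a → suc a ℕ.≤ M → previous a + rest a ≈ below (val x) 1 a * below (inv x) 1 a
      remainder zero 0<M = begin
        previous 0 + rest 0
          ≈⟨ +-cong (∑<-zero M (λ i _ → trans (*-congˡ (trans (*-congˡ (b-below {suc i} {0} (ℕ.s≤s ℕ.z≤n))) (zeroʳ _))) (zeroʳ _)))
                                        (κ-sum₁ M 0<M) ⟩
        0# + 1#               ≈⟨ +-identityˡ 1# ⟩
        1#                    ≈⟨ sym (*-identityˡ 1#) ⟩
        1# * 1#               ∎
      remainder (suc a) a<M = begin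
        previous (suc a) + rest (suc a)
          ≈⟨ +-cong (sym (partial-fractions x a M (ℕₚ.<⇒≤ a<M))) (κ-sum a M a<M) ⟩
        F x 1 (suc a) + 0#                                    ≈⟨ +-identityʳ _ ⟩
        F x 1 (suc a)                                         ≈⟨ F-yes x {1} {suc a} (ℕ.s≤s ℕ.z≤n) ⟩
        below (val x) 1 (suc a) * below (inv x) 1 (suc a)     ∎

    -- Generating function of the chains of pairs (αʲ , βʲ) with parts at least c and at most D.
    chain : ∀ {k} → Unit → Vec Unit k → ℕ → ℕ → Carrier
    chain x [] c D = F x c D
    chain x (y ∷ ys) c D = ∑< D (λ i → q ^ suc i * F x c (suc i) * chain y ys (suc i) D)

    ψ : ∀ {k} → Vec Unit k → ℕ → Carrier
    ψ [] n = 1#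
    ψ (x ∷ xs) n = q ^ n * f x n * ψ xs n

    -- The sum over a₁ is carried out first. F_{a₁,a₂} vanishes for a₁ > a₂, so the sum up to D is a
    -- Bailey step with upper end a₂. It leaves q^{a₂} b_n(a₂) in front of the rest of the chain:
    -- the same shape with one variable fewer.
    bailey-chain : ∀ {k} x (xs : Vec Unit k) n D → ∑< D (λ i → q ^ suc i * b (suc n) (suc i) * chain x xs (suc i) D) ≈
                                ψ (x ∷ xs) (suc n) * b (suc n) D
    bailey-chain x [] n D = trans (bailey-step x n D) (*-congʳ (sym (*-identityʳ _)))
    bailey-chain x (y ∷ ys) n D = begin
      ∑< D (λ i → t i * ∑< D (λ j → q ^ suc j * F x (suc i) (suc j) * C j))
        ≈⟨ ∑-cong (upTo D) (λ i → ∑-*ˡ (t i) (upTo D) _) ⟩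
      ∑< D (λ i → ∑< D (λ j → t i * (q ^ suc j * F x (suc i) (suc j) * C j)))
        ≈⟨ ∑-swap (upTo D) (upTo D) _ ⟩
      ∑< D (λ j → ∑< D (λ i → t i * (q ^ suc j * F x (suc i) (suc j) * C j)))
        ≈⟨ ∑<-cong D (λ j j<D → inner j j<D) ⟩
      ∑< D (λ j → q ^ suc n * f x (suc n) * (q ^ suc j * b (suc n) (suc j) * C j))
        ≈⟨ sym (∑-*ˡ _ (upTo D) _) ⟩
      q ^ suc n * f x (suc n) * ∑< D (λ j → q ^ suc j * b (suc n) (suc j) * C j)
        ≈⟨ *-congˡ (bailey-chain y ys n D) ⟩
      q ^ suc n * f x (suc n) * (ψ (y ∷ ys) (suc n) * b (suc n) D)
        ≈⟨ sym (*-assoc _ _ _) ⟩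
      ψ (x ∷ y ∷ ys) (suc n) * b (suc n) D                                             ∎
      where
      t C : ℕ → Carrier
      t i = q ^ suc i * b (suc n) (suc i)
      C j = chain y ys (suc j) D
      inner : ∀ j → j ℕ.< D → ∑< D (λ i → t i * (q ^ suc j * F x (suc i) (suc j) * C j)) ≈
                              q ^ suc n * f x (suc n) * (q ^ suc j * b (suc n) (suc j) * C j)
      inner j j<D = begin
        ∑< D (λ i → t i * (q ^ suc j * F x (suc i) (suc j) * C j))
          ≈⟨ ∑<-truncate {suc j} j<D (λ i j<i _ → trans (*-congˡ (trans (*-congʳ (trans (*-congˡ (F-no x {suc i} {suc j} (ℕ.s≤s j<i))) (zeroʳ _))) (zeroˡ _))) (zeroʳ _)) ⟩
        ∑< (suc j) (λ i → t i * (q ^ suc j * F x (suc i) (suc j) * C j))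
          ≈⟨ ∑-cong (upTo (suc j)) (λ i → solve 4 (λ t y F C → t :* (y :* F :* C) := t :* F :* (y :* C)) refl (t i) (q ^ suc j) _ _) ⟩
        ∑< (suc j) (λ i → t i * F x (suc i) (suc j) * (q ^ suc j * C j))
          ≈⟨ sym (∑-*ʳ _ (upTo (suc j)) _) ⟩
        ∑< (suc j) (λ i → t i * F x (suc i) (suc j)) * (q ^ suc j * C j)
          ≈⟨ *-congʳ (bailey-step x n (suc j)) ⟩
        q ^ suc n * f x (suc n) * b (suc n) (suc j) * (q ^ suc j * C j)
          ≈⟨ solve 5 (λ a f b y C → a :* f :* b :* (y :* C) := a :* f :* (y :* b :* C)) refl (q ^ suc n) (f x (suc n)) _ (q ^ suc j) _ ⟩
        q ^ suc n * f x (suc n) * (q ^ suc j * b (suc n) (suc j) * C j)        ∎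

    -- Only the link starting at 1 is expanded by partial fractions; each of its terms carries
    -- b_n(a₁), the input of `bailey-chain`. The bound D ≤ N lets the same N terms serve every D.
    chain-expansion : ∀ {k} z x (xs : Vec Unit k) D → D ℕ.≤ N →
      chain z (x ∷ xs) 1 D ≈ ∑< N (λ i → κ (suc i) * f z (suc i) * (ψ (x ∷ xs) (suc i) * b (suc i) D))
    chain-expansion z x xs D D≤N = begin
      ∑< D (λ j → q ^ suc j * F z 1 (suc j) * C j)
        ≈⟨ ∑<-cong D (λ j j<D → trans (*-congʳ (trans (*-congˡ (partial-fractions z j N (ℕₚ.≤-trans j<D D≤N))) (∑-*ˡ _ (upTo N) _))) (∑-*ʳ _ (upTo N) _)) ⟩
      ∑< D (λ j → ∑< N (λ i → q ^ suc j * (κ (suc i) * (f z (suc i) * b (suc i) (suc j))) * C j))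
        ≈⟨ ∑-swap (upTo D) (upTo N) _ ⟩
      ∑< N (λ i → ∑< D (λ j → q ^ suc j * (κ (suc i) * (f z (suc i) * b (suc i) (suc j))) * C j))
        ≈⟨ ∑-cong (upTo N) (λ i → trans (∑-cong (upTo D) (λ j → solve 5 (λ a k f b c → a :* (k :* (f :* b)) :* c := k :* f :* (a :* b :* c)) refl (q ^ suc j) (κ (suc i)) (f z (suc i)) _ _))
                                  (trans (sym (∑-*ˡ _ (upTo D) _)) (*-congˡ (bailey-chain x xs i D)))) ⟩
      ∑< N (λ i → κ (suc i) * f z (suc i) * (ψ (x ∷ xs) (suc i) * b (suc i) D)) ∎
      where
      C : ℕ → Carrier
      C j = chain x xs (suc j) D

    -- Durfee rectangles and the sum over D.

    -- Sorting partitions by the largest j × (j + c) rectangle in the Ferrers diagram suggests that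
    -- each of these sums is 1/(q;q)_∞. Terms with j > N would be 0, as j(j + c) > N.
    rectangles : ℕ → Carrier
    rectangles c = ∑< (suc N) (λ j → q ^ (j ℕ.* (j ℕ.+ c)) * (p j * p (j ℕ.+ c)))

    -- Hence the difference is divisible by every power of q and so is 0: all the sums rectangles c are equal.
    rectangles-difference : ∀ c →
      rectangles c - rectangles (suc c) ≈ - (q ^ suc c) * (rectangles (suc c) - rectangles (suc (suc c)))
    rectangles-difference c = begin
      rectangles c - rectangles (suc c)           ≈⟨ difference c ⟩
      ∑< (suc N) (λ j → r c j * (1# - q ^ suc (j ℕ.+ c) - q ^ j))
        ≈⟨ ∑-cong (upTo (suc N)) (λ j → split j) ⟩
      ∑< (suc N) (λ j → r c j * (1# - q ^ j) + - (r c j * q ^ suc (j ℕ.+ c)))  ≈⟨ ∑-+ (upTo (suc N)) _ _ ⟩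
      ∑< (suc N) (λ j → r c j * (1# - q ^ j)) + ∑< (suc N) (λ j → - (r c j * q ^ suc (j ℕ.+ c)))
        ≈⟨ +-congʳ shift ⟩
      ∑< (suc N) (λ j → r c (suc j) * (1# - q ^ suc j)) + ∑< (suc N) (λ j → - (r c j * q ^ suc (j ℕ.+ c)))
        ≈⟨ sym (∑-+ (upTo (suc N)) _ _) ⟩
      ∑< (suc N) (λ j → r c (suc j) * (1# - q ^ suc j) + - (r c j * q ^ suc (j ℕ.+ c)))
        ≈⟨ ∑-cong (upTo (suc N)) (λ j → combine j) ⟩
      ∑< (suc N) (λ j → - (q ^ suc c) * (r (suc c) j * (1# - q ^ suc (j ℕ.+ suc c) - q ^ j)))
        ≈⟨ sym (∑-*ˡ _ (upTo (suc N)) _) ⟩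
      - (q ^ suc c) * ∑< (suc N) (λ j → r (suc c) j * (1# - q ^ suc (j ℕ.+ suc c) - q ^ j))
        ≈⟨ *-congˡ (sym (difference (suc c))) ⟩
      - (q ^ suc c) * (rectangles (suc c) - rectangles (suc (suc c)))   ∎
      where
      -- The common factor of the j-th terms of `rectangles c` and `rectangles (suc c)`, with
      -- denominator (q)_j (q)_{j+c+1}.
      r : ℕ → ℕ → Carrier
      r c j = q ^ (j ℕ.* (j ℕ.+ c)) * (p j * p (suc (j ℕ.+ c)))

      ∑-neg : ∀ n g → - ∑< n g ≈ ∑< n (λ j → - g j)
      ∑-neg n g = trans (solve 1 (λ a → :- a := (:- :1) :* a) refl _) (trans (∑-*ˡ (- 1#) (upTo n) g)
                    (∑-cong (upTo n) (λ j → solve 1 (λ a → (:- :1) :* a := :- a) refl _)))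

      difference : ∀ c → rectangles c - rectangles (suc c) ≈ ∑< (suc N) (λ j → r c j * (1# - q ^ suc (j ℕ.+ c) - q ^ j))
      difference c = trans (+-congˡ (∑-neg (suc N) _)) (trans (sym (∑-+ (upTo (suc N)) _ _)) (∑-cong (upTo (suc N)) term))
        where
        term : ∀ j → q ^ (j ℕ.* (j ℕ.+ c)) * (p j * p (j ℕ.+ c)) + - (q ^ (j ℕ.* (j ℕ.+ suc c)) * (p j * p (j ℕ.+ suc c)))
                     ≈ r c j * (1# - q ^ suc (j ℕ.+ c) - q ^ j)
        term j = begin
          _ ≈⟨ +-cong (*-congˡ (*-congˡ (sym (p-suc (j ℕ.+ c)))))
                      (-‿cong (*-cong (trans (reflexive (≡.cong (q ^_) (≡.trans (≡.cong (j ℕ.*_) (ℕₚ.+-suc j c)) (≡.trans (ℕₚ.*-suc j (j ℕ.+ c)) (ℕₚ.+-comm j _)))))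
                                             (^-homo-* q (j ℕ.* (j ℕ.+ c)) j))
                                      (*-congˡ (reflexive (≡.cong p (ℕₚ.+-suc j c)))))) ⟩
          q ^ (j ℕ.* (j ℕ.+ c)) * (p j * ((1# - q ^ suc (j ℕ.+ c)) * p (suc (j ℕ.+ c)))) + - (q ^ (j ℕ.* (j ℕ.+ c)) * q ^ j * (p j * p (suc (j ℕ.+ c))))
            ≈⟨ solve 5 (λ a P Q y z → a :* (P :* ((:1 :- y) :* Q)) :+ :- (a :* z :* (P :* Q)) := a :* (P :* Q) :* (:1 :- y :- z)) refl
                 (q ^ (j ℕ.* (j ℕ.+ c))) (p j) (p (suc (j ℕ.+ c))) (q ^ suc (j ℕ.+ c)) (q ^ j) ⟩
          r c j * (1# - q ^ suc (j ℕ.+ c) - q ^ j) ∎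

      split : ∀ j → r c j * (1# - q ^ suc (j ℕ.+ c) - q ^ j) ≈ r c j * (1# - q ^ j) + - (r c j * q ^ suc (j ℕ.+ c))
      split j = solve 3 (λ r y z → r :* (:1 :- y :- z) := r :* (:1 :- z) :+ :- (r :* y)) refl (r c j) (q ^ suc (j ℕ.+ c)) (q ^ j)

      -- Replacing j by j + 1 keeps the range: the old term j = 0 has the factor 1 - q⁰, the new
      -- last term a power of q beyond N.
      shift : ∑< (suc N) (λ j → r c j * (1# - q ^ j)) ≈ ∑< (suc N) (λ j → r c (suc j) * (1# - q ^ suc j))
      shift = begin
        ∑< (suc N) (λ j → r c j * (1# - q ^ j))       ≈⟨ ∑<-head N _ ⟩
        r c 0 * (1# - 1#) + ∑< N (λ j → r c (suc j) * (1# - q ^ suc j))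
          ≈⟨ solve 2 (λ r s → r :* (:1 :- :1) :+ s := s :+ :0) refl _ _ ⟩
        ∑< N (λ j → r c (suc j) * (1# - q ^ suc j)) + 0#
          ≈⟨ +-congˡ (sym (trans (*-congʳ (trans (*-congʳ (q^-vanish (ℕₚ.m≤m*n (suc N) (suc N ℕ.+ c)))) (zeroˡ _))) (zeroˡ _))) ⟩
        ∑< N (λ j → r c (suc j) * (1# - q ^ suc j)) + r c (suc N) * (1# - q ^ suc N)   ≈⟨ sym (∑<-suc N _) ⟩
        ∑< (suc N) (λ j → r c (suc j) * (1# - q ^ suc j))   ∎

      combine : ∀ j → r c (suc j) * (1# - q ^ suc j) + - (r c j * q ^ suc (j ℕ.+ c)) ≈
                      - (q ^ suc c) * (r (suc c) j * (1# - q ^ suc (j ℕ.+ suc c) - q ^ j))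
      combine j = begin
        q ^ (suc j ℕ.* (suc j ℕ.+ c)) * (p (suc j) * p (suc (suc j ℕ.+ c))) * (1# - q ^ suc j) + - (q ^ (j ℕ.* (j ℕ.+ c)) * (p j * p (suc (j ℕ.+ c))) * q ^ suc (j ℕ.+ c))
          ≈⟨ +-cong (trans (solve 4 (λ a P Q y → a :* (P :* Q) :* y := a :* ((y :* P) :* Q)) refl _ _ _ _) (*-cong pow₁ (*-congʳ (p-suc j))))
                    (-‿cong (*-cong (*-congˡ (*-congˡ (sym (p-suc (suc (j ℕ.+ c)))))) pow₂)) ⟩
        A * J * (J * u) * (p j * P) + - (A * (p j * ((1# - q ^ suc (suc (j ℕ.+ c))) * P)) * (J * u))
          ≈⟨ solve 6 (λ A u J p P y → A :* J :* (J :* u) :* (p :* P) :+ :- (A :* (p :* ((:1 :- y) :* P)) :* (J :* u))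
                        := (:- u) :* (A :* J :* (p :* P) :* (:1 :- y :- J))) refl A u J (p j) P (q ^ suc (suc (j ℕ.+ c))) ⟩
        - u * (A * J * (p j * P) * (1# - q ^ suc (suc (j ℕ.+ c)) - J))
          ≈⟨ *-congˡ (*-cong (*-cong (sym pow₃) (*-congˡ (reflexive (≡.cong (λ l → p (suc l)) (≡.sym (ℕₚ.+-suc j c))))))
                             (+-congʳ (+-congˡ (-‿cong (reflexive (≡.cong (λ l → q ^ suc l) (≡.sym (ℕₚ.+-suc j c)))))))) ⟩
        - u * (r (suc c) j * (1# - q ^ suc (j ℕ.+ suc c) - J)) ∎
        where
        A u J P : Carrier
        A = q ^ (j ℕ.* (j ℕ.+ c))
        u = q ^ suc c
        J = q ^ j
        P = p (suc (suc (j ℕ.+ c)))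
        pow₂ : q ^ suc (j ℕ.+ c) ≈ J * u
        pow₂ = trans (reflexive (≡.cong (q ^_) (≡.sym (ℕₚ.+-suc j c)))) (^-homo-* q j (suc c))
        pow₃ : q ^ (j ℕ.* (j ℕ.+ suc c)) ≈ A * J
        pow₃ = trans (reflexive (≡.cong (q ^_) (≡.trans (≡.cong (j ℕ.*_) (ℕₚ.+-suc j c)) (≡.trans (ℕₚ.*-suc j (j ℕ.+ c)) (ℕₚ.+-comm j _)))))
                     (^-homo-* q (j ℕ.* (j ℕ.+ c)) j)
        pow₁ : q ^ (suc j ℕ.* (suc j ℕ.+ c)) ≈ A * J * (J * u)
        pow₁ = begin
          q ^ (suc (j ℕ.+ c) ℕ.+ j ℕ.* suc (j ℕ.+ c))
            ≡⟨ ≡.cong (λ l → q ^ (suc (j ℕ.+ c) ℕ.+ j ℕ.* l)) (≡.sym (ℕₚ.+-suc j c)) ⟩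
          q ^ (suc (j ℕ.+ c) ℕ.+ j ℕ.* (j ℕ.+ suc c))         ≈⟨ ^-homo-* q (suc (j ℕ.+ c)) _ ⟩
          q ^ suc (j ℕ.+ c) * q ^ (j ℕ.* (j ℕ.+ suc c))       ≈⟨ *-cong pow₂ pow₃ ⟩
          J * u * (A * J)                                     ≈⟨ *-comm _ _ ⟩
          A * J * (J * u)                                     ∎

    -- Each round gains q^{c+1}; one q is recorded and the rest goes into the cofactor. Since c
    -- rises meanwhile, the induction on t treats all c at once.
    rectangles-difference-divisible : ∀ t c → ∃[ r ] rectangles c - rectangles (suc c) ≈ q ^ t * r
    rectangles-difference-divisible zero c = _ , sym (*-identityˡ _)
    rectangles-difference-divisible (suc t) c = next (rectangles-difference-divisible t (suc c))
      where
      next : ∃[ r ] rectangles (suc c) - rectangles (suc (suc c)) ≈ q ^ t * r →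
             ∃[ r ] rectangles c - rectangles (suc c) ≈ q ^ suc t * r
      next (r , e) = - (q ^ c * r) , trans (rectangles-difference c) (trans (*-congˡ e)
        (solve 4 (λ q c t r → (:- (q :* c)) :* (t :* r) := q :* t :* (:- (c :* r))) refl q (q ^ c) (q ^ t) r))

    rectangles-suc : ∀ c → rectangles c ≈ rectangles (suc c)
    rectangles-suc c = conclude (rectangles-difference-divisible (suc N) c)
      where
      conclude : ∃[ r ] rectangles c - rectangles (suc c) ≈ q ^ suc N * r → rectangles c ≈ rectangles (suc c)
      conclude (r , e) = x-y≈0⇒x≈y (trans e (trans (*-congʳ q^[1+N]≈0) (zeroˡ r)))

    -- It suffices to evaluate at c = N: there j(j + N) > N for every j ≥ 1, and the term j = 0 is
    -- `p N`.
    rectangles-constant : ∀ c → rectangles c ≈ p N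
    rectangles-constant c = trans (sym (from-zero c)) (trans (from-zero N) last-rectangle)
      where
      from-zero : ∀ c → rectangles 0 ≈ rectangles c
      from-zero zero = refl
      from-zero (suc c) = trans (from-zero c) (rectangles-suc c)

      last-rectangle : rectangles N ≈ p N
      last-rectangle = begin
        rectangles N     ≈⟨ ∑<-truncate {1} {suc N} (ℕ.s≤s ℕ.z≤n) later-vanish ⟩
        1# * (1# * p N) + 0#   ≈⟨ trans (+-identityʳ _) (trans (*-identityˡ _) (*-identityˡ _)) ⟩
        p N              ∎
        where
        later-vanish : ∀ j → 1 ℕ.≤ j → j ℕ.< suc N → q ^ (j ℕ.* (j ℕ.+ N)) * (p j * p (j ℕ.+ N)) ≈ 0#
        later-vanish (suc j) _ _ = trans (*-congʳ (q^-vanish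
          (ℕₚ.≤-trans (ℕ.s≤s (ℕₚ.m≤n+m N j)) (ℕₚ.m≤m+n (suc j ℕ.+ N) (j ℕ.* (suc j ℕ.+ N)))))) (zeroˡ _)

    -- The substitution D = n + j turns D² into n² + j(j + 2n) and b_n(D) into 1/((q)_j (q)_{j+2n}),
    -- which gives q^{n²} times `rectangles (n ℕ.+ n)`. The range is first lengthened by n vanishing
    -- terms so that the shift fits exactly.
    durfee : ∀ n → n ℕ.≤ N → 1 ℕ.≤ n → ∑< N (λ i → q ^ (suc i ℕ.* suc i) * b n (suc i)) ≈ q ^ (n ℕ.* n) * p N
    durfee n n≤N 1≤n = begin
      ∑< N (λ i → h (suc i))                              ≈⟨ sym (+-identityˡ _) ⟩
      0# + ∑< N (λ i → h (suc i))
        ≈⟨ +-congʳ (sym (trans (*-congˡ (b-below {n} {0} 1≤n)) (zeroʳ _))) ⟩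
      h 0 + ∑< N (λ i → h (suc i))                        ≈⟨ sym (∑<-head N h) ⟩
      ∑< (suc N) h
        ≈⟨ sym (∑<-truncate {suc N} {n ℕ.+ suc N} (ℕₚ.m≤n+m (suc N) n)
                                                               (λ i N<i _ → trans (*-congʳ (q^-vanish (ℕₚ.<-≤-trans N<i (m≤m*m i)))) (zeroˡ _))) ⟩
      ∑< (n ℕ.+ suc N) h                                  ≈⟨ ∑<-+ n (suc N) h ⟩
      ∑< n h + ∑< (suc N) (λ j → h (n ℕ.+ j))
        ≈⟨ +-cong (∑<-zero n (λ i i<n → trans (*-congˡ (b-below i<n)) (zeroʳ _))) (∑-cong (upTo (suc N)) shifted) ⟩
      0# + ∑< (suc N) (λ j → q ^ (n ℕ.* n) * (q ^ (j ℕ.* (j ℕ.+ (n ℕ.+ n))) * (p j * p (j ℕ.+ (n ℕ.+ n)))))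
        ≈⟨ +-identityˡ _ ⟩
      ∑< (suc N) (λ j → q ^ (n ℕ.* n) * (q ^ (j ℕ.* (j ℕ.+ (n ℕ.+ n))) * (p j * p (j ℕ.+ (n ℕ.+ n)))))
        ≈⟨ sym (∑-*ˡ _ (upTo (suc N)) _) ⟩
      q ^ (n ℕ.* n) * rectangles (n ℕ.+ n)                ≈⟨ *-congˡ (rectangles-constant (n ℕ.+ n)) ⟩
      q ^ (n ℕ.* n) * p N                                 ∎
      where
      h : ℕ → Carrier
      h a = q ^ (a ℕ.* a) * b n a
      m≤m*m : ∀ m → m ℕ.≤ m ℕ.* m
      m≤m*m zero = ℕ.z≤n
      m≤m*m (suc m) = ℕₚ.m≤m*n (suc m) (suc m)
      shifted : ∀ j → h (n ℕ.+ j) ≈ q ^ (n ℕ.* n) * (q ^ (j ℕ.* (j ℕ.+ (n ℕ.+ n))) * (p j * p (j ℕ.+ (n ℕ.+ n))))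
      shifted j = begin
        q ^ ((n ℕ.+ j) ℕ.* (n ℕ.+ j)) * b n (n ℕ.+ j)
          ≈⟨ *-cong (trans (reflexive (≡.cong (q ^_) (square n j))) (^-homo-* q (n ℕ.* n) _))
                    (trans (b-at n j) (*-congˡ (reflexive (≡.cong p (swap n j))))) ⟩
        q ^ (n ℕ.* n) * q ^ (j ℕ.* (j ℕ.+ (n ℕ.+ n))) * (p j * p (j ℕ.+ (n ℕ.+ n)))    ≈⟨ *-assoc _ _ _ ⟩
        _ ∎
        where
        square : ∀ n j → (n ℕ.+ j) ℕ.* (n ℕ.+ j) ≡.≡ n ℕ.* n ℕ.+ j ℕ.* (j ℕ.+ (n ℕ.+ n))
        square = ℕ-Solver.solve 2 (λ n j → (n ℕ-Solver.:+ j) ℕ-Solver.:* (n ℕ-Solver.:+ j) ℕ-Solver.:=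
                   n ℕ-Solver.:* n ℕ-Solver.:+ j ℕ-Solver.:* (j ℕ-Solver.:+ (n ℕ-Solver.:+ n))) ≡.refl
        swap : ∀ n j → n ℕ.+ j ℕ.+ n ≡.≡ j ℕ.+ (n ℕ.+ n)
        swap n j = ≡.trans (≡.cong (ℕ._+ n) (ℕₚ.+-comm n j)) (ℕₚ.+-assoc j n n)

    -- The factor depending on z, and the evaluation of the generating function.

    -- A two-sided series in z written as two geometric series; both contain the term z⁰, hence the
    -- - 1.
    Φ : Unit → ℕ → Carrier
    Φ z n = geo (val z * q ^ n) + geo (inv z * q ^ n) - 1#

    Φ-closed : ∀ z n → (1# - q ^ suc n * q ^ suc n) * f z (suc n) ≈ Φ z (suc n)
    Φ-closed z n = begin
      (1# - y * y) * (g * h)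
        ≈⟨ *-congʳ (+-congˡ (-‿cong (sym (trans (*-congʳ (val*inv z)) (*-identityˡ _))))) ⟩
      (1# - val z * inv z * (y * y)) * (g * h)
        -- 1 - z z⁻¹ y² is (1 - z⁻¹ y) + (1 - z y) - (1 - z y)(1 - z⁻¹ y), and each summand cancels
        -- against g, h or both.
        ≈⟨ solve 5 (λ a c y g h → (:1 :- a :* c :* (y :* y)) :* (g :* h) :=
              ((:1 :- c :* y) :* h) :* g :+ ((:1 :- a :* y) :* g) :* h :- ((:1 :- a :* y) :* g) :* ((:1 :- c :* y) :* h)) refl (val z) (inv z) y g h ⟩
      ((1# - inv z * y) * h) * g + ((1# - val z * y) * g) * h - ((1# - val z * y) * g) * ((1# - inv z * y) * h)
        ≈⟨ +-cong (+-cong (*-congʳ hy) (*-congʳ gy)) (-‿cong (*-cong gy hy)) ⟩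
      1# * g + 1# * h - 1# * 1#
        ≈⟨ solve 2 (λ g h → :1 :* g :+ :1 :* h :- :1 :* :1 := g :+ h :- :1) refl g h ⟩
      g + h - 1#                                                        ∎
      where
      y g h : Carrier
      y = q ^ suc n
      g = geo (val z * y)
      h = geo (inv z * y)
      gy : (1# - val z * y) * g ≈ 1#
      gy = geo-inverse (val z) n
      hy : (1# - inv z * y) * h ≈ 1#
      hy = geo-inverse (inv z) n

    -- The n-th term of the right-hand side, with 1/(q;q)_∞ distributed over the sum: n(n-1)/2 from
    -- `σ` and n² add up to n(3n-1)/2, and `ψ` contributes q^{kn}.
    summand : ∀ {k} → Vec Unit k → ℕ → Carrier
    summand xs n = p N * (σ n * q ^ (n ℕ.* n) * ((1# - q ^ n) * ψ xs n))

    durfee-chains : ∀ {k} z x (xs : Vec Unit k) → ∑< N (λ d → q ^ (suc d ℕ.* suc d) * chain z (x ∷ xs) 1 (suc d)) ≈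
                               ∑< N (λ i → Φ z (suc i) * summand (x ∷ xs) (suc i))
    durfee-chains z x xs = begin
      ∑< N (λ d → q ^ (suc d ℕ.* suc d) * chain z (x ∷ xs) 1 (suc d))
        ≈⟨ ∑<-cong N (λ d d<N → trans (*-congˡ (chain-expansion z x xs (suc d) d<N)) (∑-*ˡ _ (upTo N) _)) ⟩
      ∑< N (λ d → ∑< N (λ i → q ^ (suc d ℕ.* suc d) * (κ (suc i) * f z (suc i) * (ψ (x ∷ xs) (suc i) * b (suc i) (suc d)))))
        ≈⟨ ∑-swap (upTo N) (upTo N) _ ⟩
      ∑< N (λ i → ∑< N (λ d → q ^ (suc d ℕ.* suc d) * (κ (suc i) * f z (suc i) * (ψ (x ∷ xs) (suc i) * b (suc i) (suc d)))))
        ≈⟨ ∑<-cong N (λ i i<N → collect i i<N) ⟩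
      ∑< N (λ i → Φ z (suc i) * summand (x ∷ xs) (suc i)) ∎
      where
      collect : ∀ i → i ℕ.< N → ∑< N (λ d → q ^ (suc d ℕ.* suc d) * (κ (suc i) * f z (suc i) * (ψ (x ∷ xs) (suc i) * b (suc i) (suc d)))) ≈
                               Φ z (suc i) * summand (x ∷ xs) (suc i)
      collect i i<N = begin
        _
          ≈⟨ ∑-cong (upTo N) (λ d → solve 5 (λ y k f s b → y :* (k :* f :* (s :* b)) := k :* f :* s :* (y :* b)) refl
               (q ^ (suc d ℕ.* suc d)) (κ (suc i)) (f z (suc i)) (ψ (x ∷ xs) (suc i)) (b (suc i) (suc d))) ⟩
        ∑< N (λ d → κ (suc i) * f z (suc i) * ψ (x ∷ xs) (suc i) * (q ^ (suc d ℕ.* suc d) * b (suc i) (suc d)))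
          ≈⟨ sym (∑-*ˡ _ (upTo N) _) ⟩
        κ (suc i) * f z (suc i) * ψ (x ∷ xs) (suc i) * ∑< N (λ d → q ^ (suc d ℕ.* suc d) * b (suc i) (suc d))
          ≈⟨ *-congˡ (durfee (suc i) i<N (ℕ.s≤s ℕ.z≤n)) ⟩
        κ (suc i) * f z (suc i) * ψ (x ∷ xs) (suc i) * (q ^ (suc i ℕ.* suc i) * p N)
          ≈⟨ solve 7 (λ s a c f w y P → s :* a :* c :* f :* w :* (y :* P) := (c :* f) :* (P :* (s :* y :* (a :* w)))) refl
               (σ (suc i)) (1# - q ^ suc i) (1# - q ^ suc i * q ^ suc i) (f z (suc i)) (ψ (x ∷ xs) (suc i)) (q ^ (suc i ℕ.* suc i)) (p N) ⟩
        (1# - q ^ suc i * q ^ suc i) * f z (suc i) * summand (x ∷ xs) (suc i)    ≈⟨ *-congʳ (Φ-closed z i) ⟩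
        Φ z (suc i) * summand (x ∷ xs) (suc i) ∎

-- The truncated ring of Laurent polynomials, as lists of terms.

module LaurentTerms where
  open ≡
  open ≡-Reasoning

  module ℤ-Sums = ListSums ℤₚ.+-*-commutativeRing

  Exponent : ℕ → Set
  Exponent V = ℕ × Vec ℤ V

  Terms : ℕ → Set
  Terms V = List (ℤ × Exponent V)

  module _ {V : ℕ} where
    open ℤ-Sums

    _⊕_ : Exponent V → Exponent V → Exponent V
    (d , u) ⊕ (e , v) = d ℕ.+ e , zipWith ℤ._+_ u v

    0ₑ : Exponent V
    0ₑ = 0 , replicate V (+ 0)

    ⊕-assoc : ∀ x y z → (x ⊕ y) ⊕ z ≡ x ⊕ (y ⊕ z)
    ⊕-assoc (a , u) (b , v) (c , w) = cong₂ _,_ (ℕₚ.+-assoc a b c) (Vecₚ.zipWith-assoc ℤₚ.+-assoc u v w)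

    ⊕-comm : ∀ x y → x ⊕ y ≡ y ⊕ x
    ⊕-comm (a , u) (b , v) = cong₂ _,_ (ℕₚ.+-comm a b) (Vecₚ.zipWith-comm ℤₚ.+-comm u v)

    ⊕-identityˡ : ∀ x → 0ₑ ⊕ x ≡ x
    ⊕-identityˡ (a , u) = cong (a ,_) (Vecₚ.zipWith-identityˡ ℤₚ.+-identityˡ u)

    -- The ℤ-linear extension of φ from monomials to lists of terms. Its values ignore order,
    -- repetition and cancellation of terms, and so take the place of a normal form.
    ⟦_⟧ : Terms V → (Exponent V → ℤ) → ℤ
    ⟦ p ⟧ φ = ∑ p (λ t → proj₁ t ℤ.* φ (proj₂ t))

    ⟦⟧-cong : ∀ p {φ χ} → (∀ e → φ e ≡ χ e) → ⟦ p ⟧ φ ≡ ⟦ p ⟧ χ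
    ⟦⟧-cong p h = ∑-cong p (λ t → cong (proj₁ t ℤ.*_) (h (proj₂ t)))

    ⟦⟧-swap : ∀ p r (φ : Exponent V → Exponent V → ℤ) → ⟦ p ⟧ (λ x → ⟦ r ⟧ (φ x)) ≡ ⟦ r ⟧ (λ y → ⟦ p ⟧ (λ x → φ x y))
    ⟦⟧-swap p r φ = begin
      ∑ p (λ s → proj₁ s ℤ.* ∑ r (λ t → proj₁ t ℤ.* φ (proj₂ s) (proj₂ t)))
        ≡⟨ ∑-cong p (λ s → ∑-*ˡ (proj₁ s) r (λ t → proj₁ t ℤ.* φ (proj₂ s) (proj₂ t))) ⟩
      ∑ p (λ s → ∑ r (λ t → proj₁ s ℤ.* (proj₁ t ℤ.* φ (proj₂ s) (proj₂ t))))
        ≡⟨ ∑-swap p r (λ s t → proj₁ s ℤ.* (proj₁ t ℤ.* φ (proj₂ s) (proj₂ t))) ⟩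
      ∑ r (λ t → ∑ p (λ s → proj₁ s ℤ.* (proj₁ t ℤ.* φ (proj₂ s) (proj₂ t))))
        ≡⟨ ∑-cong r (λ t → trans (∑-cong p (λ s → rotate (proj₁ s) (proj₁ t) (φ (proj₂ s) (proj₂ t)))) (sym (∑-*ˡ (proj₁ t) p (λ s → proj₁ s ℤ.* φ (proj₂ s) (proj₂ t))))) ⟩
      ∑ r (λ t → proj₁ t ℤ.* ∑ p (λ s → proj₁ s ℤ.* φ (proj₂ s) (proj₂ t))) ∎
      where
      rotate : ∀ a b c → a ℤ.* (b ℤ.* c) ≡ b ℤ.* (a ℤ.* c)
      rotate a b c = trans (sym (ℤₚ.*-assoc a b c)) (trans (cong (ℤ._* c) (ℤₚ.*-comm a b)) (ℤₚ.*-assoc b a c))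

    _*ₜ_ : Terms V → Terms V → Terms V
    _*ₜ_ = cartesianProductWith (λ s t → proj₁ s ℤ.* proj₁ t , proj₂ s ⊕ proj₂ t)

    -ₜ_ : Terms V → Terms V
    -ₜ_ = map (λ t → ℤ.- proj₁ t , proj₂ t)

    mono : Exponent V → Terms V
    mono e = (ℤ.1ℤ , e) ∷ []

    ⟦*⟧ : ∀ p r φ → ⟦ p *ₜ r ⟧ φ ≡ ⟦ p ⟧ (λ x → ⟦ r ⟧ (λ y → φ (x ⊕ y)))
    ⟦*⟧ p r φ = trans (∑-cartesianProductWith _ p r _)
      (∑-cong p (λ s → trans (∑-cong r (λ t → ℤₚ.*-assoc (proj₁ s) (proj₁ t) (φ (proj₂ s ⊕ proj₂ t))))
                             (sym (∑-*ˡ (proj₁ s) r (λ t → proj₁ t ℤ.* φ (proj₂ s ⊕ proj₂ t))))))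

    ⟦-⟧ : ∀ p φ → ⟦ -ₜ p ⟧ φ ≡ ℤ.- ⟦ p ⟧ φ
    ⟦-⟧ [] φ = refl
    ⟦-⟧ ((c , e) ∷ p) φ = trans (cong₂ ℤ._+_ (sym (ℤₚ.neg-distribˡ-* c (φ e))) (⟦-⟧ p φ)) (sym (ℤₚ.neg-distrib-+ (c ℤ.* φ e) _))

    ⟦mono⟧ : ∀ e φ → ⟦ mono e ⟧ φ ≡ φ e
    ⟦mono⟧ e φ = trans (ℤₚ.+-identityʳ _) (ℤₚ.*-identityˡ (φ e))

  -- Laurent polynomials over ℤ[q]/(q^{N+1}). Two lists of terms are equal if every ℤ-linear functional that
  -- kills all terms of q-degree above N takes the same value on both; the ring laws then reduce to laws of ⊕.
  module TermRing (V N : ℕ) where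
    open ℤ-Sums

    Vanishing : (Exponent V → ℤ) → Set
    Vanishing φ = ∀ d v → N ℕ.< d → φ (d , v) ≡ + 0

    infix 4 _≃_
    record _≃_ (p r : Terms V) : Set where
      constructor eq
      field ⟦≃⟧ : ∀ φ → Vanishing φ → ⟦ p ⟧ φ ≡ ⟦ r ⟧ φ
    open _≃_ public

    ≃-isEquivalence : IsEquivalence _≃_
    ≃-isEquivalence = record
      { refl = eq (λ _ _ → refl)
      ; sym = λ h → eq (λ φ v → sym (⟦≃⟧ h φ v))
      ; trans = λ g h → eq (λ φ v → trans (⟦≃⟧ g φ v) (⟦≃⟧ h φ v))
      }

    -- Multiplying by a monomial never lowers the q-degree. This is the ideal property of the terms
    -- of degree above N, and it makes `_*ₜ_` respect `_≃_`.
    Vanishing-⊕ : ∀ {φ} → Vanishing φ → ∀ x → Vanishing (λ y → φ (x ⊕ y))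
    Vanishing-⊕ h (d , u) e v N<e = h (d ℕ.+ e) _ (ℕₚ.<-≤-trans N<e (ℕₚ.m≤n+m e d))

    *ₜ-comm : ∀ p r → p *ₜ r ≃ r *ₜ p
    *ₜ-comm p r = eq λ φ _ → begin
      ⟦ p *ₜ r ⟧ φ                              ≡⟨ ⟦*⟧ p r φ ⟩
      ⟦ p ⟧ (λ x → ⟦ r ⟧ (λ y → φ (x ⊕ y)))     ≡⟨ ⟦⟧-swap p r (λ x y → φ (x ⊕ y)) ⟩
      ⟦ r ⟧ (λ y → ⟦ p ⟧ (λ x → φ (x ⊕ y)))     ≡⟨ ⟦⟧-cong r (λ y → ⟦⟧-cong p (λ x → cong φ (⊕-comm x y))) ⟩
      ⟦ r ⟧ (λ y → ⟦ p ⟧ (λ x → φ (y ⊕ x)))     ≡⟨ sym (⟦*⟧ r p φ) ⟩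
      ⟦ r *ₜ p ⟧ φ                              ∎

    *ₜ-congˡ : ∀ p {r s} → r ≃ s → p *ₜ r ≃ p *ₜ s
    *ₜ-congˡ p {r} {s} h = eq λ φ v → trans (⟦*⟧ p r φ)
      (trans (⟦⟧-cong p (λ x → ⟦≃⟧ h _ (Vanishing-⊕ v x))) (sym (⟦*⟧ p s φ)))

    *ₜ-assoc : ∀ p r s → (p *ₜ r) *ₜ s ≃ p *ₜ (r *ₜ s)
    *ₜ-assoc p r s = eq λ φ _ → begin
      ⟦ (p *ₜ r) *ₜ s ⟧ φ                                                 ≡⟨ ⟦*⟧ (p *ₜ r) s φ ⟩
      ⟦ p *ₜ r ⟧ (λ w → ⟦ s ⟧ (λ z → φ (w ⊕ z)))                          ≡⟨ ⟦*⟧ p r _ ⟩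
      ⟦ p ⟧ (λ x → ⟦ r ⟧ (λ y → ⟦ s ⟧ (λ z → φ ((x ⊕ y) ⊕ z))))
        ≡⟨ ⟦⟧-cong p (λ x → trans (⟦⟧-cong r (λ y → ⟦⟧-cong s (λ z → cong φ (⊕-assoc x y z)))) (sym (⟦*⟧ r s _))) ⟩
      ⟦ p ⟧ (λ x → ⟦ r *ₜ s ⟧ (λ w → φ (x ⊕ w)))                          ≡⟨ sym (⟦*⟧ p (r *ₜ s) φ) ⟩
      ⟦ p *ₜ (r *ₜ s) ⟧ φ                                                 ∎

    *ₜ-identityˡ : ∀ p → mono 0ₑ *ₜ p ≃ p
    *ₜ-identityˡ p = eq λ φ _ → trans (⟦*⟧ (mono 0ₑ) p φ)
      (trans (⟦mono⟧ 0ₑ (λ x → ⟦ p ⟧ (λ y → φ (x ⊕ y)))) (⟦⟧-cong p (λ e → cong φ (⊕-identityˡ e))))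

    *ₜ-distribˡ : ∀ p r s → p *ₜ (r ++ s) ≃ (p *ₜ r) ++ (p *ₜ s)
    *ₜ-distribˡ p r s = eq λ φ _ → begin
      ⟦ p *ₜ (r ++ s) ⟧ φ                                                          ≡⟨ ⟦*⟧ p (r ++ s) φ ⟩
      ⟦ p ⟧ (λ x → ⟦ r ++ s ⟧ (λ y → φ (x ⊕ y)))
        ≡⟨ ∑-cong p (λ t → trans (cong (proj₁ t ℤ.*_) (∑-++ r s _))
             (ℤₚ.*-distribˡ-+ (proj₁ t) (⟦ r ⟧ (λ y → φ (proj₂ t ⊕ y))) (⟦ s ⟧ (λ y → φ (proj₂ t ⊕ y))))) ⟩
      ∑ p (λ t → proj₁ t ℤ.* ⟦ r ⟧ (λ y → φ (proj₂ t ⊕ y)) ℤ.+ proj₁ t ℤ.* ⟦ s ⟧ (λ y → φ (proj₂ t ⊕ y)))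
        ≡⟨ ∑-+ p _ _ ⟩
      ⟦ p ⟧ (λ x → ⟦ r ⟧ (λ y → φ (x ⊕ y))) ℤ.+ ⟦ p ⟧ (λ x → ⟦ s ⟧ (λ y → φ (x ⊕ y)))
        ≡⟨ sym (cong₂ ℤ._+_ (⟦*⟧ p r φ) (⟦*⟧ p s φ)) ⟩
      ⟦ p *ₜ r ⟧ φ ℤ.+ ⟦ p *ₜ s ⟧ φ
        ≡⟨ sym (∑-++ (p *ₜ r) (p *ₜ s) _) ⟩
      ⟦ (p *ₜ r) ++ (p *ₜ s) ⟧ φ                                                   ∎

    private
      module E = IsEquivalence ≃-isEquivalence

      ++-cong : ∀ {p p′ r r′} → p ≃ p′ → r ≃ r′ → p ++ r ≃ p′ ++ r′
      ++-cong {p} {p′} {r} {r′} g h = eq λ φ v → trans (∑-++ p r _) (trans (cong₂ ℤ._+_ (⟦≃⟧ g φ v) (⟦≃⟧ h φ v)) (sym (∑-++ p′ r′ _)))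

      ++-comm : ∀ p r → p ++ r ≃ r ++ p
      ++-comm p r = eq λ φ _ → trans (∑-++ p r _) (trans (ℤₚ.+-comm (⟦ p ⟧ φ) (⟦ r ⟧ φ)) (sym (∑-++ r p _)))

      -ₜ-inverseˡ : ∀ p → (-ₜ p) ++ p ≃ []
      -ₜ-inverseˡ p = eq λ φ _ → trans (∑-++ (-ₜ p) p _) (trans (cong (ℤ._+ ⟦ p ⟧ φ) (⟦-⟧ p φ)) (ℤₚ.+-inverseˡ (⟦ p ⟧ φ)))

      ≡⇒≃ : ∀ {p r} → p ≡ r → p ≃ r
      ≡⇒≃ refl = E.refl

    termRing : CommutativeRing 0ℓ 0ℓ
    termRing = record
      { Carrier = Terms V
      ; _≈_ = _≃_
      ; _+_ = _++_
      ; _*_ = _*ₜ_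
      ; -_ = -ₜ_
      ; 0# = []
      ; 1# = mono 0ₑ
      ; isCommutativeRing = record
        { isRing = record
          { +-isAbelianGroup = record
            { isGroup = record
              { isMonoid = record
                { isSemigroup = record
                  { isMagma = record { isEquivalence = ≃-isEquivalence ; ∙-cong = ++-cong }
                  ; assoc = λ p r s → ≡⇒≃ (Listₚ.++-assoc p r s)
                  }
                ; identity = (λ _ → E.refl) , λ p → ≡⇒≃ (Listₚ.++-identityʳ p)
                }
              ; inverse = -ₜ-inverseˡ , λ p → E.trans (++-comm p (-ₜ p)) (-ₜ-inverseˡ p)
              ; ⁻¹-cong = λ {p} {r} h → eq λ φ v → trans (⟦-⟧ p φ) (trans (cong ℤ.-_ (⟦≃⟧ h φ v)) (sym (⟦-⟧ r φ)))
              }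
            ; comm = ++-comm
            }
          ; *-cong = λ {p} {p′} {r} {r′} g h → E.trans (*ₜ-congˡ p h)
              (E.trans (*ₜ-comm p r′) (E.trans (*ₜ-congˡ r′ g) (*ₜ-comm r′ p′)))
          ; *-assoc = *ₜ-assoc
          ; *-identity = *ₜ-identityˡ , λ p → E.trans (*ₜ-comm p (mono 0ₑ)) (*ₜ-identityˡ p)
          ; distrib = *ₜ-distribˡ , λ p r s → E.trans (*ₜ-comm (r ++ s) p)
              (E.trans (*ₜ-distribˡ p r s) (++-cong (*ₜ-comm p r) (*ₜ-comm p s)))
          }
        ; *-comm = *ₜ-comm
        }
      }

open LaurentTerms

-- Enumeration of partitions, chains of pairs and Durfee symbols.

module DurfeeSymbols where
  open ≡

  Pair : Set
  Pair = List ℕ × List ℕ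

  concatMap⁺-unique : {A B : Set} {h : A → List B} {xs : List A} → Unique xs → (∀ x → Unique (h x)) →
                      (∀ {x y z} → z ∈ h x → z ∈ h y → x ≡ y) → Unique (concatMap h xs)
  concatMap⁺-unique {xs = []} _ _ _ = []
  concatMap⁺-unique {h = h} {xs = x ∷ xs} u@(_ ∷ us) uh disjoint =
    Uniqueₚ.++⁺ (uh x) (concatMap⁺-unique us uh disjoint)
      (λ { (z∈ , z∈′) → Uniqueₚ.Unique[x∷xs]⇒x∉xs u (occurs z∈ (∈-concatMap⁻ h z∈′)) })
    where
    occurs : ∀ {z ys} → z ∈ h x → Any (λ y → z ∈ h y) ys → x ∈ ys
    occurs z∈ (here z∈′) = here (disjoint z∈ z∈′)
    occurs z∈ (there a) = there (occurs z∈ a)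

  -- Replacing the upper bound by the current entry merges monotonicity and both bounds into one
  -- inductive condition, suited to the recursion of `partitions`.
  Desc : ℕ → ℕ → List ℕ → Set
  Desc c b [] = ⊤
  Desc c b (x ∷ xs) = c ≤ x × x ≤ b × Desc c x xs

  Desc-weaken : ∀ {c a b} λs → a ≤ b → Desc c a λs → Desc c b λs
  Desc-weaken [] _ _ = tt
  Desc-weaken (x ∷ xs) a≤b (c≤x , x≤a , d) = c≤x , ℕₚ.≤-trans x≤a a≤b , d

  Desc-length : ∀ {c b} λs → 1 ≤ c → Desc c b λs → length λs ≤ sum λs
  Desc-length [] _ _ = ℕ.z≤n
  Desc-length (x ∷ xs) 1≤c (c≤x , _ , d) = ℕₚ.+-mono-≤ (ℕₚ.≤-trans 1≤c c≤x) (Desc-length xs 1≤c d)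

  module Enumeration (N : ℕ) where

    -- Up to t copies of a in front of the lists in L. The nesting yields the factor 1 + y + ⋯ + yᵗ
    -- in the generating function, which for t = N is literally `geo y`.
    prepend≤ : ℕ → List (List ℕ) → ℕ → List (List ℕ)
    prepend≤ a L zero = L
    prepend≤ a L (suc t) = L ++ map (a ∷_) (prepend≤ a L t)

    -- Every part size is used at most N times, which loses no partition of a number ≤ N.
    partitions : ℕ → ℕ → List (List ℕ)
    partitions c zero = [] ∷ []
    partitions c (suc b) with c ℕ.≤? suc b
    ... | yes _ = prepend≤ (suc b) (partitions c b) N
    ... | no _ = [] ∷ []

    partitions-sound : ∀ c b {λs} → λs ∈ partitions c b → Desc c b λs
    prepend≤-sound : ∀ c b t {λs} → c ≤ suc b → λs ∈ prepend≤ (suc b) (partitions c b) t → Desc c (suc b) λs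

    partitions-sound c zero (here refl) = tt
    partitions-sound c (suc b) λ∈ with c ℕ.≤? suc b
    ... | yes c≤ = prepend≤-sound c b N c≤ λ∈
    partitions-sound c (suc b) (here refl) | no _ = tt

    prepend≤-sound c b zero {λs} c≤ λ∈ = Desc-weaken λs (ℕₚ.n≤1+n b) (partitions-sound c b λ∈)
    prepend≤-sound c b (suc t) {λs} c≤ λ∈ with ∈-++⁻ (partitions c b) λ∈
    ... | inj₁ λ∈′ = Desc-weaken λs (ℕₚ.n≤1+n b) (partitions-sound c b λ∈′)
    ... | inj₂ λ∈′ with μ , μ∈ , refl ← ∈-map⁻ (suc b ∷_) λ∈′ = c≤ , ℕₚ.≤-refl , prepend≤-sound c b t c≤ μ∈

    partitions-complete : ∀ {c} b {λs} → 1 ≤ c → Desc c b λs → length λs ≤ N → λs ∈ partitions c b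
    prepend≤-complete : ∀ {c} b t {λs} → 1 ≤ c → c ≤ suc b → Desc c (suc b) λs → length λs ≤ t → t ≤ N →
                        λs ∈ prepend≤ (suc b) (partitions c b) t

    partitions-complete zero {[]} 1≤c d l = here refl
    partitions-complete zero {x ∷ xs} 1≤c (c≤x , x≤0 , _) l =
      contradiction (ℕₚ.≤-trans 1≤c (ℕₚ.≤-trans c≤x x≤0)) λ ()
    partitions-complete {c} (suc b) {λs} 1≤c d l with c ℕ.≤? suc b
    ... | yes c≤ = prepend≤-complete b N 1≤c c≤ d l ℕₚ.≤-refl
    partitions-complete {c} (suc b) {[]} 1≤c d l | no _ = here refl
    partitions-complete {c} (suc b) {x ∷ xs} 1≤c (c≤x , x≤b , _) l | no c≰ = contradiction (ℕₚ.≤-trans c≤x x≤b) c≰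

    prepend≤-complete b zero {[]} 1≤c c≤ d l t≤N = partitions-complete b 1≤c tt ℕ.z≤n
    prepend≤-complete b (suc t) {[]} 1≤c c≤ d l t≤N = ∈-++⁺ˡ (partitions-complete b 1≤c tt ℕ.z≤n)
    prepend≤-complete {c} b (suc t) {x ∷ xs} 1≤c c≤ (c≤x , x≤b , d) l t≤N with x ℕ.≟ suc b
    ... | yes refl = ∈-++⁺ʳ (partitions c b) (∈-map⁺ (suc b ∷_)
                       (prepend≤-complete b t 1≤c c≤ d (ℕₚ.≤-pred l) (ℕₚ.<⇒≤ t≤N)))
    ... | no x≢ = ∈-++⁺ˡ (partitions-complete b 1≤c (c≤x , ℕₚ.≤-pred (ℕₚ.≤∧≢⇒< x≤b x≢) , d) (ℕₚ.≤-trans l t≤N))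

    partitions-unique : ∀ c b → Unique (partitions c b)
    prepend≤-unique : ∀ c b t → Unique (prepend≤ (suc b) (partitions c b) t)

    partitions-unique c zero = [] ∷ []
    partitions-unique c (suc b) with c ℕ.≤? suc b
    ... | yes _ = prepend≤-unique c b N
    ... | no _ = [] ∷ []

    prepend≤-unique c b zero = partitions-unique c b
    prepend≤-unique c b (suc t) = Uniqueₚ.++⁺ (partitions-unique c b)
      (Uniqueₚ.map⁺ Listₚ.∷-injectiveʳ (prepend≤-unique c b t)) disjoint
      where
      disjoint : ∀ {λs} → ¬ (λs ∈ partitions c b × λs ∈ map (suc b ∷_) (prepend≤ (suc b) (partitions c b) t))
      disjoint (λ∈ , λ∈′) with μ , _ , refl ← ∈-map⁻ (suc b ∷_) λ∈′ with _ , b<b , _ ← partitions-sound c b λ∈ =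
        ℕₚ.<-irrefl refl b<b

    -- The condition c ≤ a does not follow from the other two, as both partitions may be empty; it
    -- corresponds to the value 0 of `F` for a < c.
    InBox : ℕ → ℕ → Pair → Set
    InBox c a (α , β) = c ≤ a × Desc c a α × Desc c a β

    pairsIn : ℕ → ℕ → List Pair
    pairsIn c a with c ℕ.≤? a
    ... | yes _ = cartesianProduct (partitions c a) (partitions c a)
    ... | no _ = []

    pairsIn-sound : ∀ c a {p} → p ∈ pairsIn c a → InBox c a p
    pairsIn-sound c a p∈ with c ℕ.≤? a
    ... | yes c≤a with α∈ , β∈ ← ∈-cartesianProduct⁻ (partitions c a) (partitions c a) p∈ =
      c≤a , partitions-sound c a α∈ , partitions-sound c a β∈

    pairsIn-complete : ∀ c a {p} → 1 ≤ c → InBox c a p → sum (proj₁ p) ≤ N → sum (proj₂ p) ≤ N → p ∈ pairsIn c a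
    pairsIn-complete c a {α , β} 1≤c (c≤a , dα , dβ) α≤N β≤N with c ℕ.≤? a
    ... | yes _ = ∈-cartesianProduct⁺ (partitions-complete a 1≤c dα (ℕₚ.≤-trans (Desc-length α 1≤c dα) α≤N))
                                      (partitions-complete a 1≤c dβ (ℕₚ.≤-trans (Desc-length β 1≤c dβ) β≤N))
    ... | no c≰a = contradiction c≤a c≰a

    pairsIn-unique : ∀ c a → Unique (pairsIn c a)
    pairsIn-unique c a with c ℕ.≤? a
    ... | yes _ = Uniqueₚ.cartesianProduct⁺ (partitions-unique c a) (partitions-unique c a)
    ... | no _ = []

    extend : ∀ {k} → ℕ → Pair → Vec Pair k → Vec Pair (suc k)
    extend a (α , β) ps = (a ∷ α , β) ∷ ps

    -- `suc i` is the largest part of the first α: `extend` puts it in place, it bounds the rest of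
    -- its pair from above, and it is the lower bound for all later pairs. The list is a
    -- term-by-term model of `chain`.
    chains : ∀ k → ℕ → ℕ → List (Vec Pair (suc k))
    chains zero c D = map (_∷ []) (pairsIn c D)
    chains (suc k) c D =
      concatMap (λ i → cartesianProductWith (extend (suc i)) (pairsIn c (suc i)) (chains k (suc i) D)) (upTo D)

    -- Conditions (1) and (2) reorganised: each pair lies between the largest part of the preceding
    -- α and that of its own α, with D closing the last pair.
    InChain : ∀ {k} → ℕ → ℕ → Vec Pair (suc k) → Set
    InChain c D (p ∷ []) = InBox c D p
    InChain c D (([] , β) ∷ p ∷ ps) = ⊥
    InChain c D ((a ∷ α , β) ∷ p ∷ ps) = InBox c a (α , β) × 1 ≤ a × a ≤ D × InChain a D (p ∷ ps)

    chains-sound : ∀ k c D {ps} → ps ∈ chains k c D → InChain c D ps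
    chains-sound zero c D ps∈ with p , p∈ , refl ← ∈-map⁻ (_∷ []) ps∈ = pairsIn-sound c D p∈
    chains-sound (suc k) c D ps∈
      with i , i∈ , ps∈′ ← find (∈-concatMap⁻ _ {xs = upTo D} ps∈)
      with p , p′ ∷ rest , p∈ , rest∈ , refl ← ∈-cartesianProductWith⁻ (extend (suc i)) (pairsIn c (suc i)) (chains k (suc i) D) ps∈′ =
      pairsIn-sound c (suc i) p∈ , ℕ.s≤s ℕ.z≤n , ∈-upTo⁻ i∈ , chains-sound k (suc i) D rest∈

    chains-complete : ∀ k c D ps → 1 ≤ c → InChain c D ps → weight ps ≤ N → ps ∈ chains k c D
    chains-complete zero c D ((α , β) ∷ []) 1≤c box w =
      ∈-map⁺ (_∷ []) (pairsIn-complete c D 1≤c box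
        (ℕₚ.≤-trans (ℕₚ.m≤m+n _ _) (ℕₚ.m+n≤o⇒m≤o (sum α ℕ.+ sum β) w)) (ℕₚ.≤-trans (ℕₚ.m≤n+m _ _) (ℕₚ.m+n≤o⇒m≤o (sum α ℕ.+ sum β) w)))
    chains-complete (suc k) c D ((suc i ∷ α , β) ∷ p ∷ ps) 1≤c (box , _ , a≤D , rest) w =
      ∈-concatMap⁺ _ (lose (∈-upTo⁺ a≤D) (∈-cartesianProductWith⁺ (extend (suc i))
        (pairsIn-complete c (suc i) 1≤c box
          (ℕₚ.≤-trans (ℕₚ.m≤n+m _ (suc i)) (ℕₚ.≤-trans (ℕₚ.m≤m+n _ _) w′)) (ℕₚ.≤-trans (ℕₚ.m≤n+m _ _) w′))
        (chains-complete k (suc i) D (p ∷ ps) (ℕ.s≤s ℕ.z≤n) rest (ℕₚ.m+n≤o⇒n≤o (suc i ℕ.+ sum α ℕ.+ sum β) w))))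
      where
      w′ : suc i ℕ.+ sum α ℕ.+ sum β ≤ N
      w′ = ℕₚ.m+n≤o⇒m≤o (suc i ℕ.+ sum α ℕ.+ sum β) w

    chains-unique : ∀ k c D → Unique (chains k c D)
    chains-unique zero c D = Uniqueₚ.map⁺ (λ { refl → refl }) (pairsIn-unique c D)
    chains-unique (suc k) c D = concatMap⁺-unique (Uniqueₚ.upTo⁺ D)
      (λ i → Uniqueₚ.cartesianProductWith⁺ (extend (suc i)) (λ { refl → refl , refl }) (pairsIn-unique c (suc i)) (chains-unique k (suc i) D))
      same-head
      where
      same-head : ∀ {i j ps} → ps ∈ cartesianProductWith (extend (suc i)) (pairsIn c (suc i)) (chains k (suc i) D) →
                  ps ∈ cartesianProductWith (extend (suc j)) (pairsIn c (suc j)) (chains k (suc j) D) → i ≡ j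
      same-head {i} {j} ps∈ ps∈′
        with _ , _ , _ , _ , refl ← ∈-cartesianProductWith⁻ (extend (suc i)) (pairsIn c (suc i)) (chains k (suc i) D) ps∈
        with _ , _ , _ , _ , refl ← ∈-cartesianProductWith⁻ (extend (suc j)) (pairsIn c (suc j)) (chains k (suc j) D) ps∈′ = refl

  Desc-linked : ∀ {c b} λs → Desc c b λs → Linked _≥_ λs
  Desc-linked [] _ = []
  Desc-linked (x ∷ []) _ = [-]
  Desc-linked (x ∷ y ∷ ys) (_ , _ , d) = proj₁ (proj₂ d) ∷ Desc-linked (y ∷ ys) d

  Desc-≥ : ∀ {c b} λs → Desc c b λs → LAll.All (c ≤_) λs
  Desc-≥ [] _ = []
  Desc-≥ (x ∷ xs) (c≤x , _ , d) = c≤x ∷ Desc-≥ xs d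

  Desc-≤ : ∀ {c b} λs → Desc c b λs → LAll.All (_≤ b) λs
  Desc-≤ [] _ = []
  Desc-≤ (x ∷ xs) (_ , x≤b , d) = x≤b ∷ Desc-≤ xs (Desc-weaken xs x≤b d)

  linked-head : ∀ {x} λs → Linked _≥_ (x ∷ λs) → MAll.All (_≤ x) (head λs)
  linked-head [] _ = nothing
  linked-head (y ∷ ys) (y≤x ∷ _) = just y≤x

  linked-Desc : ∀ {c b} λs → Linked _≥_ λs → LAll.All (c ≤_) λs → MAll.All (_≤ b) (head λs) → Desc c b λs
  linked-Desc [] _ _ _ = tt
  linked-Desc (x ∷ xs) l (c≤x ∷ cs) (just x≤b) = c≤x , x≤b , linked-Desc xs (Linked.tail l) cs (linked-head xs l)

  head-All : ∀ {P : ℕ → Set} {xs} → LAll.All P xs → MAll.All P (head xs)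
  head-All [] = nothing
  head-All (p ∷ _) = just p

  last-All : ∀ {P : ℕ → Set} {xs} → LAll.All P xs → MAll.All P (last xs)
  last-All [] = nothing
  last-All (p ∷ []) = just p
  last-All (_ ∷ p ∷ ps) = last-All (p ∷ ps)

  last-≥ : ∀ {a} λs → Linked _≥_ λs → MAll.All (a ≤_) (last λs) → LAll.All (a ≤_) λs
  last-≥ [] _ _ = []
  last-≥ (x ∷ []) _ (just a≤x) = a≤x ∷ []
  last-≥ (x ∷ y ∷ ys) (y≤x ∷ l) h with last-≥ (y ∷ ys) l h
  ... | a≤y ∷ rest = ℕₚ.≤-trans a≤y y≤x ∷ a≤y ∷ rest

  -- The Durfee symbols of N with given ranks correspond to a duplicate-free list.

  module Bijection (N : ℕ) where
    open Enumeration N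

    Parts : Pair → Set
    Parts p = IsPartition (proj₁ p) × IsPartition (proj₂ p)

    Bounded : ℕ → Pair → Set
    Bounded D p = LAll.All (_≤ D) (proj₁ p) × LAll.All (_≤ D) (proj₂ p)

    FromBelow : ∀ {k} → ℕ → Vec Pair (suc k) → Set
    FromBelow c (p ∷ _) = LAll.All (c ≤_) (proj₁ p) × LAll.All (c ≤_) (proj₂ p)

    -- The largest part of one α bounds the smallest parts of the next pair, hence by monotonicity
    -- all its parts. That a ≤ D is read off the bounds on all parts, because an empty last pair
    -- compares nothing with D.
    toChain : ∀ {k} c D (ps : Vec Pair (suc k)) → c ≤ D → VAll.All Parts ps → Valid ps D →
              VAll.All (Bounded D) ps → FromBelow c ps → InChain c D ps
    toChain c D ((α , β) ∷ []) c≤D (((lα , _) , (lβ , _)) VAll.∷ _) (hα , hβ) _ (cα , cβ) =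
      c≤D , linked-Desc α lα cα hα , linked-Desc β lβ cβ hβ
    toChain c D ((a ∷ α , β) ∷ (α′ , β′) ∷ ps) c≤D (((lα , pos ∷ _) , (lβ , _)) VAll.∷ parts@(((lα′ , _) , (lβ′ , _)) VAll.∷ _))
            ((β≤a , a≤α′ , a≤β′) , valid) ((a≤D ∷ _ , _) VAll.∷ bounded) (c≤a ∷ cα , cβ) =
      (c≤a , linked-Desc α (Linked.tail lα) cα (linked-head α lα) , linked-Desc β lβ cβ β≤a) , pos , a≤D ,
      toChain a D ((α′ , β′) ∷ ps) a≤D parts valid bounded (last-≥ α′ lα′ a≤α′ , last-≥ β′ lβ′ a≤β′)

    fromBelow : ∀ {k} c D (ps : Vec Pair (suc k)) → InChain c D ps → FromBelow c ps
    fromBelow c D ((α , β) ∷ []) (_ , dα , dβ) = Desc-≥ α dα , Desc-≥ β dβ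
    fromBelow c D ((a ∷ α , β) ∷ p ∷ ps) ((c≤a , dα , dβ) , _) = c≤a ∷ Desc-≥ α dα , Desc-≥ β dβ

    Desc-partition : ∀ {c b} λs → 1 ≤ c → Desc c b λs → IsPartition λs
    Desc-partition λs 1≤c d = Desc-linked λs d , LAll.map (ℕₚ.≤-trans 1≤c) (Desc-≥ λs d)

    chain-parts : ∀ {k} c D (ps : Vec Pair (suc k)) → 1 ≤ c → InChain c D ps → VAll.All Parts ps
    chain-parts c D ((α , β) ∷ []) 1≤c (_ , dα , dβ) = (Desc-partition α 1≤c dα , Desc-partition β 1≤c dβ) VAll.∷ VAll.[]
    chain-parts c D ((a ∷ α , β) ∷ p ∷ ps) 1≤c ((c≤a , dα , dβ) , 1≤a , _ , rest) =
      (Desc-partition (a ∷ α) 1≤c (c≤a , ℕₚ.≤-refl , dα) , Desc-partition β 1≤c dβ) VAll.∷ chain-parts a D (p ∷ ps) 1≤a rest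

    chain-bounded : ∀ {k} c D (ps : Vec Pair (suc k)) → InChain c D ps → VAll.All (Bounded D) ps
    chain-bounded c D ((α , β) ∷ []) (_ , dα , dβ) = (Desc-≤ α dα , Desc-≤ β dβ) VAll.∷ VAll.[]
    chain-bounded c D ((a ∷ α , β) ∷ p ∷ ps) ((_ , dα , dβ) , _ , a≤D , rest) =
      (a≤D ∷ Desc-≤ α (Desc-weaken α a≤D dα) , Desc-≤ β (Desc-weaken β a≤D dβ)) VAll.∷ chain-bounded a D (p ∷ ps) rest

    chain-valid : ∀ {k} c D (ps : Vec Pair (suc k)) → InChain c D ps → Valid ps D
    chain-valid c D ((α , β) ∷ []) (_ , dα , dβ) = head-All (Desc-≤ α dα) , head-All (Desc-≤ β dβ)
    chain-valid c D ((a ∷ α , β) ∷ p ∷ ps) ((_ , _ , dβ) , _ , _ , rest) with fromBelow a D (p ∷ ps) rest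
    ... | aα′ , aβ′ = (head-All (Desc-≤ β dβ) , last-All aα′ , last-All aβ′) , chain-valid a D (p ∷ ps) rest

    -- Contains symbols of sizes other than N too, so that its generating function is the full
    -- nested sum; `counted` selects the size and the ranks afterwards.
    symbols : ∀ k → List (Vec Pair (suc k) × ℕ)
    symbols k = concatMap (λ i → map (_, suc i) (chains k 1 (suc i))) (upTo N)

    symbols-unique : ∀ k → Unique (symbols k)
    symbols-unique k = concatMap⁺-unique (Uniqueₚ.upTo⁺ N) (λ i → Uniqueₚ.map⁺ (cong proj₁) (chains-unique k 1 (suc i))) same-D
      where
      same-D : ∀ {i j s} → s ∈ map (_, suc i) (chains k 1 (suc i)) → s ∈ map (_, suc j) (chains k 1 (suc j)) → i ≡ j
      same-D {i} {j} s∈ s∈′ with _ , _ , refl ← ∈-map⁻ (_, suc i) s∈ with _ , _ , refl ← ∈-map⁻ (_, suc j) s∈′ = refl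

    symbols-sound : ∀ k {ps D} → (ps , D) ∈ symbols k → 1 ≤ D × InChain 1 D ps
    symbols-sound k s∈
      with i , i∈ , s∈′ ← find (∈-concatMap⁻ _ {xs = upTo N} s∈)
      with ps , ps∈ , refl ← ∈-map⁻ (_, suc i) s∈′ = ℕ.s≤s ℕ.z≤n , chains-sound k 1 (suc i) ps∈

    symbols-complete : ∀ k {ps D} → 1 ≤ D → D ≤ N → InChain 1 D ps → weight ps ≤ N → (ps , D) ∈ symbols k
    symbols-complete k {ps} {suc D} _ D≤N chain w =
      ∈-concatMap⁺ _ (lose (∈-upTo⁺ D≤N) (∈-map⁺ (_, suc D) (chains-complete k 1 (suc D) ps ℕₚ.≤-refl chain w)))

    Counted : ∀ {k} → Vec ℤ (suc k) → Vec Pair (suc k) × ℕ → Set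
    Counted ms (ps , D) = weight ps ℕ.+ D ℕ.* D ≡ N × ranks ps ≡ ms

    counted? : ∀ {k} (ms : Vec ℤ (suc k)) s → Dec (Counted ms s)
    counted? ms (ps , D) = (weight ps ℕ.+ D ℕ.* D ℕ.≟ N) ×-dec Vecₚ.≡-dec ℤ._≟_ (ranks ps) ms

    counted : ∀ {k} → Vec ℤ (suc k) → List (Vec Pair (suc k) × ℕ)
    counted {k} ms = filter (counted? ms) (symbols k)

    lookup-injective : ∀ {A : Set} {xs : List A} → Unique xs → ∀ {i j} → lookup xs i ≡ lookup xs j → i ≡ j
    lookup-injective (_ ∷ u) {zero} {zero} _ = refl
    lookup-injective {xs = x ∷ xs} (x∉ ∷ u) {zero} {suc j} e = contradiction e (LAll.lookup x∉ (∈-lookup j))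
    lookup-injective {xs = x ∷ xs} (x∉ ∷ u) {suc i} {zero} e = contradiction (sym e) (LAll.lookup x∉ (∈-lookup i))
    lookup-injective (_ ∷ u) {suc i} {suc j} e = cong suc (lookup-injective u e)

    -- The image of the injection `h` is exactly the set of entries of a duplicate-free list, so the
    -- positions in the list number the elements of B.
    listing-size : ∀ {A B : Set} (xs : List A) → Unique xs → (h : B → A) → (∀ {b b′} → h b ≡ h b′ → b ≡ b′) →
                   (∀ b → h b ∈ xs) → (∀ {a} → a ∈ xs → ∃[ b ] h b ≡ a) → HasSize B (length xs)
    listing-size xs u h h-injective h∈ section = mk↔ₛ′ to from
      (λ b → h-injective (trans (proj₂ (section (∈-lookup (from b)))) (sym (lookup-index (h∈ b)))))
      (λ i → lookup-injective u (trans (sym (lookup-index (h∈ (to i)))) (proj₂ (section (∈-lookup i)))))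
      where
      to = λ i → proj₁ (section (∈-lookup {xs = xs} i))
      from = λ b → index (h∈ b)

    IsPartition-irrelevant : ∀ {λs} (u v : IsPartition λs) → u ≡ v
    IsPartition-irrelevant (a , b) (c , d) = cong₂ _,_ (Linked.irrelevant ℕₚ.≤-irrelevant a c) (LAll.irrelevant ℕₚ.≤-irrelevant b d)

    Parts-irrelevant : ∀ {p} (u v : Parts p) → u ≡ v
    Parts-irrelevant (a , b) (c , d) = cong₂ _,_ (IsPartition-irrelevant a c) (IsPartition-irrelevant b d)

    Bounded-irrelevant : ∀ {D p} (u v : Bounded D p) → u ≡ v
    Bounded-irrelevant (a , b) (c , d) = cong₂ _,_ (LAll.irrelevant ℕₚ.≤-irrelevant a c) (LAll.irrelevant ℕₚ.≤-irrelevant b d)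

    Link-irrelevant : ∀ p p′ (u v : Link p p′) → u ≡ v
    Link-irrelevant (a ∷ α , β) (α′ , β′) (u , u′ , u″) (v , v′ , v″) = cong₂ _,_ (MAll.irrelevant ℕₚ.≤-irrelevant u v)
      (cong₂ _,_ (MAll.irrelevant ℕₚ.≤-irrelevant u′ v′) (MAll.irrelevant ℕₚ.≤-irrelevant u″ v″))

    Valid-irrelevant : ∀ {k} (ps : Vec Pair k) D (u v : Valid ps D) → u ≡ v
    Valid-irrelevant ((α , β) ∷ []) D (u , u′) (v , v′) =
      cong₂ _,_ (MAll.irrelevant ℕₚ.≤-irrelevant u v) (MAll.irrelevant ℕₚ.≤-irrelevant u′ v′)
    Valid-irrelevant (p ∷ p′ ∷ ps) D (u , u′) (v , v′) = cong₂ _,_ (Link-irrelevant p p′ u v) (Valid-irrelevant (p′ ∷ ps) D u′ v′)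

    underlying : ∀ {k ms} → DurfeeSet (suc k) ms N → Vec Pair (suc k) × ℕ
    underlying (τ , _) = MarkedDurfee.pairs τ , MarkedDurfee.D τ

    -- Symbols with the same arrays and the same D could differ only in their proofs. The order
    -- conditions have unique proofs by the lemmas above, the two equations by uniqueness of
    -- identity proofs.
    underlying-injective : ∀ {k ms} {s t : DurfeeSet (suc k) ms N} → underlying s ≡ underlying t → s ≡ t
    underlying-injective {s = mkDurfee ps D p q r b refl , refl} {t = mkDurfee .ps .D p′ q′ r′ b′ e , refl} refl
      with refl ← ℕₚ.≤-irrelevant p p′ | refl ← VAll.irrelevant Parts-irrelevant q q′ | refl ← Valid-irrelevant ps D r r′
         | refl ← VAll.irrelevant Bounded-irrelevant b b′ | refl ← e = refl

    underlying-counted : ∀ {k ms} (s : DurfeeSet (suc k) ms N) → underlying s ∈ counted ms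
    underlying-counted {k} {ms} (mkDurfee ps@((_ , _) ∷ _) D 1≤D parts@((pα , pβ) VAll.∷ _) valid bounded size , r) =
      ∈-filter⁺ (counted? ms) (symbols-complete k 1≤D D≤N (toChain 1 D ps 1≤D parts valid bounded (proj₂ pα , proj₂ pβ))
        (ℕₚ.m+n≤o⇒m≤o (weight ps) (ℕₚ.≤-reflexive size))) (size , r)
      where
      D≤N : D ≤ N
      D≤N = ℕₚ.≤-trans (ℕₚ.m≤m*n D D {{ℕ.>-nonZero 1≤D}}) (ℕₚ.m+n≤o⇒n≤o (weight ps) (ℕₚ.≤-reflexive size))

    counted-underlying : ∀ {k} {ms : Vec ℤ (suc k)} {s} → s ∈ counted ms → ∃[ t ] underlying {k} {ms} t ≡ s
    counted-underlying {k} {ms} {ps , D} s∈ with ∈-filter⁻ (counted? ms) {xs = symbols k} s∈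
    ... | s∈′ , size , r with symbols-sound k s∈′
    ... | 1≤D , chain = (mkDurfee ps D 1≤D (chain-parts 1 D ps ℕₚ.≤-refl chain) (chain-valid 1 D ps chain)
                           (chain-bounded 1 D ps chain) size , r) , refl

    DurfeeSet-size : ∀ {k} (ms : Vec ℤ (suc k)) → HasSize (DurfeeSet (suc k) ms N) (length (counted ms))
    DurfeeSet-size {k} ms = listing-size (counted ms) (Uniqueₚ.filter⁺ (counted? ms) (symbols-unique k)) underlying
      underlying-injective underlying-counted counted-underlying

open DurfeeSymbols

-- Generating functions of the enumerated lists.

module GeneratingFunctions (R : CommutativeRing 0ℓ 0ℓ) where
  open CommutativeRing R hiding (zero)
  open ListSums R
  open QSeries R
  open Unit
  open Algebra.Properties.CommutativeSemiring.Exp commutativeSemiring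
  open Relation.Binary.Reasoning.Setoid setoid

  module Weights (q : Carrier) (N : ℕ) (q^[1+N]≈0 : q ^ suc N ≈ 0#) where
    open Truncated q N q^[1+N]≈0
    open Enumeration N
    open Bijection N

    partitionWeight : Carrier → List ℕ → Carrier
    partitionWeight x [] = 1#
    partitionWeight x (a ∷ λs) = x * q ^ a * partitionWeight x λs

    pairWeight : Unit → Pair → Carrier
    pairWeight x (α , β) = partitionWeight (val x) α * partitionWeight (inv x) β

    -- The first part of αʲ is recorded by q alone, which accounts for the -1 in the j-th rank, j < K.
    chainWeight : ∀ {k} → Unit → Vec Unit k → Vec Pair (suc k) → Carrier
    chainWeight x [] (p ∷ []) = pairWeight x p
    chainWeight x (y ∷ ys) (([] , β) ∷ ps) = 0#
    chainWeight x (y ∷ ys) ((a ∷ α , β) ∷ ps) = q ^ a * pairWeight x (α , β) * chainWeight y ys ps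

    symbolWeight : ∀ {k} → Unit → Vec Unit k → Vec Pair (suc k) × ℕ → Carrier
    symbolWeight x xs (ps , D) = q ^ (D ℕ.* D) * chainWeight x xs ps

    prepend≤-gf : ∀ x a L t → ∑ (prepend≤ a L t) (partitionWeight x) ≈
                              ∑< (suc t) ((x * q ^ a) ^_) * ∑ L (partitionWeight x)
    prepend≤-gf x a L zero = sym (trans (*-congʳ (+-identityʳ 1#)) (*-identityˡ _))
    prepend≤-gf x a L (suc t) = begin
      ∑ (prepend≤ a L (suc t)) W                              ≈⟨ ∑-++ L _ W ⟩
      ∑ L W + ∑ (map (a ∷_) (prepend≤ a L t)) W
        ≈⟨ +-congˡ (trans (∑-map (a ∷_) (prepend≤ a L t) W) (sym (∑-*ˡ y (prepend≤ a L t) W))) ⟩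
      ∑ L W + y * ∑ (prepend≤ a L t) W
        ≈⟨ +-cong (sym (*-identityˡ _)) (trans (*-congˡ (prepend≤-gf x a L t)) (sym (*-assoc _ _ _))) ⟩
      1# * ∑ L W + y * ∑< (suc t) (y ^_) * ∑ L W              ≈⟨ sym (distribʳ _ _ _) ⟩
      (1# + y * ∑< (suc t) (y ^_)) * ∑ L W                    ≈⟨ *-congʳ (+-congˡ (∑-*ˡ y (upTo (suc t)) _)) ⟩
      (1# + ∑< (suc t) (λ i → y ^ suc i)) * ∑ L W             ≈⟨ *-congʳ (sym (∑<-head (suc t) (y ^_))) ⟩
      ∑< (suc (suc t)) (y ^_) * ∑ L W                         ∎
      where
      W : List ℕ → Carrier
      W = partitionWeight x
      y : Carrier
      y = x * q ^ a

    partitions-gf : ∀ x c b → ∑ (partitions c b) (partitionWeight x) ≈ below x c b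
    partitions-gf x c zero = +-identityʳ 1#
    partitions-gf x c (suc b) with c ℕ.≤? suc b
    ... | yes _ = trans (prepend≤-gf x (suc b) (partitions c b) N) (*-congˡ (partitions-gf x c b))
    ... | no _ = +-identityʳ 1#

    pairsIn-gf : ∀ x c a → ∑ (pairsIn c a) (pairWeight x) ≈ F x c a
    pairsIn-gf x c a with c ℕ.≤? a
    ... | yes _ = trans (∑-product _,_ (partitions c a) (partitions c a) (λ _ _ → refl))
                        (*-cong (partitions-gf (val x) c a) (partitions-gf (inv x) c a))
    ... | no _ = refl

    chains-gf : ∀ {k} x (xs : Vec Unit k) c D → ∑ (chains k c D) (chainWeight x xs) ≈ chain x xs c D
    chains-gf x [] c D = trans (∑-map (_∷ []) (pairsIn c D) _) (pairsIn-gf x c D)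
    chains-gf {suc k} x (y ∷ ys) c D = begin
      ∑ (chains (suc k) c D) (chainWeight x (y ∷ ys))      ≈⟨ ∑-concatMap _ (upTo D) _ ⟩
      _                                                    ≈⟨ ∑-cong (upTo D) (λ i → trans
            (∑-product (extend (suc i)) (pairsIn c (suc i)) (chains k (suc i) D)
              {g = λ p → q ^ suc i * pairWeight x p} {k = chainWeight y ys} (λ _ _ → refl))
            (*-cong (trans (sym (∑-*ˡ (q ^ suc i) (pairsIn c (suc i)) (pairWeight x))) (*-congˡ (pairsIn-gf x c (suc i))))
                    (chains-gf y ys (suc i) D))) ⟩
      chain x (y ∷ ys) c D                                 ∎

    symbols-gf : ∀ {k} x (xs : Vec Unit k) → ∑ (symbols k) (symbolWeight x xs) ≈
                                             ∑< N (λ d → q ^ (suc d ℕ.* suc d) * chain x xs 1 (suc d))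
    symbols-gf {k} x xs = trans (∑-concatMap _ (upTo N) _) (∑-cong (upTo N) (λ d →
      trans (∑-map (_, suc d) (chains k 1 (suc d)) _)
        (trans (sym (∑-*ˡ (q ^ (suc d ℕ.* suc d)) (chains k 1 (suc d)) (chainWeight x xs)))
          (*-congˡ (chains-gf x xs 1 (suc d))))))

-- Linear functionals on the Laurent polynomials of the statement.

module Functionals {k : ℕ} where
  open ℤ-Sums
  open ≡-Reasoning

  ⟪_⟫ : LPoly k → (Vec ℤ k → ℤ) → ℤ
  ⟪ p ⟫ φ = ∑ p (λ t → proj₁ t ℤ.* φ (proj₂ t))

  ⟪⟫-cong : ∀ p {φ χ} → (∀ e → φ e ≡ χ e) → ⟪ p ⟫ φ ≡ ⟪ p ⟫ χ
  ⟪⟫-cong p h = ∑-cong p (λ t → ≡.cong (proj₁ t ℤ.*_) (h (proj₂ t)))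

  ⟪⟫-zero : ∀ p {φ} → (∀ e → φ e ≡ + 0) → ⟪ p ⟫ φ ≡ + 0
  ⟪⟫-zero p h = ∑-zero-∈ p (λ {t} _ → ≡.trans (≡.cong (proj₁ t ℤ.*_) (h (proj₂ t))) (ℤₚ.*-zeroʳ (proj₁ t)))

  ⟪*⟫ : ∀ p r φ → ⟪ p *L r ⟫ φ ≡ ⟪ p ⟫ (λ u → ⟪ r ⟫ (λ v → φ (zipWith ℤ._+_ u v)))
  ⟪*⟫ p r φ = ≡.trans (∑-concatMap _ p _) (∑-cong p (λ s → ≡.trans (∑-map _ r _)
    (≡.trans (∑-cong r (λ t → ℤₚ.*-assoc (proj₁ s) (proj₁ t) (φ (zipWith ℤ._+_ (proj₂ s) (proj₂ t)))))
             (≡.sym (∑-*ˡ (proj₁ s) r (λ t → proj₁ t ℤ.* φ (zipWith ℤ._+_ (proj₂ s) (proj₂ t))))))))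

  ⟪⟫-∑ : ∀ {A : Set} p (xs : List A) (φ : Vec ℤ k → A → ℤ) → ⟪ p ⟫ (λ u → ∑ xs (φ u)) ≡ ∑ xs (λ x → ⟪ p ⟫ (λ u → φ u x))
  ⟪⟫-∑ p xs φ = ≡.trans (∑-cong p (λ t → ∑-*ˡ (proj₁ t) xs (φ (proj₂ t)))) (∑-swap p xs (λ t x → proj₁ t ℤ.* φ (proj₂ t) x))

  ⟪sum⟫ : ∀ {A : Set} (h : A → LPoly k) xs φ → ⟪ sumL (map h xs) ⟫ φ ≡ ∑ xs (λ x → ⟪ h x ⟫ φ)
  ⟪sum⟫ h [] φ = ≡.refl
  ⟪sum⟫ h (x ∷ xs) φ = ≡.trans (∑-++ (h x) (sumL (map h xs)) _) (≡.cong (λ i → ⟪ h x ⟫ φ ℤ.+ i) (⟪sum⟫ h xs φ))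

  ⟪neg⟫ : ∀ p φ → ⟪ negL p ⟫ φ ≡ ℤ.- ⟪ p ⟫ φ
  ⟪neg⟫ [] φ = ≡.refl
  ⟪neg⟫ ((c , e) ∷ p) φ = ≡.trans (≡.cong₂ ℤ._+_ (≡.sym (ℤₚ.neg-distribˡ-* c (φ e))) (⟪neg⟫ p φ))
                            (≡.sym (ℤₚ.neg-distrib-+ (c ℤ.* φ e) (⟪ p ⟫ φ)))

  indicator : Vec ℤ k → Vec ℤ k → ℤ
  indicator m e = if ⌊ Vecₚ.≡-dec ℤ._≟_ e m ⌋ then + 1 else + 0

  -- Coefficient extraction is itself a linear functional, so equality in the truncated ring can be
  -- tested on it.
  coeffL≡⟪⟫ : ∀ p m → coeffL p m ≡ ⟪ p ⟫ (indicator m)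
  coeffL≡⟪⟫ [] m = ≡.refl
  coeffL≡⟪⟫ ((c , e) ∷ p) m = ≡.cong₂ ℤ._+_ scale (coeffL≡⟪⟫ p m)
    where
    scale : (if ⌊ Vecₚ.≡-dec ℤ._≟_ e m ⌋ then c else + 0) ≡ c ℤ.* indicator m e
    scale with Vecₚ.≡-dec ℤ._≟_ e m
    ... | yes _ = ≡.sym (ℤₚ.*-identityʳ c)
    ... | no _ = ≡.sym (ℤₚ.*-zeroʳ c)

open Functionals

-- Rearrangement of double sums, and counting by indicators.

module IntegerSums where
  open ℤ-Sums
  open ≡-Reasoning

  -- Serves the Cauchy product: truncated series multiply over a square of index pairs, their
  -- product over a triangle, and the entries in between vanish. The auxiliary `C` extends the
  -- triangle by 0 so that the sums can be exchanged.
  ∑<-triangle : ∀ M (B : ℕ → ℕ → ℤ) → (∀ i j → M ℕ.≤ i ℕ.+ j → B i j ≡ + 0) →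
                ∑< M (λ n → ∑< (suc n) (λ i → B i (n ∸ i))) ≡ ∑< M (λ i → ∑< M (B i))
  ∑<-triangle M B vanish = begin
    ∑< M (λ n → ∑< (suc n) (λ i → B i (n ∸ i)))
      ≡⟨ ∑<-cong M (λ n n<M → ≡.trans (∑<-cong (suc n) (λ i i<n → ≡.sym (C-≤ (ℕₚ.≤-pred i<n))))
            (≡.sym (∑<-truncate n<M (λ i n<i _ → C-> n<i)))) ⟩
    ∑< M (λ n → ∑< M (λ i → C i n))         ≡⟨ ∑-swap (upTo M) (upTo M) (λ n i → C i n) ⟩
    ∑< M (λ i → ∑< M (C i))                 ≡⟨ ∑<-cong M row ⟩
    ∑< M (λ i → ∑< M (B i))                 ∎
    where
    C : ℕ → ℕ → ℤ
    C i n with i ℕ.≤? n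
    ... | yes _ = B i (n ∸ i)
    ... | no _ = + 0
    C-≤ : ∀ {i n} → i ℕ.≤ n → C i n ≡ B i (n ∸ i)
    C-≤ {i} {n} i≤n with i ℕ.≤? n
    ... | yes _ = ≡.refl
    ... | no i≰n = contradiction i≤n i≰n
    C-> : ∀ {i n} → n ℕ.< i → C i n ≡ + 0
    C-> {i} {n} n<i with i ℕ.≤? n
    ... | yes i≤n = contradiction i≤n (ℕₚ.<⇒≱ n<i)
    ... | no _ = ≡.refl
    row : ∀ i → i ℕ.< M → ∑< M (C i) ≡ ∑< M (B i)
    row i i<M = begin
      ∑< M (C i)
        ≡⟨ ≡.cong (λ l → ∑< l (C i)) (≡.sym (ℕₚ.m+[n∸m]≡n (ℕₚ.<⇒≤ i<M))) ⟩
      ∑< (i ℕ.+ (M ∸ i)) (C i)                              ≡⟨ ∑<-+ i (M ∸ i) (C i) ⟩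
      ∑< i (C i) ℤ.+ ∑< (M ∸ i) (λ j → C i (i ℕ.+ j))
        ≡⟨ ≡.cong₂ ℤ._+_ (∑<-zero i (λ n n<i → C-> n<i))
             (∑<-cong (M ∸ i) (λ j _ → ≡.trans (C-≤ (ℕₚ.m≤m+n i j)) (≡.cong (B i) (ℕₚ.m+n∸m≡n i j)))) ⟩
      + 0 ℤ.+ ∑< (M ∸ i) (B i)                              ≡⟨ ℤₚ.+-identityˡ (∑< (M ∸ i) (B i)) ⟩
      ∑< (M ∸ i) (B i)
        ≡⟨ ≡.sym (∑<-truncate (ℕₚ.m∸n≤m M i) (λ j M-i≤j _ → vanish i j (ℕₚ.≤-trans (ℕₚ.m≤n+m∸n M i) (ℕₚ.+-monoʳ-≤ i M-i≤j)))) ⟩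
      ∑< M (B i)                                            ∎

  ∑-indicator : ∀ {A : Set} {P : A → Set} (P? : ∀ x → Dec (P x)) xs →
                ∑ xs (λ x → if ⌊ P? x ⌋ then + 1 else + 0) ≡ + length (filter P? xs)
  ∑-indicator P? [] = ≡.refl
  ∑-indicator P? (x ∷ xs) with P? x
  ... | yes _ = ≡.cong (λ i → + 1 ℤ.+ i) (∑-indicator P? xs)
  ... | no _ = ≡.trans (ℤₚ.+-identityˡ (∑ xs (λ x → if ⌊ P? x ⌋ then + 1 else + 0))) (∑-indicator P? xs)

open IntegerSums

-- Power series in q over Laurent polynomials in x₁, …, x_k, embedded into the terms in one further variable z
-- (the first coordinate of the exponent vector).
module Embedding (k N : ℕ) where
  open ℤ-Sums
  open TermRing (suc k) N
  private module R = CommutativeRing termRing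

  lift : ℕ → LPoly k → Terms (suc k)
  lift i = map (λ t → proj₁ t , i , + 0 ∷ proj₂ t)

  ⟦lift⟧ : ∀ i p φ → ⟦ lift i p ⟧ φ ≡ ⟪ p ⟫ (λ e → φ (i , + 0 ∷ e))
  ⟦lift⟧ i p φ = ∑-map _ p _

  lift-* : ∀ i j p r → lift i p *ₜ lift j r ≃ lift (i ℕ.+ j) (p *L r)
  lift-* i j p r = eq λ φ _ → begin
    ⟦ lift i p *ₜ lift j r ⟧ φ
      ≡⟨ ⟦*⟧ (lift i p) (lift j r) φ ⟩
    ⟦ lift i p ⟧ (λ x → ⟦ lift j r ⟧ (λ y → φ (x ⊕ y)))                         ≡⟨ ⟦lift⟧ i p _ ⟩
    ⟪ p ⟫ (λ u → ⟦ lift j r ⟧ (λ y → φ ((i , + 0 ∷ u) ⊕ y)))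
      ≡⟨ ⟪⟫-cong p (λ u → ⟦lift⟧ j r _) ⟩
    ⟪ p ⟫ (λ u → ⟪ r ⟫ (λ v → φ (i ℕ.+ j , + 0 ∷ zipWith ℤ._+_ u v)))           ≡⟨ ≡.sym (⟪*⟫ p r _) ⟩
    ⟪ p *L r ⟫ (λ e → φ (i ℕ.+ j , + 0 ∷ e))
      ≡⟨ ≡.sym (⟦lift⟧ (i ℕ.+ j) (p *L r) φ) ⟩
    ⟦ lift (i ℕ.+ j) (p *L r) ⟧ φ                                               ∎
    where
    open ≡-Reasoning

  -- Reduction modulo q^{N+1}. The lemmas below show that it respects sums, differences, products
  -- and 1.
  trunc : PS k → Terms (suc k)
  trunc f = concatMap (λ i → lift i (f i)) (upTo (suc N))

  ⟦trunc⟧ : ∀ f φ → ⟦ trunc f ⟧ φ ≡ ∑< (suc N) (λ i → ⟪ f i ⟫ (λ e → φ (i , + 0 ∷ e)))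
  ⟦trunc⟧ f φ = ≡.trans (∑-concatMap (λ i → lift i (f i)) (upTo (suc N)) _) (∑-cong (upTo (suc N)) (λ i → ⟦lift⟧ i (f i) φ))

  trunc-+ : ∀ f g → trunc (f +P g) ≃ trunc f ++ trunc g
  trunc-+ f g = eq λ φ _ → begin
    ⟦ trunc (f +P g) ⟧ φ                                          ≡⟨ ⟦trunc⟧ (f +P g) φ ⟩
    ∑< (suc N) (λ i → ⟪ f i ++ g i ⟫ (λ e → φ (i , + 0 ∷ e)))
      ≡⟨ ∑-cong (upTo (suc N)) (λ i → ∑-++ (f i) (g i) _) ⟩
    ∑< (suc N) (λ i → ⟪ f i ⟫ (λ e → φ (i , + 0 ∷ e)) ℤ.+ ⟪ g i ⟫ (λ e → φ (i , + 0 ∷ e)))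
      ≡⟨ ∑-+ (upTo (suc N)) (λ i → ⟪ f i ⟫ (λ e → φ (i , + 0 ∷ e))) (λ i → ⟪ g i ⟫ (λ e → φ (i , + 0 ∷ e))) ⟩
    _
      ≡⟨ ≡.sym (≡.cong₂ ℤ._+_ (⟦trunc⟧ f φ) (⟦trunc⟧ g φ)) ⟩
    ⟦ trunc f ⟧ φ ℤ.+ ⟦ trunc g ⟧ φ                               ≡⟨ ≡.sym (∑-++ (trunc f) (trunc g) _) ⟩
    ⟦ trunc f ++ trunc g ⟧ φ                                      ∎
    where
    open ≡-Reasoning

  ∑-negate : ∀ {A : Set} (xs : List A) (h : A → ℤ) → ∑ xs (λ x → ℤ.- h x) ≡ ℤ.- ∑ xs h
  ∑-negate [] h = ≡.refl
  ∑-negate (x ∷ xs) h = ≡.trans (≡.cong (λ i → ℤ.- h x ℤ.+ i) (∑-negate xs h)) (≡.sym (ℤₚ.neg-distrib-+ (h x) (∑ xs h)))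

  trunc-neg : ∀ f → trunc (λ i → negL (f i)) ≃ -ₜ trunc f
  trunc-neg f = eq λ φ _ → ≡.trans (⟦trunc⟧ (λ i → negL (f i)) φ)
    (≡.trans (∑-cong (upTo (suc N)) (λ i → ⟪neg⟫ (f i) (λ e → φ (i , + 0 ∷ e))))
      (≡.trans (∑-negate (upTo (suc N)) (λ i → ⟪ f i ⟫ (λ e → φ (i , + 0 ∷ e))))
        (≡.sym (≡.trans (⟦-⟧ (trunc f) φ) (≡.cong ℤ.-_ (⟦trunc⟧ f φ))))))

  trunc-- : ∀ f g → trunc (f -P g) ≃ trunc f ++ (-ₜ trunc g)
  trunc-- f g = R.trans (trunc-+ f (λ i → negL (g i))) (R.+-congˡ {trunc f} (trunc-neg g))

  trunc-* : ∀ f g → trunc (f *P g) ≃ trunc f *ₜ trunc g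
  trunc-* f g = eq λ φ v →
    let B : ℕ → ℕ → ℤ
        B i j = ⟪ f i ⟫ (λ d → ⟪ g j ⟫ (λ e → φ (i ℕ.+ j , + 0 ∷ zipWith ℤ._+_ d e)))
    in begin
    ⟦ trunc (f *P g) ⟧ φ                                                        ≡⟨ ⟦trunc⟧ (f *P g) φ ⟩
    ∑< (suc N) (λ n → ⟪ (f *P g) n ⟫ (λ e → φ (n , + 0 ∷ e)))
      ≡⟨ ∑-cong (upTo (suc N)) (λ n → ≡.trans (⟪sum⟫ (λ i → f i *L g (n ∸ i)) (upTo (suc n)) (λ e → φ (n , + 0 ∷ e)))
           (∑<-cong (suc n) (λ i i≤n → ≡.trans (⟪*⟫ (f i) (g (n ∸ i)) (λ e → φ (n , + 0 ∷ e)))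
             (≡.cong (λ l → ⟪ f i ⟫ (λ d → ⟪ g (n ∸ i) ⟫ (λ e → φ (l , + 0 ∷ zipWith ℤ._+_ d e))))
               (≡.sym (ℕₚ.m+[n∸m]≡n (ℕₚ.≤-pred i≤n))))))) ⟩
    ∑< (suc N) (λ n → ∑< (suc n) (λ i → B i (n ∸ i)))
      ≡⟨ ∑<-triangle (suc N) B (λ i j N<i+j → ⟪⟫-zero (f i) (λ d → ⟪⟫-zero (g j) (λ e → v _ _ N<i+j))) ⟩
    ∑< (suc N) (λ i → ∑< (suc N) (λ j → B i j))
      ≡⟨ ∑-cong (upTo (suc N)) (λ i → ≡.sym (⟪⟫-∑ (f i) (upTo (suc N)) (λ d j → ⟪ g j ⟫ (λ e → φ (i ℕ.+ j , + 0 ∷ zipWith ℤ._+_ d e))))) ⟩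
    ∑< (suc N) (λ i → ⟪ f i ⟫ (λ d → ∑< (suc N) (λ j → ⟪ g j ⟫ (λ e → φ (i ℕ.+ j , + 0 ∷ zipWith ℤ._+_ d e)))))
      ≡⟨ ∑-cong (upTo (suc N)) (λ i → ⟪⟫-cong (f i) (λ d → ≡.sym (⟦trunc⟧ g (λ y → φ ((i , + 0 ∷ d) ⊕ y))))) ⟩
    ∑< (suc N) (λ i → ⟪ f i ⟫ (λ d → ⟦ trunc g ⟧ (λ y → φ ((i , + 0 ∷ d) ⊕ y))))
      ≡⟨ ≡.sym (⟦trunc⟧ f (λ x → ⟦ trunc g ⟧ (λ y → φ (x ⊕ y)))) ⟩
    ⟦ trunc f ⟧ (λ x → ⟦ trunc g ⟧ (λ y → φ (x ⊕ y)))
      ≡⟨ ≡.sym (⟦*⟧ (trunc f) (trunc g) φ) ⟩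
    ⟦ trunc f *ₜ trunc g ⟧ φ                                                    ∎
    where
    open ≡-Reasoning

  -- A series concentrated in degree d. For d > N the sum misses it, but the functional then kills
  -- the right side as well.
  select : ∀ (φ : Exponent (suc k) → ℤ) → Vanishing φ → ∀ d (h : ℕ → LPoly k) c → h d ≡ c → (∀ n → n ≢ d → h n ≡ []) →
           ∑< (suc N) (λ n → ⟪ h n ⟫ (λ e → φ (n , + 0 ∷ e))) ≡ ⟪ c ⟫ (λ e → φ (d , + 0 ∷ e))
  select φ v d h c ≡.refl off with d ℕ.≤? N
  ... | yes d≤N = ∑<-single d (ℕ.s≤s d≤N) (λ n n≢d → ≡.cong (λ p → ⟪ p ⟫ (λ e → φ (n , + 0 ∷ e))) (off n n≢d))
  ... | no d≰N = ≡.trans (∑<-zero (suc N) (λ n n≤N → ≡.cong (λ p → ⟪ p ⟫ (λ e → φ (n , + 0 ∷ e)))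
                    (off n (λ { ≡.refl → d≰N (ℕₚ.≤-pred n≤N) }))))
                    (≡.sym (⟪⟫-zero c (λ e → v d _ (ℕₚ.≰⇒> d≰N))))

  trunc-monoQ : ∀ c d → trunc (monoQ c d) ≃ lift d c
  trunc-monoQ c d = eq λ φ v → ≡.trans (⟦trunc⟧ (monoQ c d) φ)
    (≡.trans (select φ v d (monoQ c d) c on off) (≡.sym (⟦lift⟧ d c φ)))
    where
    on : monoQ c d d ≡ c
    on with d ℕ.≟ d
    ... | yes _ = ≡.refl
    ... | no d≢d = contradiction ≡.refl d≢d
    off : ∀ n → n ≢ d → monoQ c d n ≡ []
    off n n≢d with n ℕ.≟ d
    ... | yes n≡d = contradiction n≡d n≢d
    ... | no _ = ≡.refl

  trunc-oneP : trunc oneP ≃ mono 0ₑ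
  trunc-oneP = trunc-monoQ oneL 0

  q : Terms (suc k)
  q = mono (1 , replicate (suc k) (+ 0))

  open Algebra.Properties.CommutativeSemiring.Exp R.commutativeSemiring using (_^_)

  mono-q^ : ∀ i → q ^ i ≃ mono (i , replicate (suc k) (+ 0))
  mono-q^ zero = R.refl
  mono-q^ (suc i) = R.trans (R.*-congˡ {q} (mono-q^ i))
    (R.reflexive (≡.cong (λ v → mono (suc i , v)) (Vecₚ.zipWith-identityˡ ℤₚ.+-identityˡ (replicate (suc k) (+ 0)))))

  q^[1+N]≈0 : q ^ suc N ≃ []
  q^[1+N]≈0 = R.trans (mono-q^ (suc N)) (eq λ φ v → ≡.trans (⟦mono⟧ (suc N , replicate (suc k) (+ 0)) φ) (v (suc N) _ ℕₚ.≤-refl))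

  open QSeries termRing
  open Truncated q N q^[1+N]≈0
  open ListSums termRing using () renaming (∑ to ∑ₜ; ∑< to ∑ₜ<)

  ⟦∑⟧ : ∀ {A : Set} (xs : List A) h φ → ⟦ ∑ₜ xs h ⟧ φ ≡ ∑ xs (λ x → ⟦ h x ⟧ φ)
  ⟦∑⟧ [] h φ = ≡.refl
  ⟦∑⟧ (x ∷ xs) h φ = ≡.trans (∑-++ (h x) (∑ₜ xs h) _) (≡.cong (λ i → ⟦ h x ⟧ φ ℤ.+ i) (⟦∑⟧ xs h φ))

  lift-pow : ∀ d c t → lift d c ^ t ≃ lift (d ℕ.* t) (powL c t)
  lift-pow d c zero = R.reflexive (≡.cong (λ l → lift l oneL) (≡.sym (ℕₚ.*-zeroʳ d)))
  lift-pow d c (suc t) = R.trans (R.*-congˡ {lift d c} (lift-pow d c t)) (R.trans (lift-* d (d ℕ.* t) c (powL c t))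
    (R.reflexive (≡.cong (λ l → lift l (powL c (suc t))) (≡.sym (ℕₚ.*-suc d t)))))

  -- `geomP` stops at t = n in the coefficient of qⁿ, whereas `geo` always has N + 1 terms. As (d +
  -- 1) t ≥ t, the additional t contribute nothing to qⁿ; exchanging the sums then leaves one degree
  -- for each t, treated by `select`.
  trunc-geomP : ∀ c d → trunc (geomP c (suc d)) ≃ geo (lift (suc d) c)
  trunc-geomP c d = eq λ φ v → begin
    ⟦ trunc (geomP c (suc d)) ⟧ φ
      ≡⟨ ⟦trunc⟧ (geomP c (suc d)) φ ⟩
    ∑< (suc N) (λ n → ⟪ geomP c (suc d) n ⟫ (λ e → φ (n , + 0 ∷ e)))
      ≡⟨ ∑<-cong (suc N) (λ n n≤N → ≡.trans (⟪sum⟫ (h n) (upTo (suc n)) (λ e → φ (n , + 0 ∷ e)))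
           (≡.sym (∑<-truncate n≤N (λ t n<t _ → ≡.cong (λ p → ⟪ p ⟫ (λ e → φ (n , + 0 ∷ e)))
             (off t n (λ { ≡.refl → ℕₚ.<-irrefl ≡.refl (ℕₚ.<-≤-trans n<t (ℕₚ.m≤m+n t (d ℕ.* t))) })))))) ⟩
    ∑< (suc N) (λ n → ∑< (suc N) (λ t → ⟪ h n t ⟫ (λ e → φ (n , + 0 ∷ e))))
      ≡⟨ ∑-swap (upTo (suc N)) (upTo (suc N)) (λ n t → ⟪ h n t ⟫ (λ e → φ (n , + 0 ∷ e))) ⟩
    ∑< (suc N) (λ t → ∑< (suc N) (λ n → ⟪ h n t ⟫ (λ e → φ (n , + 0 ∷ e))))
      ≡⟨ ∑-cong (upTo (suc N)) (λ t → select φ v (suc d ℕ.* t) (λ n → h n t) (powL c t) (on t) (off t)) ⟩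
    ∑< (suc N) (λ t → ⟪ powL c t ⟫ (λ e → φ (suc d ℕ.* t , + 0 ∷ e)))
      ≡⟨ ∑-cong (upTo (suc N)) (λ t → ≡.sym (≡.trans (⟦≃⟧ (lift-pow (suc d) c t) φ v) (⟦lift⟧ (suc d ℕ.* t) (powL c t) φ))) ⟩
    ∑< (suc N) (λ t → ⟦ lift (suc d) c ^ t ⟧ φ)
      ≡⟨ ≡.sym (⟦∑⟧ (upTo (suc N)) (lift (suc d) c ^_) φ) ⟩
    ⟦ geo (lift (suc d) c) ⟧ φ                                                   ∎
    where
    open ≡-Reasoning
    h : ℕ → ℕ → LPoly k
    h n t = if ⌊ suc d ℕ.* t ℕ.≟ n ⌋ then powL c t else zeroL
    on : ∀ t → h (suc d ℕ.* t) t ≡ powL c t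
    on t with suc d ℕ.* t ℕ.≟ suc d ℕ.* t
    ... | yes _ = ≡.refl
    ... | no e = contradiction ≡.refl e
    off : ∀ t n → n ≢ suc d ℕ.* t → h n t ≡ []
    off t n n≢ with suc d ℕ.* t ℕ.≟ n
    ... | yes e = contradiction (≡.sym e) n≢
    ... | no _ = ≡.refl

-- Pentagonal exponents and finite products.

tri : ℕ → ℕ
tri zero = 0
tri (suc n) = tri n ℕ.+ suc n

-- Splits n(3n-1)/2 as n(n-1)/2 + n², the shares of `σ` and of the sum over D. Halving is avoided by
-- comparing the doubles.
pent-suc : ∀ n → pent (suc n) ≡ tri n ℕ.+ suc n ℕ.* suc n
pent-suc n = begin
  suc n ℕ.* (3 ℕ.* suc n ∸ 1) ℕ./ 2                     ≡⟨ ≡.cong (ℕ._/ 2) (double n) ⟩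
  (tri n ℕ.+ suc n ℕ.* suc n) ℕ.* 2 ℕ./ 2               ≡⟨ m*n/n≡m (tri n ℕ.+ suc n ℕ.* suc n) 2 ⟩
  tri n ℕ.+ suc n ℕ.* suc n                             ∎
  where
  open ≡-Reasoning
  open ℕ-Solver
  tri-double : ∀ n → tri n ℕ.* 2 ≡ n ℕ.* suc n
  tri-double zero = ≡.refl
  tri-double (suc n) = ≡.trans (ℕₚ.*-distribʳ-+ 2 (tri n) (suc n)) (≡.trans (≡.cong (ℕ._+ suc n ℕ.* 2) (tri-double n))
    (solve 1 (λ n → n :* (con 1 :+ n) :+ (con 1 :+ n) :* con 2 := (con 1 :+ n) :* (con 2 :+ n)) ≡.refl n))
  double : ∀ n → suc n ℕ.* (3 ℕ.* suc n ∸ 1) ≡ (tri n ℕ.+ suc n ℕ.* suc n) ℕ.* 2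
  double n = ≡.trans (solve 1 (λ n → (con 1 :+ n) :* (n :+ ((con 1 :+ n) :+ ((con 1 :+ n) :+ con 0))) :=
                        n :* (con 1 :+ n) :+ (con 1 :+ n) :* (con 1 :+ n) :* con 2) ≡.refl n)
    (≡.trans (≡.cong (ℕ._+ suc n ℕ.* suc n ℕ.* 2) (≡.sym (tri-double n))) (≡.sym (ℕₚ.*-distribʳ-+ 2 (tri n) (suc n ℕ.* suc n))))

module Products {k : ℕ} {N : ℕ} where
  open TermRing (suc k) N
  open CommutativeRing termRing

  ∏ : {A : Set} → List A → (A → Carrier) → Carrier
  ∏ xs h = foldr (λ x r → h x * r) 1# xs

  ∏-cong : {A : Set} (xs : List A) {g h : A → Carrier} → (∀ x → g x ≈ h x) → ∏ xs g ≈ ∏ xs h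
  ∏-cong [] p = refl
  ∏-cong (x ∷ xs) p = *-cong (p x) (∏-cong xs p)

  ∏-map : {A B : Set} (j : A → B) (xs : List A) (h : B → Carrier) → ∏ (map j xs) h ≡ ∏ xs (h ∘ j)
  ∏-map j [] h = ≡.refl
  ∏-map j (x ∷ xs) h = ≡.cong (h (j x) *_) (∏-map j xs h)

  -- `upTo` puts the new index last, while `p` takes the new factor in front.
  ∏-∷ʳ : {A : Set} (xs : List A) (x : A) (h : A → Carrier) → ∏ (xs ++ x ∷ []) h ≈ h x * ∏ xs h
  ∏-∷ʳ [] x h = refl
  ∏-∷ʳ (y ∷ ys) x h = trans (*-congˡ {h y} (∏-∷ʳ ys x h))
    (trans (sym (*-assoc (h y) (h x) (∏ ys h))) (trans (*-congʳ {∏ ys h} (*-comm (h y) (h x))) (*-assoc (h x) (h y) (∏ ys h))))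

-- The right-hand side of the theorem in the truncated ring.

module RightHandSide (k N : ℕ) where
  open TermRing (suc k) N
  open CommutativeRing termRing hiding (zero)
  open Embedding k N
  open ListSums termRing
  open RingSolver termRing
  open QSeries termRing
  open Truncated q N q^[1+N]≈0
  open Unit
  open Products {k} {N}
  open Algebra.Properties.CommutativeSemiring.Exp commutativeSemiring using (_^_; ^-homo-*)
  open Relation.Binary.Reasoning.Setoid setoid

  power : Fin (suc k) → ℤ → Vec ℤ (suc k)
  power j s = updateAt (replicate (suc k) (+ 0)) j (λ _ → s)

  power-+ : ∀ {n} (j : Fin n) s t → zipWith ℤ._+_ (updateAt (replicate n (+ 0)) j (λ _ → s)) (updateAt (replicate n (+ 0)) j (λ _ → t)) ≡
                                    updateAt (replicate n (+ 0)) j (λ _ → s ℤ.+ t)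
  power-+ {suc n} zero s t = ≡.cong (s ℤ.+ t ∷_) (Vecₚ.zipWith-identityˡ ℤₚ.+-identityˡ (replicate n (+ 0)))
  power-+ (suc j) s t = ≡.cong (+ 0 ∷_) (power-+ j s t)

  power-0 : ∀ {n} (j : Fin n) → updateAt (replicate n (+ 0)) j (λ _ → + 0) ≡ replicate n (+ 0)
  power-0 zero = ≡.refl
  power-0 (suc j) = ≡.cong (+ 0 ∷_) (power-0 j)

  -- Index `zero` is z; the other indices are the variables of the theorem.
  variable-unit : Fin (suc k) → Unit
  variable-unit j = record
    { val = mono (0 , power j (+ 1))
    ; inv = mono (0 , power j ℤ.-1ℤ)
    ; val*inv = reflexive (≡.cong (λ v → mono (0 , v)) (≡.trans (power-+ j (+ 1) ℤ.-1ℤ) (power-0 j)))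
    }

  X : Fin k → Unit
  X j = variable-unit (suc j)

  mono-split : ∀ d v → mono (d , v) ≈ mono (0 , v) * q ^ d
  mono-split d v = sym (trans (*-congˡ {mono (0 , v)} (mono-q^ d))
    (reflexive (≡.cong (λ w → mono (d , w)) (Vecₚ.zipWith-identityʳ ℤₚ.+-identityʳ v))))

  lift-one : ∀ d → lift d oneL ≈ q ^ d
  lift-one d = sym (mono-q^ d)

  trunc-∏ : ∀ {A : Set} (h : A → PS k) xs → trunc (prodP (map h xs)) ≈ ∏ xs (λ x → trunc (h x))
  trunc-∏ h [] = trunc-oneP
  trunc-∏ h (x ∷ xs) = trans (trunc-* (h x) (prodP (map h xs))) (*-congˡ {trunc (h x)} (trunc-∏ h xs))

  trunc-zero : ∀ M → concatMap (λ i → lift i []) (upTo M) ≡ []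
  trunc-zero M = empty (upTo M)
    where
    empty : ∀ (xs : List ℕ) → concatMap (λ i → lift i []) xs ≡ []
    empty [] = ≡.refl
    empty (x ∷ xs) = empty xs

  trunc-∑ : ∀ {A : Set} (h : A → PS k) xs → trunc (sumP (map h xs)) ≈ ∑ xs (λ x → trunc (h x))
  trunc-∑ h [] = reflexive (trunc-zero (suc N))
  trunc-∑ h (x ∷ xs) = trans (trunc-+ (h x) (sumP (map h xs))) (+-congˡ {trunc (h x)} (trunc-∑ h xs))

  trunc-invPoch : ∀ M → trunc (invPochTo k M) ≈ p M
  trunc-invPoch M = trans (trunc-∏ _ (upTo M)) (trans (∏-cong (upTo M) (λ j →
                      trans (trunc-geomP oneL j) (geo-cong (lift-one (suc j))))) (∏-p M))
    where
    ∏-p : ∀ M → ∏ (upTo M) (λ j → geo (q ^ suc j)) ≈ p M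
    ∏-p zero = refl
    ∏-p (suc M) = trans (reflexive (≡.cong (λ l → ∏ l (λ j → geo (q ^ suc j))) (≡.sym (Listₚ.upTo-∷ʳ M))))
      (trans (∏-∷ʳ (upTo M) M (λ j → geo (q ^ suc j))) (*-congˡ {geo (q ^ suc M)} (∏-p M)))

  σ-sign : ∀ n → σ (suc n) ≈ lift (tri n) (constL (ℤ.-1ℤ ℤ.^ n))
  σ-sign zero = solve 0 (:- (:- :1 :* :1) := :1) refl
  σ-sign (suc n) = begin
    - (σ (suc n) * q ^ suc n)
      ≈⟨ -‿cong (*-cong (σ-sign n) (mono-q^ (suc n))) ⟩
    (ℤ.- (s ℤ.* + 1) , tri n ℕ.+ suc n , zipWith ℤ._+_ 0v 0v) ∷ []
      ≡⟨ ≡.cong₂ (λ c v → (c , tri n ℕ.+ suc n , v) ∷ []) (≡.trans (≡.cong ℤ.-_ (ℤₚ.*-identityʳ s)) (≡.sym (ℤₚ.-1*i≡-i s)))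
           (Vecₚ.zipWith-identityˡ ℤₚ.+-identityˡ 0v) ⟩
    lift (tri (suc n)) (constL (ℤ.-1ℤ ℤ.^ suc n))                   ∎
    where
    s = ℤ.-1ℤ ℤ.^ n
    0v = replicate (suc k) (+ 0)

  lift-const-+ : ∀ a b c → lift (a ℕ.+ b) (constL c) ≈ lift a (constL c) * q ^ b
  lift-const-+ a b c = sym (trans (*-congˡ {lift a (constL c)} (mono-q^ b))
    (reflexive (≡.cong₂ (λ d v → (d , a ℕ.+ b , v) ∷ []) (ℤₚ.*-identityʳ c) (Vecₚ.zipWith-identityˡ ℤₚ.+-identityˡ (replicate (suc k) (+ 0))))))

  trunc-sign : ∀ n → trunc (monoQ (constL (ℤ.-1ℤ ℤ.^ n)) (pent (suc n) ℕ.+ k ℕ.* suc n)) ≈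
                     σ (suc n) * q ^ (suc n ℕ.* suc n) * q ^ (k ℕ.* suc n)
  trunc-sign n = begin
    trunc (monoQ (constL s) (pent (suc n) ℕ.+ k ℕ.* suc n))
      ≈⟨ trunc-monoQ (constL s) (pent (suc n) ℕ.+ k ℕ.* suc n) ⟩
    lift (pent (suc n) ℕ.+ k ℕ.* suc n) (constL s)
      ≡⟨ ≡.cong (λ e → lift (e ℕ.+ k ℕ.* suc n) (constL s)) (pent-suc n) ⟩
    lift (tri n ℕ.+ suc n ℕ.* suc n ℕ.+ k ℕ.* suc n) (constL s)
      ≈⟨ lift-const-+ (tri n ℕ.+ suc n ℕ.* suc n) (k ℕ.* suc n) s ⟩
    lift (tri n ℕ.+ suc n ℕ.* suc n) (constL s) * q ^ (k ℕ.* suc n)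
      ≈⟨ *-congʳ {q ^ (k ℕ.* suc n)} (trans (lift-const-+ (tri n) (suc n ℕ.* suc n) s) (*-congʳ {q ^ (suc n ℕ.* suc n)} (sym (σ-sign n)))) ⟩
    σ (suc n) * q ^ (suc n ℕ.* suc n) * q ^ (k ℕ.* suc n)                ∎
    where
    s : ℤ
    s = ℤ.-1ℤ ℤ.^ n

  ψ-∏ : ∀ {l} (Y : Fin l → Unit) n → ψ (Vec.tabulate Y) n ≈ q ^ (l ℕ.* n) * ∏ (allFin l) (λ j → f (Y j) n)
  ψ-∏ {zero} Y n = sym (*-identityˡ 1#)
  ψ-∏ {suc l} Y n = begin
    q ^ n * f (Y zero) n * ψ (Vec.tabulate (Y ∘ suc)) n
      ≈⟨ *-congˡ {q ^ n * f (Y zero) n} (ψ-∏ (Y ∘ suc) n) ⟩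
    q ^ n * f (Y zero) n * (q ^ (l ℕ.* n) * ∏ (allFin l) (λ j → f (Y (suc j)) n))
      ≈⟨ solve 4 (λ a b c d → a :* b :* (c :* d) := a :* c :* (b :* d)) refl (q ^ n) (f (Y zero) n) (q ^ (l ℕ.* n)) _ ⟩
    q ^ n * q ^ (l ℕ.* n) * (f (Y zero) n * ∏ (allFin l) (λ j → f (Y (suc j)) n))
      ≈⟨ *-cong (sym (^-homo-* q n (l ℕ.* n))) (*-congˡ {f (Y zero) n} (reflexive (≡.trans (≡.sym (∏-map suc (allFin l) (λ j → f (Y j) n)))
           (≡.cong (λ xs → ∏ xs (λ j → f (Y j) n)) (Listₚ.map-tabulate (λ j → j) suc))))) ⟩
    q ^ (suc l ℕ.* n) * ∏ (allFin (suc l)) (λ j → f (Y j) n)                ∎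

  trunc-rhsTerm : ∀ n → trunc (invPochTo k N *P rhsTerm k (suc n)) ≈ summand (Vec.tabulate X) (suc n)
  trunc-rhsTerm n = begin
    trunc (invPochTo k N *P rhsTerm k (suc n))
      ≈⟨ trans (trunc-* (invPochTo k N) (rhsTerm k (suc n))) (*-cong (trunc-invPoch N)
           (trans (trunc-* (monoQ (constL (ℤ.-1ℤ ℤ.^ n)) (pent (suc n) ℕ.+ k ℕ.* suc n)) ((oneP -P monoQ oneL (suc n)) *P factors))
             (*-cong (trunc-sign n) (trans (trunc-* (oneP -P monoQ oneL (suc n)) factors) (*-cong one-minus trunc-factors))))) ⟩
    p N * (s * (q ^ (suc n ℕ.* suc n)) * qk * ((1# - q ^ suc n) * P))
      ≈⟨ solve 6 (λ p s y qk a P → p :* (s :* y :* qk :* (a :* P)) := p :* (s :* y :* (a :* (qk :* P)))) refl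
           (p N) s (q ^ (suc n ℕ.* suc n)) qk (1# - q ^ suc n) P ⟩
    p N * (s * q ^ (suc n ℕ.* suc n) * ((1# - q ^ suc n) * (qk * P)))
      ≈⟨ *-congˡ {p N} (*-congˡ {s * q ^ (suc n ℕ.* suc n)} (*-congˡ {1# - q ^ suc n} (sym (ψ-∏ X (suc n))))) ⟩
    summand (Vec.tabulate X) (suc n) ∎
    where
    factors : PS k
    factors = prodP (map (λ j → geomP (Defs.var j) (suc n) *P geomP (varInv j) (suc n)) (allFin k))
    s qk P : Carrier
    s = σ (suc n)
    qk = q ^ (k ℕ.* suc n)
    P = ∏ (allFin k) (λ j → f (X j) (suc n))
    one-minus : trunc (oneP -P monoQ oneL (suc n)) ≈ 1# - q ^ suc n
    one-minus = trans (trunc-- oneP (monoQ oneL (suc n)))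
      (+-cong trunc-oneP (-‿cong (trans (trunc-monoQ oneL (suc n)) (lift-one (suc n)))))
    trunc-factors : trunc factors ≈ P
    trunc-factors = trans (trunc-∏ (λ j → geomP (Defs.var j) (suc n) *P geomP (varInv j) (suc n)) (allFin k))
      (∏-cong (allFin k) (λ j → trans (trunc-* (geomP (Defs.var j) (suc n)) (geomP (varInv j) (suc n))) (*-cong
        (trans (trunc-geomP (Defs.var j) n) (geo-cong (mono-split (suc n) (power (suc j) (+ 1)))))
        (trans (trunc-geomP (varInv j) n) (geo-cong (mono-split (suc n) (power (suc j) ℤ.-1ℤ)))))))

  rhs : PS k
  rhs = invPochTo k N *P sumP (map (λ n → rhsTerm k (suc n)) (upTo N))

  trunc-rhs : trunc rhs ≈ ∑< N (λ i → trunc (invPochTo k N *P rhsTerm k (suc i)))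
  trunc-rhs = begin
    trunc rhs
      ≈⟨ trunc-* (invPochTo k N) (sumP (map (λ n → rhsTerm k (suc n)) (upTo N))) ⟩
    trunc (invPochTo k N) * trunc (sumP (map (λ n → rhsTerm k (suc n)) (upTo N)))
      ≈⟨ *-congˡ {trunc (invPochTo k N)} (trunc-∑ (λ n → rhsTerm k (suc n)) (upTo N)) ⟩
    trunc (invPochTo k N) * ∑< N (λ i → trunc (rhsTerm k (suc i)))
      ≈⟨ ∑-*ˡ (trunc (invPochTo k N)) (upTo N) (λ i → trunc (rhsTerm k (suc i))) ⟩
    ∑< N (λ i → trunc (invPochTo k N) * trunc (rhsTerm k (suc i)))
      ≈⟨ ∑-cong (upTo N) (λ i → sym (trunc-* (invPochTo k N) (rhsTerm k (suc i)))) ⟩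
    ∑< N (λ i → trunc (invPochTo k N *P rhsTerm k (suc i)))                   ∎

-- The weight of a symbol is a monomial recording its size and ranks.

module SymbolMonomials (k N : ℕ) where
  open TermRing (suc k) N
  open CommutativeRing termRing hiding (zero)
  open Embedding k N
  open RightHandSide k N
  open QSeries termRing
  open Unit
  open Enumeration N
  open Algebra.Properties.CommutativeSemiring.Exp commutativeSemiring using (_^_)
  open GeneratingFunctions termRing
  open Weights q N q^[1+N]≈0
  open Relation.Binary.Reasoning.Setoid setoid

  0v : Vec ℤ (suc k)
  0v = replicate (suc k) (+ 0)

  partition-monomial : ∀ j s λs → partitionWeight (mono (0 , power j s)) λs ≈ mono (sum λs , power j (s ℤ.* + length λs))
  partition-monomial j s [] = reflexive (≡.cong (λ v → mono (0 , v))
    (≡.trans (≡.sym (power-0 j)) (≡.cong (power j) (≡.sym (ℤₚ.*-zeroʳ s)))))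
  partition-monomial j s (a ∷ λs) = begin
    mono (0 , power j s) * q ^ a * partitionWeight (mono (0 , power j s)) λs
      ≈⟨ *-cong (sym (mono-split a (power j s))) (partition-monomial j s λs) ⟩
    mono (a ℕ.+ sum λs , zipWith ℤ._+_ (power j s) (power j (s ℤ.* + length λs)))
      ≡⟨ ≡.cong (λ v → mono (a ℕ.+ sum λs , v)) (≡.trans (power-+ j s (s ℤ.* + length λs))
           (≡.cong (power j) (≡.sym (ℤₚ.*-suc s (+ length λs))))) ⟩
    mono (a ℕ.+ sum λs , power j (s ℤ.* + suc (length λs))) ∎

  pair-monomial : ∀ j α β → pairWeight (variable-unit j) (α , β) ≈
                            mono (sum α ℕ.+ sum β , power j (+ length α ℤ.- + length β))
  pair-monomial j α β = begin
    _ ≈⟨ *-cong (partition-monomial j (+ 1) α) (partition-monomial j ℤ.-1ℤ β) ⟩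
    mono (sum α ℕ.+ sum β , zipWith ℤ._+_ (power j (+ 1 ℤ.* + length α)) (power j (ℤ.-1ℤ ℤ.* + length β)))
      ≡⟨ ≡.cong (λ v → mono (sum α ℕ.+ sum β , v)) (≡.trans (power-+ j (+ 1 ℤ.* + length α) (ℤ.-1ℤ ℤ.* + length β))
           (≡.cong (power j) (≡.cong₂ ℤ._+_ (ℤₚ.*-identityˡ (+ length α)) (ℤₚ.-1*i≡-i (+ length β))))) ⟩
    mono (sum α ℕ.+ sum β , power j (+ length α ℤ.- + length β)) ∎

  -- `g` tells which variable marks which rank. It is kept general so that the induction along a
  -- chain can pass to `g ∘ suc`; for the identity the exponent vector is the rank vector itself.
  powers : ∀ {n l} → (Fin l → Fin n) → Vec ℤ l → Vec ℤ n
  powers {n} g [] = replicate n (+ 0)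
  powers {n} g (r ∷ rs) = zipWith ℤ._+_ (Vec.updateAt (replicate n (+ 0)) (g zero) (λ _ → r)) (powers (g ∘ suc) rs)

  powers-suc : ∀ {n l} (g : Fin l → Fin n) rs → powers (suc ∘ g) rs ≡ + 0 ∷ powers g rs
  powers-suc g [] = ≡.refl
  powers-suc {n} g (r ∷ rs) = ≡.cong (zipWith ℤ._+_ (+ 0 ∷ Vec.updateAt (replicate n (+ 0)) (g zero) (λ _ → r))) (powers-suc (g ∘ suc) rs)

  powers-id : ∀ {n} (rs : Vec ℤ n) → powers (λ j → j) rs ≡ rs
  powers-id [] = ≡.refl
  powers-id {suc n} (r ∷ rs) = ≡.trans (≡.cong (zipWith ℤ._+_ (r ∷ replicate n (+ 0))) (powers-suc (λ j → j) rs))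
    (≡.cong₂ _∷_ (ℤₚ.+-identityʳ r) (≡.trans (Vecₚ.zipWith-identityˡ ℤₚ.+-identityˡ (powers (λ j → j) rs)) (powers-id rs)))

  -- `InChain` excludes an empty αʲ with j < K, to which `chainWeight` assigns 0 and not a monomial.
  chain-monomial : ∀ {l} (g : Fin (suc l) → Fin (suc k)) c D (ps : Vec Pair (suc l)) → InChain c D ps →
    chainWeight (variable-unit (g zero)) (Vec.tabulate (variable-unit ∘ g ∘ suc)) ps ≈ mono (weight ps , powers g (ranks ps))
  chain-monomial {zero} g c D ((α , β) ∷ []) _ = trans (pair-monomial (g zero) α β)
    (reflexive (≡.cong₂ (λ d v → mono (d , v)) (≡.sym (ℕₚ.+-identityʳ (sum α ℕ.+ sum β)))
      (≡.sym (Vecₚ.zipWith-identityʳ ℤₚ.+-identityʳ (power (g zero) (+ length α ℤ.- + length β))))))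
  chain-monomial {suc l} g c D ((a ∷ α , β) ∷ p ∷ ps) (_ , _ , _ , rest) = begin
    q ^ a * pairWeight (variable-unit (g zero)) (α , β) * chainWeight (variable-unit (g (suc zero))) (Vec.tabulate (λ j → variable-unit (g (suc (suc j))))) (p ∷ ps)
      ≈⟨ *-cong (*-cong (mono-q^ a) (pair-monomial (g zero) α β)) (chain-monomial (g ∘ suc) a D (p ∷ ps) rest) ⟩
    mono (a ℕ.+ (sum α ℕ.+ sum β) ℕ.+ weight (p ∷ ps) , zipWith ℤ._+_ (zipWith ℤ._+_ 0v (power (g zero) r)) (powers (g ∘ suc) (ranks (p ∷ ps))))
      ≡⟨ ≡.cong₂ (λ d v → mono (d ℕ.+ weight (p ∷ ps) , zipWith ℤ._+_ v (powers (g ∘ suc) (ranks (p ∷ ps))))) (≡.sym (ℕₚ.+-assoc a (sum α) (sum β)))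
           (≡.trans (Vecₚ.zipWith-identityˡ ℤₚ.+-identityˡ (power (g zero) r)) (≡.cong (power (g zero)) rank)) ⟩
    mono (weight ((a ∷ α , β) ∷ p ∷ ps) , powers g (ranks ((a ∷ α , β) ∷ p ∷ ps))) ∎
    where
    r : ℤ
    r = + length α ℤ.- + length β
    rank : r ≡ + suc (length α) ℤ.- + length β ℤ.- ℤ.1ℤ
    rank = ≡.sym (≡.trans (≡.cong (ℤ._- ℤ.1ℤ) (≡.trans (ℤₚ.+-assoc (+ 1) (+ length α) (ℤ.- (+ length β))) (ℤₚ.+-comm (+ 1) r)))
                    (≡.trans (ℤₚ.+-assoc r (+ 1) ℤ.-1ℤ) (ℤₚ.+-identityʳ r)))

  symbol-monomial : ∀ (ps : Vec Pair (suc k)) D → InChain 1 D ps →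
    symbolWeight (variable-unit zero) (Vec.tabulate X) (ps , D) ≈ mono (weight ps ℕ.+ D ℕ.* D , ranks ps)
  symbol-monomial ps D chain = begin
    q ^ (D ℕ.* D) * chainWeight (variable-unit zero) (Vec.tabulate X) ps
      ≈⟨ *-cong (mono-q^ (D ℕ.* D)) (chain-monomial (λ j → j) 1 D ps chain) ⟩
    mono (D ℕ.* D ℕ.+ weight ps , zipWith ℤ._+_ 0v (powers (λ j → j) (ranks ps)))
      ≡⟨ ≡.cong₂ (λ d v → mono (d , v)) (ℕₚ.+-comm (D ℕ.* D) (weight ps))
           (≡.trans (Vecₚ.zipWith-identityˡ ℤₚ.+-identityˡ _) (powers-id (ranks ps))) ⟩
    mono (weight ps ℕ.+ D ℕ.* D , ranks ps) ∎

-- Extraction of the coefficient of z⁰ x^m q^N.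

module Coefficients (k N : ℕ) (m : Vec ℤ k) where
  open ℤ-Sums
  open TermRing (suc k) N
  private module R = CommutativeRing termRing
  open Embedding k N
  open RightHandSide k N
  open QSeries termRing
  open Unit
  open Truncated q N q^[1+N]≈0
  open RingSolver termRing using (solve; _:=_; _:+_; _:*_; _:-_; :1)
  open ListSums termRing using () renaming (∑ to ∑ₜ; ∑< to ∑ₜ<; ∑-*ʳ to ∑ₜ-*ʳ)
  open Enumeration N
  open Bijection N
  open Algebra.Properties.CommutativeSemiring.Exp R.commutativeSemiring using (_^_)
  open GeneratingFunctions termRing
  open Weights q N q^[1+N]≈0
  open SymbolMonomials k N
  open ≡-Reasoning

  target? : (e : Exponent (suc k)) → Dec (proj₁ e ≡ N × proj₂ e ≡ + 0 ∷ m)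
  target? (d , v) = (d ℕ.≟ N) ×-dec Vecₚ.≡-dec ℤ._≟_ v (+ 0 ∷ m)

  δ : Exponent (suc k) → ℤ
  δ e = if ⌊ target? e ⌋ then + 1 else + 0

  δ-off : ∀ e → ¬ (proj₁ e ≡ N × proj₂ e ≡ + 0 ∷ m) → δ e ≡ + 0
  δ-off e e≢ with target? e
  ... | yes e≡ = contradiction e≡ e≢
  ... | no _ = ≡.refl

  indicator-⇔ : ∀ {P Q : Set} (P? : Dec P) (Q? : Dec Q) → (P → Q) → (Q → P) →
                (if ⌊ P? ⌋ then + 1 else + 0) ≡ (if ⌊ Q? ⌋ then + 1 else + 0)
  indicator-⇔ (yes _) (yes _) _ _ = ≡.refl
  indicator-⇔ (yes p) (no ¬q) f _ = contradiction (f p) ¬q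
  indicator-⇔ (no ¬p) (yes q) _ g = contradiction (g q) ¬p
  indicator-⇔ (no _) (no _) _ _ = ≡.refl

  δ-vanishing : Vanishing δ
  δ-vanishing d v N<d = δ-off (d , v) (λ { (≡.refl , _) → ℕₚ.<-irrefl ≡.refl N<d })

  δ-top : ∀ e → δ (N , + 0 ∷ e) ≡ indicator m e
  δ-top e = indicator-⇔ (target? (N , + 0 ∷ e)) (Vecₚ.≡-dec ℤ._≟_ e m)
    (λ t → Vecₚ.∷-injectiveʳ (proj₂ t)) (λ e≡m → ≡.refl , ≡.cong (+ 0 ∷_) e≡m)

  -- As z marks ρ₁, the exponent 0 of z in `δ` is the condition that the first rank be 0.
  coefficient : Terms (suc k) → ℤ
  coefficient p = ⟦ p ⟧ δ

  coefficient-cong : ∀ {p r} → p ≃ r → coefficient p ≡ coefficient r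
  coefficient-cong h = ⟦≃⟧ h δ δ-vanishing

  coefficient-trunc : ∀ f → coefficient (trunc f) ≡ coeffL (f N) m
  coefficient-trunc f = begin
    ⟦ trunc f ⟧ δ                                             ≡⟨ ⟦trunc⟧ f δ ⟩
    ∑< (suc N) (λ i → ⟪ f i ⟫ (λ e → δ (i , + 0 ∷ e)))
      ≡⟨ ∑<-single N ℕₚ.≤-refl (λ i i≢N → ⟪⟫-zero (f i) (λ e → δ-off (i , + 0 ∷ e) (λ t → i≢N (proj₁ t)))) ⟩
    ⟪ f N ⟫ (λ e → δ (N , + 0 ∷ e))                           ≡⟨ ⟪⟫-cong (f N) δ-top ⟩
    ⟪ f N ⟫ (indicator m)                                     ≡⟨ ≡.sym (coeffL≡⟪⟫ (f N) m) ⟩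
    coeffL (f N) m                                            ∎

  -- In the variable z alone.
  Homogeneous : ℤ → Terms (suc k) → Set
  Homogeneous s p = ∀ φ χ → (∀ d v → φ (d , s ∷ v) ≡ χ (d , s ∷ v)) → ⟦ p ⟧ φ ≡ ⟦ p ⟧ χ

  homogeneous-mono : ∀ d s v → Homogeneous s (mono (d , s ∷ v))
  homogeneous-mono d s v φ χ h = ≡.trans (⟦mono⟧ (d , s ∷ v) φ) (≡.trans (h d v) (≡.sym (⟦mono⟧ (d , s ∷ v) χ)))

  homogeneous-* : ∀ s t {p r} → Homogeneous s p → Homogeneous t r → Homogeneous (s ℤ.+ t) (p *ₜ r)
  homogeneous-* s t {p} {r} hp hr φ χ h = ≡.trans (⟦*⟧ p r φ) (≡.trans
    (hp _ _ (λ d v → hr _ _ (λ e w → h (d ℕ.+ e) (zipWith ℤ._+_ v w)))) (≡.sym (⟦*⟧ p r χ)))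

  homogeneous-^ : ∀ s {p} → Homogeneous s p → ∀ t → Homogeneous (s ℤ.* + t) (p ^ t)
  homogeneous-^ s {p} hp zero = ≡.subst (λ i → Homogeneous i (p ^ 0)) (≡.sym (ℤₚ.*-zeroʳ s)) (homogeneous-mono 0 (+ 0) _)
  homogeneous-^ s {p} hp (suc t) = ≡.subst (λ i → Homogeneous i (p ^ suc t)) (≡.sym (ℤₚ.*-suc s (+ t)))
    (homogeneous-* s (s ℤ.* + t) {p} {p ^ t} hp (homogeneous-^ s hp t))

  homogeneous-trunc : ∀ f → Homogeneous (+ 0) (trunc f)
  homogeneous-trunc f φ χ h = ≡.trans (⟦trunc⟧ f φ)
    (≡.trans (∑-cong (upTo (suc N)) (λ i → ⟪⟫-cong (f i) (h i))) (≡.sym (⟦trunc⟧ f χ)))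

  ⟦⟧-zero : ∀ (p : Terms (suc k)) → ⟦ p ⟧ (λ _ → + 0) ≡ + 0
  ⟦⟧-zero p = ∑-zero-∈ p (λ {t} _ → ℤₚ.*-zeroʳ (proj₁ t))

  coefficient-homogeneous : ∀ {s p} → s ≢ + 0 → Homogeneous s p → coefficient p ≡ + 0
  coefficient-homogeneous {s} {p} s≢0 hp = ≡.trans
    (hp δ (λ _ → + 0) (λ d v → δ-off (d , s ∷ v) (λ t → s≢0 (Vecₚ.∷-injectiveˡ (proj₂ t))))) (⟦⟧-zero p)

  -- `trunc f` is free of z, and yᵗ has z-degree s t, which is nonzero unless t = 0; hence only the
  -- leading 1 of the geometric series reaches z⁰.
  coefficient-geo : ∀ y s f → s ≢ + 0 → Homogeneous s y → coefficient (geo y *ₜ trunc f) ≡ coefficient (trunc f)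
  coefficient-geo y s f s≢0 hy = begin
    coefficient (geo y *ₜ trunc f)
      ≡⟨ coefficient-cong (∑ₜ-*ʳ (trunc f) (upTo (suc N)) (y ^_)) ⟩
    coefficient (∑ₜ< (suc N) (λ t → (y ^ t) *ₜ trunc f))
      ≡⟨ ⟦∑⟧ (upTo (suc N)) (λ t → (y ^ t) *ₜ trunc f) δ ⟩
    ∑< (suc N) (λ t → coefficient ((y ^ t) *ₜ trunc f))
      ≡⟨ ∑<-single {suc N} 0 (ℕ.s≤s ℕ.z≤n) off ⟩
    coefficient (mono 0ₑ *ₜ trunc f)
      ≡⟨ coefficient-cong (R.*-identityˡ (trunc f)) ⟩
    coefficient (trunc f)                                             ∎
    where
    off : ∀ t → t ≢ 0 → coefficient ((y ^ t) *ₜ trunc f) ≡ + 0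
    off t t≢0 = coefficient-homogeneous {p = (y ^ t) *ₜ trunc f} nonzero
      (homogeneous-* (s ℤ.* + t) (+ 0) {y ^ t} {trunc f} (homogeneous-^ s hy t) (homogeneous-trunc f))
      where
      nonzero : s ℤ.* + t ℤ.+ + 0 ≢ + 0
      nonzero e with ℤₚ.i*j≡0⇒i≡0∨j≡0 s (≡.trans (≡.sym (ℤₚ.+-identityʳ (s ℤ.* + t))) e)
      ... | inj₁ s≡0 = s≢0 s≡0
      ... | inj₂ t≡0 = t≢0 (ℤₚ.+-injective t≡0)

  homogeneous-q^ : ∀ n → Homogeneous (+ 0) (q ^ n)
  homogeneous-q^ n = homogeneous-^ (+ 0) {q} (homogeneous-mono 1 (+ 0) _) n

  z : Unit
  z = variable-unit zero

  -- Each of the two geometric series contributes its leading 1, and 1 + 1 - 1 = 1.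
  coefficient-Φ : ∀ n f → coefficient (Φ z n *ₜ trunc f) ≡ coefficient (trunc f)
  coefficient-Φ n f = begin
    coefficient (Φ z n *ₜ T)
      ≡⟨ coefficient-cong (solve 3 (λ a b t → (a :+ b :- :1) :* t := a :* t :+ (b :* t :- t)) R.refl A B T) ⟩
    coefficient ((A *ₜ T) R.+ ((B *ₜ T) R.+ (R.- T)))
      ≡⟨ ≡.trans (∑-++ (A *ₜ T) _ _) (≡.cong (λ i → coefficient (A *ₜ T) ℤ.+ i) (≡.trans (∑-++ (B *ₜ T) _ _) (≡.cong (λ i → coefficient (B *ₜ T) ℤ.+ i) (⟦-⟧ T δ)))) ⟩
    coefficient (A *ₜ T) ℤ.+ (coefficient (B *ₜ T) ℤ.- coefficient T)
      ≡⟨ ≡.cong₂ (λ i j → i ℤ.+ (j ℤ.- coefficient T)) (coefficient-geo (val z *ₜ (q ^ n)) (+ 1 ℤ.+ + 0) f (λ ()) (homogeneous-* (+ 1) (+ 0) {val z} {q ^ n} (homogeneous-mono 0 (+ 1) _) (homogeneous-q^ n)))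
           (coefficient-geo (inv z *ₜ (q ^ n)) (ℤ.-1ℤ ℤ.+ + 0) f (λ ()) (homogeneous-* ℤ.-1ℤ (+ 0) {inv z} {q ^ n} (homogeneous-mono 0 ℤ.-1ℤ _) (homogeneous-q^ n))) ⟩
    coefficient T ℤ.+ (coefficient T ℤ.- coefficient T)
      ≡⟨ ≡.cong (λ i → coefficient T ℤ.+ i) (ℤₚ.+-inverseʳ (coefficient T)) ⟩
    coefficient T ℤ.+ + 0
      ≡⟨ ℤₚ.+-identityʳ (coefficient T) ⟩
    coefficient T                                                               ∎
    where
    T A B : Terms (suc k)
    T = trunc f
    A = geo (val z *ₜ (q ^ n))
    B = geo (inv z *ₜ (q ^ n))

  count-symbols : coefficient (∑ₜ (symbols k) (symbolWeight z (Vec.tabulate X))) ≡ + length (counted {k} (+ 0 ∷ m))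
  count-symbols = begin
    coefficient (∑ₜ (symbols k) (symbolWeight z (Vec.tabulate X)))
      ≡⟨ ⟦∑⟧ (symbols k) (symbolWeight z (Vec.tabulate X)) δ ⟩
    ∑ (symbols k) (λ s → coefficient (symbolWeight z (Vec.tabulate X) s))
      ≡⟨ ∑-cong-∈ (symbols k) (λ { {ps , D} s∈ → ≡.trans (coefficient-cong (symbol-monomial ps D (proj₂ (symbols-sound k s∈))))
                                                   (⟦mono⟧ (weight ps ℕ.+ D ℕ.* D , ranks ps) δ) }) ⟩
    -- At the monomial of a symbol, `target?` and `counted?` unfold to the same decision.
    ∑ (symbols k) (λ s → if ⌊ counted? (+ 0 ∷ m) s ⌋ then + 1 else + 0)
      ≡⟨ ∑-indicator (counted? (+ 0 ∷ m)) (symbols k) ⟩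
    + length (counted {k} (+ 0 ∷ m))                                            ∎

-- Comparison of the two sides.

open Bijection using (counted; DurfeeSet-size)

-- The ring is truncated at the very degree n whose coefficient is read off. The variables number
-- `suc k`, so a chain contains at least the sum over a₁ on which the Bailey steps act; this is
-- where k ≥ 1 enters.
rhsCoeff-counts : ∀ k n (m : Vec ℤ (suc k)) → rhsCoeff (suc k) n m ≡ + length (counted n {suc k} (+ 0 ∷ m))
rhsCoeff-counts k n m = ≡.sym (begin
  + length (counted n {suc k} (+ 0 ∷ m))                                          ≡⟨ ≡.sym count-symbols ⟩
  coefficient (∑ₜ (Bijection.symbols n (suc k)) (symbolWeight z (Vec.tabulate X)))
    ≡⟨ coefficient-cong (symbols-gf z (Vec.tabulate X)) ⟩
  coefficient (∑ₜ< n (λ d → (q ^ (suc d ℕ.* suc d)) *ₜ chain z (Vec.tabulate X) 1 (suc d)))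
    ≡⟨ coefficient-cong (durfee-chains z (X zero) (Vec.tabulate (X ∘ suc))) ⟩
  coefficient (∑ₜ< n (λ i → Φ z (suc i) *ₜ summand (Vec.tabulate X) (suc i)))
    ≡⟨ ⟦∑⟧ (upTo n) (λ i → Φ z (suc i) *ₜ summand (Vec.tabulate X) (suc i)) δ ⟩
  ∑< n (λ i → coefficient (Φ z (suc i) *ₜ summand (Vec.tabulate X) (suc i)))
    ≡⟨ ∑-cong (upTo n) (λ i → coefficient-cong (R.*-congˡ {Φ z (suc i)} (R.sym (trunc-rhsTerm i)))) ⟩
  ∑< n (λ i → coefficient (Φ z (suc i) *ₜ trunc (invPochTo (suc k) n *P rhsTerm (suc k) (suc i))))
    ≡⟨ ∑-cong (upTo n) (λ i → coefficient-Φ (suc i) (invPochTo (suc k) n *P rhsTerm (suc k) (suc i))) ⟩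
  ∑< n (λ i → coefficient (trunc (invPochTo (suc k) n *P rhsTerm (suc k) (suc i))))
    ≡⟨ ≡.sym (⟦∑⟧ (upTo n) (λ i → trunc (invPochTo (suc k) n *P rhsTerm (suc k) (suc i))) δ) ⟩
  coefficient (∑ₜ< n (λ i → trunc (invPochTo (suc k) n *P rhsTerm (suc k) (suc i))))
    ≡⟨ coefficient-cong (R.sym trunc-rhs) ⟩
  coefficient (trunc rhs)                                                         ≡⟨ coefficient-trunc rhs ⟩
  coeffL (rhs n) m                                                                ∎)
  where
  open ≡-Reasoning
  open ℤ-Sums
  open TermRing (suc (suc k)) n
  module R = CommutativeRing termRing
  open Embedding (suc k) n
  open RightHandSide (suc k) n
  open QSeries termRing
  open Truncated q n q^[1+N]≈0
  open ListSums termRing using () renaming (∑ to ∑ₜ; ∑< to ∑ₜ<)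
  open Algebra.Properties.CommutativeSemiring.Exp R.commutativeSemiring using (_^_)
  open GeneratingFunctions termRing
  open Weights q n q^[1+N]≈0
  open Coefficients (suc k) n m

theorem3p1 : (k : ℕ) → 1 ≤ k → (n : ℕ) (m : Vec ℤ k) →
    ∃[ N ] (HasSize (DurfeeSet (suc k) (+ 0 ∷ m) n) N × rhsCoeff k n m ≡ + N)
theorem3p1 (suc k) _ n m = length (counted n {suc k} (+ 0 ∷ m)) , DurfeeSet-size n (+ 0 ∷ m) , rhsCoeff-counts k n m
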